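{- Let $N$ be an integer, let $f_1(t),\ldots,f_n(t)\in\mathbb{Z}[t]$ be non-constant polynomials with positive leading coefficients, and let $g_0(t),g_1(t),\ldots,g_n(t)\in\mathbb{Q}(t)$ be rational functions. Let $v_t$ denote the $t$-adic valuation on $\mathbb{Q}(t)$, and set \[ M=\min\{v_t(g_i(t))\}, \] the minimum being taken over the given rational functions $g_i$. Suppose that all of the following conditions hold. \begin{enumerate} \item \[ v_t\left( g_0(t)-\left( 1-\frac{1}{t}\right)\sum_{\substack{i\\ f_i(1)=0}}g_i(t) -\sum_{\substack{i\\ f_i(1)\geq 2}}\left( 1-t^{f_i(1)-1}\right) \frac{B_{f_i(1)}}{f_i(1)}\,g_i(t)f_i(t) \right)\geq N. \] \item For every even, non-positive integer $k\in\{f_1(1),\ldots,f_n(1)\}$ and every integer $1\leq m\leq N-M$, \[ v_t\left(\sum_{\substack{i\\ f_i(1)= k}} g_i(t)f_i(t)^m\right)\geq N+1-m. \] \item For every even, positive integer $k\in\{f_1(1),\ldots,f_n(1)\}$ and every integer $2\leq m\leq N-M$, \[ v_t\left(\sum_{\substack{i\\ f_i(1)= k}} g_i(t)\big(f_i(t)^m-k^{m-1}f_i(t)\big)\right)\geq N+1-m. \] \end{enumerate} Then for every sufficiently large prime $p$, \[ \sum_{i=1}^n g_i(p)B_{f_i(p)}\equiv g_0(p)\pmod{p^N}. \]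
   Context: The Bernoulli numbers $B_n$ are the rational numbers defined by $\frac{x}{e^x-1}=\sum_{n\geq 0}B_n\frac{x^n}{n!}$. For rational numbers $a,b$ and a prime $p$, the congruence $a\equiv b \pmod{p^N}$ means that the $p$-adic valuation of $a-b$ is at least $N$ (i.e. congruence modulo $p^N\mathbb{Z}_{(p)}$). The sums in the conditions range over indices $i\in\{1,\ldots,n\}$ satisfying the stated condition on $f_i(1)$. -}

module Defs where

open import Data.Nat as ℕ using (ℕ; zero; suc)
open import Data.Nat.Combinatorics using (_C_)
open import Data.Integer as ℤ using (ℤ; +_; -[1+_])
open import Data.Integer.Divisibility as ℤD using ()
open import Data.Rational as ℚ using (ℚ; 0ℚ; 1ℚ; _+_; _*_; _-_; -_; _÷_)
open import Data.Rational.Properties as ℚP using ()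
open import Data.Fin using (Fin)
open import Data.List using (List; []; _∷_; map; foldr; allFin; last; length; filter; _++_; [_])
open import Data.Maybe using (Maybe; just; nothing)
open import Data.Product using (Σ; ∃; _×_; _,_)
open import Data.Unit using (⊤)
open import Data.Empty using (⊥)
open import Relation.Nullary using (¬_; yes; no)
open import Relation.Unary using (Decidable)
open import Data.Integer.Properties as ℤP using ()
open import Relation.Binary.PropositionalEquality using (_≡_; _≢_)

fromℤ : ℤ → ℚ
fromℤ z = z ℚ./ 1

fromℕ : ℕ → ℚ
fromℕ n = fromℤ (+ n)

-- division, with the (irrelevant) convention x / 0 = 0
divQ : ℚ → ℚ → ℚ
divQ p q with q ℚP.≟ 0ℚ
... | yes _ = 0ℚ
... | no q≢0 = _÷_ p q {{ℚ.≢-nonZero q≢0}}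

sumQ : List ℚ → ℚ
sumQ = foldr _+_ 0ℚ

-- Bernoulli numbers, convention x/(e^x-1) = Σ B_n x^n/n!  (B_1 = -1/2):
-- B_0 = 1,  B_n = -1/(n+1) Σ_{k=0}^{n-1} C(n+1,k) B_k  for n ≥ 1.

nextBern : ℕ → List ℚ → ℚ
nextBern n bs = - divQ (sumQ (go 0 bs)) (fromℕ (suc n))
  where
  go : ℕ → List ℚ → List ℚ
  go k [] = []
  go k (b ∷ rest) = fromℕ (suc n C k) * b ∷ go (suc k) rest

bernList : ℕ → List ℚ
bernList zero = 1ℚ ∷ []
bernList (suc n) = bernList n ++ [ nextBern (suc n) (bernList n) ]

lastOr0 : List ℚ → ℚ
lastOr0 xs with last xs
... | just x = x
... | nothing = 0ℚ

Bern : ℕ → ℚ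
Bern n = lastOr0 (bernList n)

-- Polynomials as coefficient lists (constant term first)

PolyZ : Set
PolyZ = List ℤ

PolyQ : Set
PolyQ = List ℚ

evalZ : PolyZ → ℤ → ℤ
evalZ [] x = + 0
evalZ (c ∷ cs) x = c ℤ.+ x ℤ.* evalZ cs x

evalQ : PolyQ → ℚ → ℚ
evalQ [] x = 0ℚ
evalQ (c ∷ cs) x = c + x * evalQ cs x

NonConstPosLead : PolyZ → Set
NonConstPosLead f = (2 ℕ.≤ length f) × ∃ λ k → last f ≡ just (+ suc k)

toQ : PolyZ → PolyQ
toQ = map fromℤ

addP : PolyQ → PolyQ → PolyQ
addP [] q = q
addP (a ∷ p) [] = a ∷ p
addP (a ∷ p) (b ∷ q) = (a + b) ∷ addP p q

scaleP : ℚ → PolyQ → PolyQ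
scaleP c = map (c *_)

negP : PolyQ → PolyQ
negP = scaleP (- 1ℚ)

mulP : PolyQ → PolyQ → PolyQ
mulP [] q = []
mulP (a ∷ p) q = addP (scaleP a q) (0ℚ ∷ mulP p q)

powP : PolyQ → ℕ → PolyQ
powP p zero = 1ℚ ∷ []
powP p (suc m) = mulP p (powP p m)

constP : ℚ → PolyQ
constP c = c ∷ []

monoP : ℕ → PolyQ
monoP zero = 1ℚ ∷ []
monoP (suc k) = 0ℚ ∷ monoP k

-- order of vanishing at t = 0 (nothing = zero polynomial, i.e. ∞)
ordP : PolyQ → Maybe ℕ
ordP [] = nothing
ordP (c ∷ cs) with c ℚP.≟ 0ℚ
... | no _ = just 0
... | yes _ with ordP cs
...   | just k = just (suc k)
...   | nothing = nothing

NonZeroP : PolyQ → Set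
NonZeroP p = ordP p ≢ nothing

record RatFun : Set where
  constructor _⁄_∣_
  field
    num : PolyQ
    den : PolyQ
    den≢0 : NonZeroP den
open RatFun public

-- fractions without the nonzero-denominator proof, used for intermediate
-- expressions (their denominators are products of nonzero polynomials)
Frac : Set
Frac = PolyQ × PolyQ

toFrac : RatFun → Frac
toFrac g = num g , den g

polyF : PolyQ → Frac
polyF p = p , (1ℚ ∷ [])

addF : Frac → Frac → Frac
addF (a , b) (c , d) = addP (mulP a d) (mulP c b) , mulP b d

mulF : Frac → Frac → Frac
mulF (a , b) (c , d) = mulP a c , mulP b d

subF : Frac → Frac → Frac
subF x (c , d) = addF x (negP c , d)

sumF : List Frac → Frac
sumF = foldr addF (polyF [])

-- t-adic valuation (nothing = +∞, for the zero function)
vtF : Frac → Maybe ℤ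
vtF (a , b) with ordP a | ordP b
... | nothing | _ = nothing
... | just i | just j = just (+ i ℤ.- + j)
... | just i | nothing = nothing   -- never happens for a genuine fraction

vt : RatFun → Maybe ℤ
vt g = vtF (toFrac g)

vt≥ : Frac → ℤ → Set
vt≥ h N with vtF h
... | nothing = ⊤
... | just v = N ℤ.≤ v

minM : Maybe ℤ → Maybe ℤ → Maybe ℤ
minM nothing y = y
minM (just x) nothing = just x
minM (just x) (just y) = just (x ℤ.⊓ y)

minVal : ∀ {n} → RatFun → (Fin n → RatFun) → Maybe ℤ
minVal g0 g = foldr minM (vt g0) (map (λ i → vt (g i)) (allFin _))

-- "m ≤ N - M"  (with M = +∞ there is no such m)
≤N-M : ℕ → ℤ → Maybe ℤ → Set
≤N-M m N nothing = ⊥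
≤N-M m N (just M) = + m ℤ.≤ N ℤ.- M

Even : ℤ → Set
Even k = + 2 ℤD.∣ k

at1 : PolyZ → ℤ
at1 f = evalZ f (+ 1)

sumWhere : ∀ {n} → (f : Fin n → PolyZ) → {P : ℤ → Set} → Decidable P
         → (Fin n → Frac) → Frac
sumWhere {n} f P? term = sumF (map term (filter (λ i → P? (at1 (f i))) (allFin n)))

oneMinusInvT : Frac
oneMinusInvT = (- 1ℚ ∷ 1ℚ ∷ []) , (0ℚ ∷ 1ℚ ∷ [])

cond1Term : PolyZ → RatFun → Frac
cond1Term f g =
  mulF (polyF (scaleP (divQ (Bern k) (fromℕ k)) (addP (constP 1ℚ) (negP (monoP (k ℕ.∸ 1))))))
       (mulF (toFrac g) (polyF (toQ f)))
  where k = ℤ.∣ at1 f ∣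

Cond1 : ∀ {n} → ℤ → (Fin n → PolyZ) → RatFun → (Fin n → RatFun) → Set
Cond1 N f g0 g =
  vt≥ (subF (subF (toFrac g0)
                  (mulF oneMinusInvT (sumWhere f (ℤP._≟ + 0) (λ i → toFrac (g i)))))
            (sumWhere f (+ 2 ℤP.≤?_) (λ i → cond1Term (f i) (g i))))
      N

Cond2 : ∀ {n} → ℤ → (Fin n → PolyZ) → RatFun → (Fin n → RatFun) → Set
Cond2 {n} N f g0 g =
  ∀ (k : ℤ) → Even k → k ℤ.≤ + 0 → (∃ λ (i : Fin n) → at1 (f i) ≡ k) →
  ∀ (m : ℕ) → 1 ℕ.≤ m → ≤N-M m N (minVal g0 g) →
  vt≥ (sumWhere f (ℤP._≟ k) (λ i → mulF (toFrac (g i)) (polyF (powP (toQ (f i)) m))))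
      (N ℤ.+ + 1 ℤ.- + m)

Cond3 : ∀ {n} → ℤ → (Fin n → PolyZ) → RatFun → (Fin n → RatFun) → Set
Cond3 {n} N f g0 g =
  ∀ (k : ℤ) → Even k → + 0 ℤ.< k → (∃ λ (i : Fin n) → at1 (f i) ≡ k) →
  ∀ (m : ℕ) → 2 ℕ.≤ m → ≤N-M m N (minVal g0 g) →
  vt≥ (sumWhere f (ℤP._≟ k)
         (λ i → mulF (toFrac (g i))
                     (polyF (addP (powP (toQ (f i)) m)
                                  (negP (scaleP (fromℤ (k ℤ.^ (m ℕ.∸ 1))) (toQ (f i))))))))
      (N ℤ.+ + 1 ℤ.- + m)

-- g(x) = num(x)/den(x)  (convention: 0 if den(x) = 0; irrelevant for large x)
evalRF : RatFun → ℚ → ℚ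
evalRF g x = divQ (evalQ (num g) x) (evalQ (den g) x)

-- q ∈ p^N Z_(p), i.e. q = p^N · a/b with a, b ∈ ℤ and p ∤ b
InPpowN : ℕ → ℤ → ℚ → Set
InPpowN p (+ k) q =
  ∃ λ (a : ℤ) → ∃ λ (b : ℤ) → ¬ (+ p ℤD.∣ b) × (q * fromℤ b ≡ fromℤ (a ℤ.* + (p ℕ.^ k)))
InPpowN p -[1+ k ] q =
  ∃ λ (a : ℤ) → ∃ λ (b : ℤ) → ¬ (+ p ℤD.∣ b) × (q * fromℤ b * fromℕ (p ℕ.^ suc k) ≡ fromℤ a)

CongModPow : ℕ → ℤ → ℚ → ℚ → Set
CongModPow p N a b = InPpowN p N (a - b)

-- Σ_{i=1}^n g_i(p) B_{f_i(p)}   (f_i(p) ≥ 0 for p large, as f_i has positive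
-- leading coefficient; we index B by |f_i(p)|)
bernSum : ∀ {n} → (Fin n → PolyZ) → (Fin n → RatFun) → ℕ → ℚ
bernSum {n} f g p =
  sumQ (map (λ i → evalRF (g i) (fromℕ p) * Bern ℤ.∣ evalZ (f i) (+ p) ∣) (allFin n))

{-# OPTIONS --safe #-}
module Submission where

-- For a prime p, distributing the umbral functional E(xⁿ) = Bₙ over residues modulo p gives
--   p (1 - pⁿ⁻¹) Bₙ = Σ_{0 < a < p} E((a + p x)ⁿ) = Σ_a aⁿ Σ_j C(n, j) a⁻ʲ pʲ Bⱼ.
-- On a class n = k + (p - 1) t one has aⁿ = aᵏ (1 + p q)ᵗ by Fermat, and pʲ C(n, j) is a
-- polynomial in p n with p-integral coefficients for j < p.  So p Bₙ agrees modulo any fixed power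
-- of p with G(p n), G p-integral, that is Bₙ ≡ Σ_m c_m nᵐ with p^(m-1) dividing c_m.  Moreover
-- G(0) ≡ Σ_a a^(k p^K), which is p - 1 for k = 0 and vanishes for other even k, since it is
-- multiplied by 2^(k p^K) when a is replaced by 2 a.  For k > 0 the value at n = k eliminates c_1 in
-- favour of (1 - pᵏ⁻¹) B_k / k.  Substituting n = f_i(p) in each class k = f_i(1), the m-th condition
-- on the class makes the contribution of c_m vanish modulo p^N, and condition 1 is what remains.

open import Defs
open import Algebra.Bundles using (CommutativeRing)
import Algebra.Properties.CommutativeSemiring.Exp as CommExp
import Algebra.Properties.Semiring.Exp as SemiExp
open import Data.Empty using (⊥; ⊥-elim)
open import Data.Fin as Fin using (Fin)
open import Data.Integer as ℤ using (ℤ; +_; -[1+_])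
import Data.Integer.Divisibility as ℤD
import Data.Integer.Properties as ℤP
import Data.Integer.Tactic.RingSolver as ℤSolver
open import Data.List using (List; []; _∷_; map; foldr; allFin; last; length; filter; _++_; [_])
open import Data.List.Properties using (length-++)
open import Data.List.Relation.Unary.All using (All; []; _∷_)
open import Data.List.Relation.Unary.Any using (Any; here; there)
import Data.List.Relation.Unary.Any as Any
open import Data.List.Membership.Propositional using (_∈_)
open import Data.List.Membership.Propositional.Properties using (∈-allFin)
open import Data.Maybe using (Maybe; just; nothing)
open import Data.Nat as ℕ using (ℕ; zero; suc; _≤_; _<_; z≤n; s≤s)
open import Data.Nat.Combinatorics using (_C_; nCk+nC[k+1]≡[n+1]C[k+1]; nC1≡n; nCn≡1; nCk≡nC[n∸k]; k>n⇒nCk≡0)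
import Data.Nat.Divisibility as ℕD
open import Data.Nat.Induction using (<-rec)
open import Data.Nat.Primality using (Prime; euclidsLemma; prime⇒nonZero; prime⇒nonTrivial; prime⇒irreducible)
import Data.Nat.Properties as ℕP
import Data.Nat.Tactic.RingSolver as ℕSolver
open import Data.Product using (∃; _×_; _,_; proj₁; proj₂)
open import Data.Rational as ℚ using (ℚ; 0ℚ; 1ℚ; _+_; _*_; _-_; -_; 1/_)
import Data.Rational.Properties as ℚP
import Data.Rational.Unnormalised as ℚᵘ
import Data.Rational.Unnormalised.Properties as ℚᵘP
open import Data.Sum using (_⊎_; inj₁; inj₂)
open import Data.Unit using (⊤; tt)
open import Function using (_∘_; id)
open import Relation.Binary.PropositionalEquality hiding ([_])
open import Relation.Nullary using (¬_; Dec; yes; no)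
open import Relation.Nullary.Decidable using (dec⇒maybe)
open import Relation.Unary using (Decidable)
open import Tactic.RingSolver using (solve-∀)
open import Tactic.RingSolver.Core.AlmostCommutativeRing using (AlmostCommutativeRing; fromCommutativeRing)

open SemiExp (CommutativeRing.semiring ℚP.+-*-commutativeRing) using (_^_; ^-homo-*; ^-assocʳ)
open CommExp (CommutativeRing.commutativeSemiring ℚP.+-*-commutativeRing) using (^-distrib-*)

open ≡-Reasoning

-- Precision is governed by one integer K = |N - M|: the gᵢ(p) have valuation at least M, so Bₙ is
-- needed modulo pᴷ, hence p Bₙ modulo pᴷ⁺¹. The degree of G is left uncontrolled; what counts is
-- that its coefficients are p-integral and that its variable is p n. Two denominators limit the
-- Newton series: C(n, j) brings in j!, harmless for j < p, and Bⱼ may contain p from j = p - 1 on.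
-- Below j = p - 1 neither intervenes, and the later terms are 0 modulo pᴷ⁺¹ once p ≥ K + 3. The
-- multiplier 2 takes the place of a primitive root: for k ≠ 0 and 2^|k| ≤ p it is clear from size
-- alone that 2^|k| is not 1 modulo p. A negative k is represented by p - 1 - |k|, the least
-- nonnegative member of its class. Conditions 2 and 3 stop at m = N - M; beyond that point the same
-- inequalities follow from the definition of M, so the induction over the coefficients of G has
-- them for every m. Odd classes contribute 0, since Bₙ = 0 for odd n ≥ 3.

ringℚ : AlmostCommutativeRing _ _
ringℚ = fromCommutativeRing ℚP.+-*-commutativeRing (λ x → dec⇒maybe (0ℚ ℚP.≟ x))

-- Integers inside ℚ, cancellation and finite sums.

fromℤ-toℚᵘ : ∀ z → ℚ.toℚᵘ (fromℤ z) ℚᵘ.≃ ℚᵘ.mkℚᵘ z 0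
fromℤ-toℚᵘ z = ℚP.toℚᵘ-fromℚᵘ (ℚᵘ.mkℚᵘ z 0)

fromℤ-+ : ∀ x y → fromℤ (x ℤ.+ y) ≡ fromℤ x + fromℤ y
fromℤ-+ x y = ℚP.toℚᵘ-injective
  (ℚᵘP.≃-trans (fromℤ-toℚᵘ (x ℤ.+ y))
  (ℚᵘP.≃-trans (ℚᵘ.*≡* (ring x y))
  (ℚᵘP.≃-trans (ℚᵘP.+-cong (ℚᵘP.≃-sym (fromℤ-toℚᵘ x)) (ℚᵘP.≃-sym (fromℤ-toℚᵘ y)))
               (ℚᵘP.≃-sym (ℚP.toℚᵘ-homo-+ (fromℤ x) (fromℤ y))))))
  where
  ring : ∀ x y → (x ℤ.+ y) ℤ.* (+ 1 ℤ.* + 1) ≡ (x ℤ.* + 1 ℤ.+ y ℤ.* + 1) ℤ.* + 1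
  ring = ℤSolver.solve-∀

fromℤ-* : ∀ x y → fromℤ (x ℤ.* y) ≡ fromℤ x * fromℤ y
fromℤ-* x y = ℚP.toℚᵘ-injective
  (ℚᵘP.≃-trans (fromℤ-toℚᵘ (x ℤ.* y))
  (ℚᵘP.≃-trans (ℚᵘ.*≡* (ring x y))
  (ℚᵘP.≃-trans (ℚᵘP.*-cong (ℚᵘP.≃-sym (fromℤ-toℚᵘ x)) (ℚᵘP.≃-sym (fromℤ-toℚᵘ y)))
               (ℚᵘP.≃-sym (ℚP.toℚᵘ-homo-* (fromℤ x) (fromℤ y))))))
  where
  ring : ∀ x y → (x ℤ.* y) ℤ.* (+ 1 ℤ.* + 1) ≡ (x ℤ.* y) ℤ.* + 1
  ring = ℤSolver.solve-∀

fromℤ-neg : ∀ x → fromℤ (ℤ.- x) ≡ - fromℤ x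
fromℤ-neg x = begin
  fromℤ (ℤ.- x)                                ≡⟨ ring₁ (fromℤ (ℤ.- x)) (fromℤ x) ⟩
  fromℤ (ℤ.- x) + fromℤ x + - fromℤ x          ≡⟨ cong (_+ - fromℤ x) (sym (fromℤ-+ (ℤ.- x) x)) ⟩
  fromℤ (ℤ.- x ℤ.+ x) + - fromℤ x              ≡⟨ cong (λ z → fromℤ z + - fromℤ x) (ℤP.+-inverseˡ x) ⟩
  0ℚ + - fromℤ x                               ≡⟨ ℚP.+-identityˡ _ ⟩
  - fromℤ x                                    ∎
  where
  ring₁ : ∀ a b → a ≡ a + b + - b
  ring₁ = solve-∀ ringℚ

fromℤ-injective : ∀ {x y} → fromℤ x ≡ fromℤ y → x ≡ y
fromℤ-injective {x} {y} e with ℚᵘP.≃-trans (ℚᵘP.≃-sym (fromℤ-toℚᵘ x))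
                                (ℚᵘP.≃-trans (ℚP.toℚᵘ-cong e) (fromℤ-toℚᵘ y))
... | ℚᵘ.*≡* e′ = trans (sym (ℤP.*-identityʳ x)) (trans e′ (ℤP.*-identityʳ y))

fromℤ≢0 : ∀ {x} → x ≢ + 0 → fromℤ x ≢ 0ℚ
fromℤ≢0 x≢0 e = x≢0 (fromℤ-injective e)

fromℕ-+ : ∀ m n → fromℕ (m ℕ.+ n) ≡ fromℕ m + fromℕ n
fromℕ-+ m n = fromℤ-+ (+ m) (+ n)

fromℕ-* : ∀ m n → fromℕ (m ℕ.* n) ≡ fromℕ m * fromℕ n
fromℕ-* m n = trans (cong fromℤ (ℤP.pos-* m n)) (fromℤ-* (+ m) (+ n))

fromℕ-^ : ∀ m n → fromℕ (m ℕ.^ n) ≡ fromℕ m ^ n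
fromℕ-^ m zero = refl
fromℕ-^ m (suc n) = trans (fromℕ-* m (m ℕ.^ n)) (cong (fromℕ m *_) (fromℕ-^ m n))

fromℕ-suc : ∀ n → fromℕ (suc n) ≡ 1ℚ + fromℕ n
fromℕ-suc n = fromℕ-+ 1 n

fromℕ-suc≢0 : ∀ n → fromℕ (suc n) ≢ 0ℚ
fromℕ-suc≢0 n = fromℤ≢0 {+ suc n} (λ ())

*-cancelʳ : ∀ {x y} z → z ≢ 0ℚ → x * z ≡ y * z → x ≡ y
*-cancelʳ {x} {y} z z≢0 e = begin
  x                ≡⟨ sym (ℚP.*-identityʳ x) ⟩
  x * 1ℚ           ≡⟨ cong (x *_) (sym (ℚP.*-inverseʳ z)) ⟩
  x * (z * 1/ z)   ≡⟨ sym (ℚP.*-assoc x z (1/ z)) ⟩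
  x * z * 1/ z     ≡⟨ cong (_* 1/ z) e ⟩
  y * z * 1/ z     ≡⟨ ℚP.*-assoc y z (1/ z) ⟩
  y * (z * 1/ z)   ≡⟨ cong (y *_) (ℚP.*-inverseʳ z) ⟩
  y * 1ℚ           ≡⟨ ℚP.*-identityʳ y ⟩
  y                ∎
  where instance _ = ℚ.≢-nonZero z≢0

*-cancelˡ : ∀ {x y} z → z ≢ 0ℚ → z * x ≡ z * y → x ≡ y
*-cancelˡ {x} {y} z z≢0 e =
  *-cancelʳ z z≢0 (trans (ℚP.*-comm x z) (trans e (ℚP.*-comm z y)))

*-nonzero : ∀ {x y} → x ≢ 0ℚ → y ≢ 0ℚ → x * y ≢ 0ℚ
*-nonzero {x} {y} x≢0 y≢0 e =
  x≢0 (*-cancelʳ y y≢0 (trans e (sym (ℚP.*-zeroˡ y))))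

x-y≡0⇒x≡y : ∀ {x y} → x - y ≡ 0ℚ → x ≡ y
x-y≡0⇒x≡y {x} {y} e = begin
  x            ≡⟨ ring x y ⟩
  (x - y) + y  ≡⟨ cong (_+ y) e ⟩
  0ℚ + y       ≡⟨ ℚP.+-identityˡ y ⟩
  y            ∎
  where
  ring : ∀ x y → x ≡ (x - y) + y
  ring = solve-∀ ringℚ

divQ-* : ∀ x {y} → y ≢ 0ℚ → divQ x y * y ≡ x
divQ-* x {y} y≢0 with y ℚP.≟ 0ℚ
... | yes e = ⊥-elim (y≢0 e)
... | no ne = begin
  x * 1/ y * y    ≡⟨ ℚP.*-assoc x (1/ y) y ⟩
  x * (1/ y * y)  ≡⟨ cong (x *_) (ℚP.*-inverseˡ y) ⟩
  x * 1ℚ          ≡⟨ ℚP.*-identityʳ x ⟩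
  x               ∎
  where instance _ = ℚ.≢-nonZero ne

divQ-unique : ∀ {x y z} → y ≢ 0ℚ → z * y ≡ x → divQ x y ≡ z
divQ-unique {x} {y} y≢0 e = *-cancelʳ y y≢0 (trans (divQ-* x y≢0) (sym e))

1^ : ∀ n → 1ℚ ^ n ≡ 1ℚ
1^ zero = refl
1^ (suc n) = trans (ℚP.*-identityˡ _) (1^ n)

sumTo : ℕ → (ℕ → ℚ) → ℚ
sumTo zero f = 0ℚ
sumTo (suc n) f = sumTo n f + f n

sumTo-cong : ∀ n {f g} → (∀ i → i < n → f i ≡ g i) → sumTo n f ≡ sumTo n g
sumTo-cong zero e = refl
sumTo-cong (suc n) e =
  cong₂ _+_ (sumTo-cong n (λ i i<n → e i (ℕP.m<n⇒m<1+n i<n))) (e n (ℕP.n<1+n n))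

sumTo-+ : ∀ n f g → sumTo n (λ i → f i + g i) ≡ sumTo n f + sumTo n g
sumTo-+ zero f g = refl
sumTo-+ (suc n) f g = trans (cong (_+ (f n + g n)) (sumTo-+ n f g)) (ring (sumTo n f) (sumTo n g) (f n) (g n))
  where
  ring : ∀ a b c d → a + b + (c + d) ≡ a + c + (b + d)
  ring = solve-∀ ringℚ

sumTo-* : ∀ n c f → sumTo n (λ i → c * f i) ≡ c * sumTo n f
sumTo-* zero c f = sym (ℚP.*-zeroʳ c)
sumTo-* (suc n) c f =
  trans (cong (_+ c * f n) (sumTo-* n c f)) (sym (ℚP.*-distribˡ-+ c (sumTo n f) (f n)))

sumTo-head : ∀ n f → sumTo (suc n) f ≡ f 0 + sumTo n (f ∘ suc)
sumTo-head zero f = trans (ℚP.+-identityˡ (f 0)) (sym (ℚP.+-identityʳ (f 0)))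
sumTo-head (suc n) f = trans (cong (_+ f (suc n)) (sumTo-head n f))
        (ℚP.+-assoc (f 0) (sumTo n (f ∘ suc)) (f (suc n)))

-- Umbral calculus: if u represents a functional with moments u n = E(xⁿ), then
-- translate a u n = E((x + a)ⁿ), and shift u has moments E(x · xⁿ).

shift : (ℕ → ℚ) → ℕ → ℚ
shift u n = u (suc n)

translate : ℚ → (ℕ → ℚ) → ℕ → ℚ
translate a u zero = u 0
translate a u (suc n) = translate a (shift u) n + a * translate a u n

translate-cong : ∀ {a b u v} → a ≡ b → (∀ i → u i ≡ v i) → ∀ n → translate a u n ≡ translate b v n
translate-cong refl e zero = e 0
translate-cong {a} refl e (suc n) =
  cong₂ (λ x y → x + a * y) (translate-cong refl (e ∘ suc) n) (translate-cong refl e n)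

translate-linear : ∀ a b u v n →
  translate a (λ i → u i + b * v i) n ≡ translate a u n + b * translate a v n
translate-linear a b u v zero = refl
translate-linear a b u v (suc n) =
  trans (cong₂ (λ x y → x + a * y) (translate-linear a b (shift u) (shift v) n)
                                   (translate-linear a b u v n))
        (ring a b (translate a (shift u) n) (translate a (shift v) n) (translate a u n) (translate a v n))
  where
  ring : ∀ a b x y z t → x + b * y + a * (z + b * t) ≡ x + a * z + b * (y + a * t)
  ring = solve-∀ ringℚ

translate-zero : ∀ a n → translate a (λ _ → 0ℚ) n ≡ 0ℚ
translate-zero a zero = refl
translate-zero a (suc n) =
  trans (cong₂ (λ x y → x + a * y) (translate-zero a n) (translate-zero a n)) (ring a)
  where
  ring : ∀ a → 0ℚ + a * 0ℚ ≡ 0ℚ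
  ring = solve-∀ ringℚ

translate-sumTo : ∀ a m (u : ℕ → ℕ → ℚ) n →
  translate a (λ i → sumTo m (λ j → u j i)) n ≡ sumTo m (λ j → translate a (u j) n)
translate-sumTo a zero u n = translate-zero a n
translate-sumTo a (suc m) u n = begin
  translate a (λ i → sumTo m (λ j → u j i) + u m i) n
    ≡⟨ translate-cong refl (λ i → cong (λ z → sumTo m (λ j → u j i) + z) (sym (ℚP.*-identityˡ (u m i)))) n ⟩
  translate a (λ i → sumTo m (λ j → u j i) + 1ℚ * u m i) n
    ≡⟨ translate-linear a 1ℚ _ (u m) n ⟩
  translate a (λ i → sumTo m (λ j → u j i)) n + 1ℚ * translate a (u m) n
    ≡⟨ cong₂ _+_ (translate-sumTo a m u n) (ℚP.*-identityˡ _) ⟩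
  sumTo (suc m) (λ j → translate a (u j) n) ∎

translate-translate : ∀ a b u n → translate b (translate a u) n ≡ translate (a + b) u n
translate-translate a b u zero = refl
translate-translate a b u (suc n) = begin
  translate b (λ i → translate a (shift u) i + a * translate a u i) n + b * translate b (translate a u) n
    ≡⟨ cong (_+ b * translate b (translate a u) n) (translate-linear b a (translate a (shift u)) (translate a u) n) ⟩
  translate b (translate a (shift u)) n + a * translate b (translate a u) n + b * translate b (translate a u) n
    ≡⟨ cong₂ (λ x y → x + a * y + b * y) (translate-translate a b (shift u) n) (translate-translate a b u n) ⟩
  translate (a + b) (shift u) n + a * translate (a + b) u n + b * translate (a + b) u n
    ≡⟨ ring a b (translate (a + b) (shift u) n) (translate (a + b) u n) ⟩
  translate (a + b) (shift u) n + (a + b) * translate (a + b) u n ∎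
  where
  ring : ∀ a b x y → x + a * y + b * y ≡ x + (a + b) * y
  ring = solve-∀ ringℚ

translate-scale : ∀ c a u n → translate (c * a) (λ i → c ^ i * u i) n ≡ c ^ n * translate a u n
translate-scale c a u zero = refl
translate-scale c a u (suc n) = begin
  translate (c * a) (λ i → c * c ^ i * u (suc i)) n + c * a * translate (c * a) (λ i → c ^ i * u i) n
    ≡⟨ cong₂ (λ x y → x + c * a * y)
         (trans (translate-cong refl (λ i → step i) n)
         (trans (translate-linear (c * a) c (λ _ → 0ℚ) (λ i → c ^ i * u (suc i)) n)
                (cong₂ (λ x y → x + c * y) (translate-zero (c * a) n) (translate-scale c a (shift u) n))))
         (translate-scale c a u n) ⟩
  0ℚ + c * (c ^ n * translate a (shift u) n) + c * a * (c ^ n * translate a u n)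
    ≡⟨ ring₂ c a (c ^ n) (translate a (shift u) n) (translate a u n) ⟩
  c * c ^ n * (translate a (shift u) n + a * translate a u n) ∎
  where
  ring₁ : ∀ c x y → c * x * y ≡ 0ℚ + c * (x * y)
  ring₁ = solve-∀ ringℚ
  step : ∀ i → c * c ^ i * u (suc i) ≡ 0ℚ + c * (c ^ i * u (suc i))
  step i = ring₁ c (c ^ i) (u (suc i))
  ring₂ : ∀ c a x y z → 0ℚ + c * (x * y) + c * a * (x * z) ≡ c * x * (y + a * z)
  ring₂ = solve-∀ ringℚ

translate-^ : ∀ a x n → translate a (x ^_) n ≡ (x + a) ^ n
translate-^ a x zero = refl
translate-^ a x (suc n) = begin
  translate a (λ i → x * x ^ i) n + a * translate a (x ^_) n
    ≡⟨ cong (_+ a * translate a (x ^_) n)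
         (trans (translate-cong refl (λ i → sym (ℚP.+-identityˡ (x * x ^ i))) n)
         (trans (translate-linear a x (λ _ → 0ℚ) (x ^_) n)
                (cong (_+ x * translate a (x ^_) n) (translate-zero a n)))) ⟩
  0ℚ + x * translate a (x ^_) n + a * translate a (x ^_) n
    ≡⟨ cong (λ y → 0ℚ + x * y + a * y) (translate-^ a x n) ⟩
  0ℚ + x * (x + a) ^ n + a * (x + a) ^ n
    ≡⟨ ring a x ((x + a) ^ n) ⟩
  (x + a) * (x + a) ^ n ∎
  where
  ring : ∀ a x y → 0ℚ + x * y + a * y ≡ (x + a) * y
  ring = solve-∀ ringℚ

-- In Σ C(n, i) d i only the top coefficient C(n, n) = 1 survives; the next lemma needs in addition
-- C(n + 1, n) = n + 1. Both are read off the recursion, without binomial coefficients.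
translate1-lowest : ∀ n d → (∀ i → i < n → d i ≡ 0ℚ) → translate 1ℚ d n ≡ d n
translate1-lowest zero d z = refl
translate1-lowest (suc n) d z = begin
  translate 1ℚ (shift d) n + 1ℚ * translate 1ℚ d n
    ≡⟨ cong₂ (λ x y → x + 1ℚ * y) (translate1-lowest n (shift d) (λ i i<n → z (suc i) (s≤s i<n)))
         (trans (translate1-lowest n d (λ i i<n → z i (ℕP.m<n⇒m<1+n i<n))) (z n (ℕP.n<1+n n))) ⟩
  d (suc n) + 1ℚ * 0ℚ ≡⟨ ring (d (suc n)) ⟩
  d (suc n) ∎
  where
  ring : ∀ x → x + 1ℚ * 0ℚ ≡ x
  ring = solve-∀ ringℚ

translate1-second : ∀ n d → (∀ i → i < n → d i ≡ 0ℚ) →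
  translate 1ℚ d (suc n) ≡ fromℕ (suc n) * d n + d (suc n)
translate1-second zero d z = ring (d 0) (d 1)
  where
  ring : ∀ x y → y + 1ℚ * x ≡ 1ℚ * x + y
  ring = solve-∀ ringℚ
translate1-second (suc n) d z = begin
  translate 1ℚ (shift d) (suc n) + 1ℚ * translate 1ℚ d (suc n)
    ≡⟨ cong₂ (λ x y → x + 1ℚ * y) (translate1-second n (shift d) (λ i i<n → z (suc i) (s≤s i<n)))
             (translate1-lowest (suc n) d z) ⟩
  fromℕ (suc n) * d (suc n) + d (suc (suc n)) + 1ℚ * d (suc n)
    ≡⟨ ring (fromℕ (suc n)) (d (suc n)) (d (suc (suc n))) ⟩
  (1ℚ + fromℕ (suc n)) * d (suc n) + d (suc (suc n))
    ≡⟨ cong (λ x → x * d (suc n) + d (suc (suc n))) (sym (fromℕ-suc (suc n))) ⟩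
  fromℕ (suc (suc n)) * d (suc n) + d (suc (suc n)) ∎
  where
  ring : ∀ a x y → a * x + y + 1ℚ * x ≡ (1ℚ + a) * x + y
  ring = solve-∀ ringℚ

-- Every polynomial is a difference q(x + 1) - q(x), so a functional that is invariant under
-- translation by 1 is zero. Concretely, once the moments below n vanish, invariance at `suc n`
-- leaves `fromℕ (suc n) * d n ≡ 0ℚ`.
translate1-fixed : ∀ d → (∀ n → translate 1ℚ d n ≡ d n) → ∀ n → d n ≡ 0ℚ
translate1-fixed d fix = <-rec _ λ n rec →
  *-cancelˡ (fromℕ (suc n)) (fromℕ-suc≢0 n) (begin
    fromℕ (suc n) * d n                            ≡⟨ ring (fromℕ (suc n) * d n) (d (suc n)) ⟩
    fromℕ (suc n) * d n + d (suc n) - d (suc n)    ≡⟨ cong (_- d (suc n)) (sym (translate1-second n d (λ i i<n → rec i<n))) ⟩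
    translate 1ℚ d (suc n) - d (suc n)             ≡⟨ cong (_- d (suc n)) (fix (suc n)) ⟩
    d (suc n) - d (suc n)                          ≡⟨ ring′ (d (suc n)) (fromℕ (suc n)) ⟩
    fromℕ (suc n) * 0ℚ                             ∎)
  where
  ring : ∀ x y → x ≡ x + y - y
  ring = solve-∀ ringℚ
  ring′ : ∀ x y → x - x ≡ y * 0ℚ
  ring′ = solve-∀ ringℚ

-- The replacement for generating functions: an identity between moment sequences holds as soon as
-- both sides gain the same amount under x ↦ x + 1. The multiplication and the reflection formula
-- are proved in this way.
translate1-unique : ∀ {u v} (r : ℕ → ℚ) → (∀ n → translate 1ℚ u n ≡ u n + r n) →
  (∀ n → translate 1ℚ v n ≡ v n + r n) → ∀ n → u n ≡ v n
translate1-unique {u} {v} r eu ev n =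
  x-y≡0⇒x≡y (trans (minus (u n) (v n)) (translate1-fixed (λ i → u i + (- 1ℚ) * v i) fixed n))
  where
  minus : ∀ x y → x - y ≡ x + (- 1ℚ) * y
  minus = solve-∀ ringℚ
  ring : ∀ x y r → x + r + (- 1ℚ) * (y + r) ≡ x + (- 1ℚ) * y
  ring = solve-∀ ringℚ
  fixed : ∀ n → translate 1ℚ (λ i → u i + (- 1ℚ) * v i) n ≡ u n + (- 1ℚ) * v n
  fixed n = trans (translate-linear 1ℚ (- 1ℚ) u v n)
    (trans (cong₂ (λ x y → x + (- 1ℚ) * y) (eu n) (ev n)) (ring (u n) (v n) (r n)))

translate1-binomial : ∀ n w → translate 1ℚ w n ≡ sumTo (suc n) (λ k → fromℕ (n C k) * w k)
translate1-binomial zero w = ring (w 0)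
  where
  ring : ∀ x → x ≡ 0ℚ + 1ℚ * x
  ring = solve-∀ ringℚ
translate1-binomial (suc n) w = begin
  translate 1ℚ (shift w) n + 1ℚ * translate 1ℚ w n
    ≡⟨ cong₂ (λ x y → x + 1ℚ * y) (translate1-binomial n (shift w))
         -- The term with C(n, n + 1) = 0 is appended, so that after its head is removed this sum
         -- has the same range as `S′`.
         (trans (translate1-binomial n w) (sym (trans (cong (λ z → S + z) last≡0) (ℚP.+-identityʳ S)))) ⟩
  S′ + 1ℚ * sumTo (suc (suc n)) (λ k → fromℕ (n C k) * w k)
    ≡⟨ cong (λ z → S′ + 1ℚ * z) (sumTo-head (suc n) (λ k → fromℕ (n C k) * w k)) ⟩
  S′ + 1ℚ * (fromℕ (n C 0) * w 0 + S″)
    ≡⟨ ring S′ S″ (fromℕ (n C 0) * w 0) ⟩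
  fromℕ (n C 0) * w 0 + (S′ + S″)
    ≡⟨ cong₂ _+_ (cong (λ c → fromℕ c * w 0) (trans (nC0≡1 n) (sym (nC0≡1 (suc n)))))
         (trans (sym (sumTo-+ (suc n) (λ k → fromℕ (n C k) * w (suc k)) (λ k → fromℕ (n C suc k) * w (suc k))))
                (sumTo-cong (suc n) (λ k _ → pascal k))) ⟩
  fromℕ (suc n C 0) * w 0 + sumTo (suc n) (λ k → fromℕ (suc n C suc k) * w (suc k))
    ≡⟨ sym (sumTo-head (suc n) (λ k → fromℕ (suc n C k) * w k)) ⟩
  sumTo (suc (suc n)) (λ k → fromℕ (suc n C k) * w k) ∎
  where
  S = sumTo (suc n) (λ k → fromℕ (n C k) * w k)
  S′ = sumTo (suc n) (λ k → fromℕ (n C k) * w (suc k))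
  S″ = sumTo (suc n) (λ k → fromℕ (n C suc k) * w (suc k))
  nC0≡1 : ∀ n → n C 0 ≡ 1
  nC0≡1 n = trans (nCk≡nC[n∸k] {0} {n} z≤n) (nCn≡1 n)
  last≡0 : fromℕ (n C suc n) * w (suc n) ≡ 0ℚ
  last≡0 = trans (cong (λ c → fromℕ c * w (suc n)) (k>n⇒nCk≡0 (ℕP.n<1+n n))) (ℚP.*-zeroˡ (w (suc n)))
  ring : ∀ a b c → a + 1ℚ * (c + b) ≡ c + (a + b)
  ring = solve-∀ ringℚ
  pascal : ∀ k → fromℕ (n C k) * w (suc k) + fromℕ (n C suc k) * w (suc k) ≡ fromℕ (suc n C suc k) * w (suc k)
  pascal k = begin
    fromℕ (n C k) * w (suc k) + fromℕ (n C suc k) * w (suc k)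
      ≡⟨ sym (ℚP.*-distribʳ-+ (w (suc k)) (fromℕ (n C k)) (fromℕ (n C suc k))) ⟩
    (fromℕ (n C k) + fromℕ (n C suc k)) * w (suc k)
      ≡⟨ cong (_* w (suc k)) (sym (fromℕ-+ (n C k) (n C suc k))) ⟩
    fromℕ (n C k ℕ.+ n C suc k) * w (suc k)
      ≡⟨ cong (λ c → fromℕ c * w (suc k)) (nCk+nC[k+1]≡[n+1]C[k+1] n k) ⟩
    fromℕ (suc n C suc k) * w (suc k) ∎

-- nextBern sums with a function local to its where block, which cannot be
-- named; weightedSum n bs k cs is solved by unification to the sum of that
-- function's values from position k on.  Two list elements are exposed so that
-- the position is a numeral occurring nowhere else in the goal.
mutual
  weightedSum : ℕ → List ℚ → ℕ → List ℚ → ℚ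
  weightedSum = _

  nextBern-unfold₂ : ∀ n b c bs → nextBern n (b ∷ c ∷ bs) ≡
    - divQ (fromℕ (suc n C 0) * b + (fromℕ (suc n C 1) * c + weightedSum n (b ∷ c ∷ bs) 2 bs)) (fromℕ (suc n))
  nextBern-unfold₂ n b c bs =
    cong (λ z → - divQ (fromℕ (suc n C 0) * b + (fromℕ (suc n C 1) * c + z)) (fromℕ (suc n))) (tail-unfold n b c bs)

  tail-unfold : ∀ n b c bs → _ ≡ weightedSum n (b ∷ c ∷ bs) 2 bs
  -- After this abstraction the arguments of the unknown `weightedSum` are distinct variables, so
  -- unification has a unique solution.
  tail-unfold n b c bs with b List.∷ c List.∷ bs | 2
  ... | bs′ | k = refl

nextBern-unfold : ∀ n bs → nextBern n bs ≡ - divQ (weightedSum n bs 0 bs) (fromℕ (suc n))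
nextBern-unfold n [] = refl
nextBern-unfold n (b ∷ []) = refl
nextBern-unfold n (b ∷ c ∷ bs) = nextBern-unfold₂ n b c bs

weightedSum-snoc : ∀ n bs k cs x → weightedSum n bs k (cs ++ [ x ])
  ≡ weightedSum n bs k cs + fromℕ (suc n C (k ℕ.+ length cs)) * x
weightedSum-snoc n bs k [] x =
  trans (cong (λ j → fromℕ (suc n C j) * x + 0ℚ) (sym (ℕP.+-identityʳ k))) (ℚP.+-comm (fromℕ (suc n C (k ℕ.+ 0)) * x) 0ℚ)
weightedSum-snoc n bs k (c ∷ cs) x =
  trans (cong (λ z → fromℕ (suc n C k) * c + z)
          (trans (weightedSum-snoc n bs (suc k) cs x)
                 (cong (λ j → weightedSum n bs (suc k) cs + fromℕ (suc n C j) * x) (sym (ℕP.+-suc k (length cs))))))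
        (sym (ℚP.+-assoc (fromℕ (suc n C k) * c) (weightedSum n bs (suc k) cs)
                         (fromℕ (suc n C (k ℕ.+ suc (length cs))) * x)))

last-snoc : ∀ (xs : List ℚ) x → last (xs ++ [ x ]) ≡ just x
last-snoc [] x = refl
last-snoc (y ∷ []) x = refl
last-snoc (y ∷ z ∷ xs) x = last-snoc (z ∷ xs) x

lastOr0-snoc : ∀ xs x → lastOr0 (xs ++ [ x ]) ≡ x
lastOr0-snoc xs x rewrite last-snoc xs x = refl

length-bernList : ∀ n → length (bernList n) ≡ suc n
length-bernList zero = refl
length-bernList (suc n) = trans (length-++ (bernList n)) (trans (ℕP.+-comm (length (bernList n)) 1) (cong suc (length-bernList n)))

Bern-suc : ∀ n → Bern (suc n) ≡ nextBern (suc n) (bernList n)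
Bern-suc n = lastOr0-snoc (bernList n) (nextBern (suc n) (bernList n))

weightedSum-bernList : ∀ N bs n → weightedSum N bs 0 (bernList n) ≡ sumTo (suc n) (λ k → fromℕ (suc N C k) * Bern k)
weightedSum-bernList N bs zero = ℚP.+-comm (fromℕ (suc N C 0) * 1ℚ) 0ℚ
weightedSum-bernList N bs (suc n) =
  trans (weightedSum-snoc N bs 0 (bernList n) (nextBern (suc n) (bernList n)))
        (cong₂ _+_ (weightedSum-bernList N bs n)
          (cong₂ (λ j x → fromℕ (suc N C j) * x) (length-bernList n) (sym (Bern-suc n))))

-- Recurrence, multiplication formula and reflection formula for Bernoulli numbers.

Bern-recurrence : ∀ n → sumTo (suc (suc n)) (λ k → fromℕ (suc (suc n) C k) * Bern k) ≡ 0ℚ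
Bern-recurrence n = begin
  S + fromℕ (suc (suc n) C suc n) * Bern (suc n)
    ≡⟨ cong₂ (λ c x → S + fromℕ c * x)
         (trans (nCk≡nC[n∸k] {suc n} {suc (suc n)} (ℕP.n≤1+n _))
                (trans (cong (suc (suc n) C_) (ℕP.m+n∸n≡m 1 (suc n))) (nC1≡n (suc (suc n)))))
         (trans (Bern-suc n) (trans (nextBern-unfold (suc n) (bernList n))
           (cong (λ z → - divQ z (fromℕ (suc (suc n)))) (weightedSum-bernList (suc n) (bernList n) n)))) ⟩
  S + d * - divQ S d   ≡⟨ ring S d (divQ S d) ⟩
  S - divQ S d * d     ≡⟨ cong (λ z → S - z) (divQ-* S (fromℕ-suc≢0 (suc n))) ⟩
  S - S                ≡⟨ ℚP.+-inverseʳ S ⟩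
  0ℚ                   ∎
  where
  S = sumTo (suc n) (λ k → fromℕ (suc (suc n) C k) * Bern k)
  d = fromℕ (suc (suc n))
  ring : ∀ s d x → s + d * - x ≡ s - x * d
  ring = solve-∀ ringℚ

-- The moments of the functional q ↦ q′(0).
δ₁ : ℕ → ℚ
δ₁ 1 = 1ℚ
δ₁ _ = 0ℚ

-- The equation E(q(x + 1)) - E(q(x)) = q′(0), which characterises E by `translate1-unique`. In
-- degree at least 2 it is the recurrence with the top term kept apart; degrees 0 and 1 are
-- computed.
translate1-Bern : ∀ n → translate 1ℚ Bern n ≡ Bern n + δ₁ n
translate1-Bern zero = refl
translate1-Bern (suc zero) = refl
translate1-Bern (suc (suc n)) = begin
  translate 1ℚ Bern (suc (suc n))
    ≡⟨ translate1-binomial (suc (suc n)) Bern ⟩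
  sumTo (suc (suc n)) (λ k → fromℕ (suc (suc n) C k) * Bern k) + fromℕ (suc (suc n) C suc (suc n)) * Bern (suc (suc n))
    ≡⟨ cong₂ (λ x c → x + fromℕ c * Bern (suc (suc n))) (Bern-recurrence n) (nCn≡1 (suc (suc n))) ⟩
  0ℚ + 1ℚ * Bern (suc (suc n))
    ≡⟨ ring (Bern (suc (suc n))) ⟩
  Bern (suc (suc n)) + 0ℚ ∎
  where
  ring : ∀ x → 0ℚ + 1ℚ * x ≡ x + 0ℚ
  ring = solve-∀ ringℚ

*-δ₁ : ∀ c n → c ^ n * δ₁ n ≡ c * δ₁ n
*-δ₁ c zero = trans (ℚP.*-zeroʳ 1ℚ) (sym (ℚP.*-zeroʳ c))
*-δ₁ c (suc zero) = cong (_* 1ℚ) (ℚP.*-identityʳ c)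
*-δ₁ c (suc (suc n)) = trans (ℚP.*-zeroʳ (c ^ suc (suc n))) (sym (ℚP.*-zeroʳ c))

-- The moments cⁱ Bᵢ belong to q ↦ E(q(c x)), for which translation by c plays the part that
-- translation by 1 plays for E.
translate-cBern : ∀ c n → translate c (λ i → c ^ i * Bern i) n ≡ c ^ n * Bern n + c * δ₁ n
translate-cBern c n = begin
  translate c (λ i → c ^ i * Bern i) n          ≡⟨ translate-cong (sym (ℚP.*-identityʳ c)) (λ _ → refl) n ⟩
  translate (c * 1ℚ) (λ i → c ^ i * Bern i) n   ≡⟨ translate-scale c 1ℚ Bern n ⟩
  c ^ n * translate 1ℚ Bern n                   ≡⟨ cong (c ^ n *_) (translate1-Bern n) ⟩
  c ^ n * (Bern n + δ₁ n)                       ≡⟨ ℚP.*-distribˡ-+ (c ^ n) (Bern n) (δ₁ n) ⟩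
  c ^ n * Bern n + c ^ n * δ₁ n                 ≡⟨ cong (λ z → c ^ n * Bern n + z) (*-δ₁ c n) ⟩
  c ^ n * Bern n + c * δ₁ n                     ∎

translate-0 : ∀ u n → translate 0ℚ u n ≡ u n
translate-0 u zero = refl
translate-0 u (suc n) =
  trans (cong₂ _+_ (translate-0 (shift u) n) (ℚP.*-zeroˡ (translate 0ℚ u n))) (ℚP.+-identityʳ (u (suc n)))

-- Both sides have moments u with u(x + 1) - u(x) = p δ₁; on the left this is a telescoping sum.
Bern-multiplication : ∀ p n →
  sumTo p (λ a → translate (fromℕ a) (λ i → fromℕ p ^ i * Bern i) n) ≡ fromℕ p * Bern n
Bern-multiplication p = translate1-unique (λ n → P * δ₁ n) left right
  where
  P = fromℕ p
  w : ℕ → ℚ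
  w i = P ^ i * Bern i
  F : ℕ → ℕ → ℚ
  F a = translate (fromℕ a) w
  step : ∀ a n → translate 1ℚ (F a) n ≡ F (suc a) n
  step a n = trans (translate-translate (fromℕ a) 1ℚ w n)
                   (translate-cong (trans (ℚP.+-comm (fromℕ a) 1ℚ) (sym (fromℕ-suc a))) (λ _ → refl) n)
  telescope : ∀ m n → sumTo m (λ a → F (suc a) n) ≡ sumTo m (λ a → F a n) + (F m n - F 0 n)
  telescope zero n = ring (F 0 n)
    where
    ring : ∀ x → 0ℚ ≡ 0ℚ + (x - x)
    ring = solve-∀ ringℚ
  telescope (suc m) n = trans (cong (_+ F (suc m) n) (telescope m n))
                              (ring (sumTo m (λ a → F a n)) (F m n) (F 0 n) (F (suc m) n))
    where
    ring : ∀ s x y z → s + (x - y) + z ≡ s + x + (z - y)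
    ring = solve-∀ ringℚ
  left : ∀ n → translate 1ℚ (λ i → sumTo p (λ a → F a i)) n ≡ sumTo p (λ a → F a n) + P * δ₁ n
  left n = begin
    translate 1ℚ (λ i → sumTo p (λ a → F a i)) n     ≡⟨ translate-sumTo 1ℚ p F n ⟩
    sumTo p (λ a → translate 1ℚ (F a) n)             ≡⟨ sumTo-cong p (λ a _ → step a n) ⟩
    sumTo p (λ a → F (suc a) n)                      ≡⟨ telescope p n ⟩
    sumTo p (λ a → F a n) + (F p n - F 0 n)          ≡⟨ cong₂ (λ x y → sumTo p (λ a → F a n) + (x - y))
                                                          (translate-cBern P n) (translate-0 w n) ⟩
    sumTo p (λ a → F a n) + (w n + P * δ₁ n - w n)   ≡⟨ cong (λ z → sumTo p (λ a → F a n) + z) (ring (w n) (P * δ₁ n)) ⟩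
    sumTo p (λ a → F a n) + P * δ₁ n                 ∎
    where
    ring : ∀ x y → x + y - x ≡ y
    ring = solve-∀ ringℚ
  right : ∀ n → translate 1ℚ (λ i → P * Bern i) n ≡ P * Bern n + P * δ₁ n
  right n = begin
    translate 1ℚ (λ i → P * Bern i) n            ≡⟨ translate-cong refl (λ i → sym (ℚP.+-identityˡ (P * Bern i))) n ⟩
    translate 1ℚ (λ i → 0ℚ + P * Bern i) n       ≡⟨ translate-linear 1ℚ P (λ _ → 0ℚ) Bern n ⟩
    translate 1ℚ (λ _ → 0ℚ) n + P * translate 1ℚ Bern n
                                                 ≡⟨ cong₂ (λ x y → x + P * y) (translate-zero 1ℚ n) (translate1-Bern n) ⟩
    0ℚ + P * (Bern n + δ₁ n)                     ≡⟨ ring P (Bern n) (δ₁ n) ⟩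
    P * Bern n + P * δ₁ n                        ∎
    where
    ring : ∀ p x y → 0ℚ + p * (x + y) ≡ p * x + p * y
    ring = solve-∀ ringℚ

-- This is E(q(-x)) = E(q(x + 1)). By `translate-cBern` with c = -1, translation by -1 subtracts
-- `δ₁` from `B⁻`; translating that relation back by 1 shows that `B⁻` gains `translate 1ℚ δ₁`, just
-- as the right-hand side does.
Bern-reflection : ∀ n → (- 1ℚ) ^ n * Bern n ≡ Bern n + δ₁ n
Bern-reflection = translate1-unique (translate 1ℚ δ₁) left right
  where
  B⁻ : ℕ → ℚ
  B⁻ i = (- 1ℚ) ^ i * Bern i
  left : ∀ n → translate 1ℚ B⁻ n ≡ B⁻ n + translate 1ℚ δ₁ n
  left n = begin
    translate 1ℚ B⁻ n
      ≡⟨ translate-cong refl (λ i → ring (B⁻ i) (δ₁ i)) n ⟩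
    translate 1ℚ (λ i → (B⁻ i + (- 1ℚ) * δ₁ i) + 1ℚ * δ₁ i) n
      ≡⟨ translate-linear 1ℚ 1ℚ (λ i → B⁻ i + (- 1ℚ) * δ₁ i) δ₁ n ⟩
    translate 1ℚ (λ i → B⁻ i + (- 1ℚ) * δ₁ i) n + 1ℚ * translate 1ℚ δ₁ n
      ≡⟨ cong₂ _+_ back (ℚP.*-identityˡ (translate 1ℚ δ₁ n)) ⟩
    B⁻ n + translate 1ℚ δ₁ n ∎
    where
    ring : ∀ x y → x ≡ (x + (- 1ℚ) * y) + 1ℚ * y
    ring = solve-∀ ringℚ
    back : translate 1ℚ (λ i → B⁻ i + (- 1ℚ) * δ₁ i) n ≡ B⁻ n
    back = trans (translate-cong refl (λ i → sym (translate-cBern (- 1ℚ) i)) n)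
                 (trans (translate-translate (- 1ℚ) 1ℚ B⁻ n) (translate-0 B⁻ n))
  right : ∀ n → translate 1ℚ (λ i → Bern i + δ₁ i) n ≡ Bern n + δ₁ n + translate 1ℚ δ₁ n
  right n = trans (translate-cong refl (λ i → cong (λ z → Bern i + z) (sym (ℚP.*-identityˡ (δ₁ i)))) n)
    (trans (translate-linear 1ℚ 1ℚ Bern δ₁ n)
           (cong₂ _+_ (translate1-Bern n) (ℚP.*-identityˡ (translate 1ℚ δ₁ n))))

Bern-odd : ∀ n → Bern (3 ℕ.+ 2 ℕ.* n) ≡ 0ℚ
Bern-odd n = *-cancelˡ (1ℚ + 1ℚ) (λ ()) (begin
  (1ℚ + 1ℚ) * b               ≡⟨ ring b ⟩
  b + 0ℚ - (- 1ℚ) * b         ≡⟨ cong (λ z → z - (- 1ℚ) * b) (sym (Bern-reflection m)) ⟩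
  (- 1ℚ) ^ m * b - (- 1ℚ) * b ≡⟨ cong (λ z → z * b - (- 1ℚ) * b) sign ⟩
  (- 1ℚ) * b - (- 1ℚ) * b     ≡⟨ ring′ b ⟩
  (1ℚ + 1ℚ) * 0ℚ              ∎)
  where
  m = 3 ℕ.+ 2 ℕ.* n
  b = Bern m
  ring : ∀ b → (1ℚ + 1ℚ) * b ≡ b + 0ℚ - (- 1ℚ) * b
  ring = solve-∀ ringℚ
  ring′ : ∀ b → (- 1ℚ) * b - (- 1ℚ) * b ≡ (1ℚ + 1ℚ) * 0ℚ
  ring′ = solve-∀ ringℚ
  sign : (- 1ℚ) ^ m ≡ - 1ℚ
  sign = begin
    (- 1ℚ) ^ (3 ℕ.+ 2 ℕ.* n)            ≡⟨ ^-homo-* (- 1ℚ) 3 (2 ℕ.* n) ⟩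
    (- 1ℚ) * ((- 1ℚ) ^ (2 ℕ.* n))       ≡⟨ cong ((- 1ℚ) *_) (trans (sym (^-assocʳ (- 1ℚ) 2 n)) (1^ n)) ⟩
    - 1ℚ * 1ℚ                           ≡⟨ ℚP.*-identityʳ (- 1ℚ) ⟩
    - 1ℚ                                ∎

-- The p-adic valuation on ℚ.

module Valuation (p : ℕ) (p-prime : Prime p) where

  P : ℚ
  P = fromℕ p

  P≢0 : P ≢ 0ℚ
  P≢0 = fromℤ≢0 {+ p} (λ e → ℕ.≢-nonZero⁻¹ p {{prime⇒nonZero p-prime}} (ℤP.+-injective e))

  1/P : ℚ
  1/P = divQ 1ℚ P

  1/P*P : 1/P * P ≡ 1ℚ
  1/P*P = divQ-* 1ℚ P≢0

  power : ℤ → ℚ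
  power (+ k) = P ^ k
  power -[1+ k ] = 1/P ^ suc k

  power-⊖ : ∀ m n → power (m ℤ.⊖ n) ≡ P ^ m * 1/P ^ n
  power-⊖ m zero = trans (cong power (ℤP.⊖-≥ {m} {0} z≤n)) (sym (ℚP.*-identityʳ (P ^ m)))
  power-⊖ zero (suc n) = sym (ℚP.*-identityˡ (1/P ^ suc n))
  power-⊖ (suc m) (suc n) = begin
    power (suc m ℤ.⊖ suc n)            ≡⟨ cong power (ℤP.[1+m]⊖[1+n]≡m⊖n m n) ⟩
    power (m ℤ.⊖ n)                    ≡⟨ power-⊖ m n ⟩
    P ^ m * 1/P ^ n                    ≡⟨ sym (ℚP.*-identityˡ (P ^ m * 1/P ^ n)) ⟩
    1ℚ * (P ^ m * 1/P ^ n)             ≡⟨ cong (_* (P ^ m * 1/P ^ n)) (sym 1/P*P) ⟩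
    1/P * P * (P ^ m * 1/P ^ n)        ≡⟨ ring P 1/P (P ^ m) (1/P ^ n) ⟩
    P * P ^ m * (1/P * 1/P ^ n)        ∎
    where
    ring : ∀ a b x y → b * a * (x * y) ≡ a * x * (b * y)
    ring = solve-∀ ringℚ

  power-+ : ∀ i j → power (i ℤ.+ j) ≡ power i * power j
  power-+ (+ m) (+ n) = ^-homo-* P m n
  power-+ (+ m) -[1+ n ] = power-⊖ m (suc n)
  power-+ -[1+ m ] (+ n) = trans (power-⊖ n (suc m)) (ℚP.*-comm (P ^ n) (1/P ^ suc m))
  power-+ -[1+ m ] -[1+ n ] =
    trans (cong (1/P ^_) (cong suc (sym (ℕP.+-suc m n)))) (^-homo-* 1/P (suc m) (suc n))

  -- V N is the fractional ideal pᴺℤ₍ₚ₎.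
  record V (N : ℤ) (q : ℚ) : Set where
    constructor mkV
    field
      top bot : ℤ
      p∤bot : ¬ (+ p ℤD.∣ bot)
      equation : q * fromℤ bot ≡ power N * fromℤ top

  p∤1 : ¬ (+ p ℤD.∣ + 1)
  p∤1 p∣1 = ℕP.<⇒≢ (ℕ.nonTrivial⇒n>1 p {{prime⇒nonTrivial p-prime}}) (sym (ℕD.∣1⇒≡1 p∣1))

  p∤* : ∀ x y → ¬ (+ p ℤD.∣ x) → ¬ (+ p ℤD.∣ y) → ¬ (+ p ℤD.∣ x ℤ.* y)
  p∤* x y p∤x p∤y p∣xy with euclidsLemma ℤ.∣ x ∣ ℤ.∣ y ∣ p-prime (subst (p ℕD.∣_) (ℤP.abs-* x y) p∣xy)
  ... | inj₁ d = p∤x d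
  ... | inj₂ d = p∤y d

  p∤⇒≢0 : ∀ {x} → ¬ (+ p ℤD.∣ x) → fromℤ x ≢ 0ℚ
  p∤⇒≢0 {x} p∤x = fromℤ≢0 {x} (λ { refl → p∤x (p ℕD.∣0) })

  p∤small : ∀ {n} → 0 < n → n < p → ¬ (+ p ℤD.∣ + n)
  p∤small {suc n} _ n<p p∣n = ℕP.<⇒≱ n<p (ℕD.∣⇒≤ p∣n)

  V-0 : ∀ {N} → V N 0ℚ
  V-0 {N} = mkV (+ 0) (+ 1) p∤1 (sym (ℚP.*-zeroʳ (power N)))

  V-≡ : ∀ {N x y} → x ≡ y → V N x → V N y
  V-≡ refl v = v

  V-+ : ∀ {N x y} → V N x → V N y → V N (x + y)
  V-+ {N} {x} {y} (mkV a b p∤b e) (mkV c d p∤d f) = mkV (a ℤ.* d ℤ.+ c ℤ.* b) (b ℤ.* d) (p∤* b d p∤b p∤d) (begin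
    (x + y) * fromℤ (b ℤ.* d)               ≡⟨ cong ((x + y) *_) (fromℤ-* b d) ⟩
    (x + y) * (b′ * d′)                       ≡⟨ ring₁ x y b′ d′ ⟩
    x * b′ * d′ + y * d′ * b′                   ≡⟨ cong₂ (λ s t → s * d′ + t * b′) e f ⟩
    W * a′ * d′ + W * c′ * b′                   ≡⟨ ring₂ W a′ b′ c′ d′ ⟩
    W * (a′ * d′ + c′ * b′)                     ≡⟨ cong (W *_) (sym (trans (fromℤ-+ (a ℤ.* d) (c ℤ.* b)) (cong₂ _+_ (fromℤ-* a d) (fromℤ-* c b)))) ⟩
    W * fromℤ (a ℤ.* d ℤ.+ c ℤ.* b)         ∎)
    where
    W = power N
    a′ = fromℤ a
    b′ = fromℤ b
    c′ = fromℤ c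
    d′ = fromℤ d
    ring₁ : ∀ x y b d → (x + y) * (b * d) ≡ x * b * d + y * d * b
    ring₁ = solve-∀ ringℚ
    ring₂ : ∀ w a b c d → w * a * d + w * c * b ≡ w * (a * d + c * b)
    ring₂ = solve-∀ ringℚ

  V-* : ∀ {M N x y} → V M x → V N y → V (M ℤ.+ N) (x * y)
  V-* {M} {N} {x} {y} (mkV a b p∤b e) (mkV c d p∤d f) = mkV (a ℤ.* c) (b ℤ.* d) (p∤* b d p∤b p∤d) (begin
    x * y * fromℤ (b ℤ.* d)                     ≡⟨ cong (x * y *_) (fromℤ-* b d) ⟩
    x * y * (b′ * d′)                             ≡⟨ ring x y b′ d′ ⟩
    x * b′ * (y * d′)                             ≡⟨ cong₂ _*_ e f ⟩
    power M * a′ * (power N * c′)                 ≡⟨ ring (power M) a′ (power N) c′ ⟩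
    power M * power N * (a′ * c′)                 ≡⟨ cong₂ _*_ (sym (power-+ M N)) (sym (fromℤ-* a c)) ⟩
    power (M ℤ.+ N) * fromℤ (a ℤ.* c)           ∎)
    where
    a′ = fromℤ a
    b′ = fromℤ b
    c′ = fromℤ c
    d′ = fromℤ d
    ring : ∀ x y b d → x * y * (b * d) ≡ x * b * (y * d)
    ring = solve-∀ ringℚ

  V-fromℤ : ∀ z → V (+ 0) (fromℤ z)
  V-fromℤ z = mkV z (+ 1) p∤1 (ℚP.*-comm (fromℤ z) 1ℚ)

  V-fromℕ : ∀ n → V (+ 0) (fromℕ n)
  V-fromℕ n = V-fromℤ (+ n)

  V-power : ∀ N → V N (power N)
  V-power N = mkV (+ 1) (+ 1) p∤1 refl

  V-P : V (+ 1) P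
  V-P = V-≡ (ℚP.*-identityʳ P) (V-power (+ 1))

  V-mul : ∀ {N x y} → V (+ 0) x → V N y → V N (x * y)
  V-mul {N} v w = subst (λ M → V M _) (ℤP.+-identityˡ N) (V-* v w)

  V-neg : ∀ {N x} → V N x → V N (- x)
  V-neg {N} {x} v = V-≡ (ring x) (V-mul (V-fromℤ -[1+ 0 ]) v)
    where
    ring : ∀ x → (- 1ℚ) * x ≡ - x
    ring = solve-∀ ringℚ

  V-sub : ∀ {N x y} → V N x → V N y → V N (x - y)
  V-sub v w = V-+ v (V-neg w)

  V-mono : ∀ {M N x} → M ℤ.≤ N → V N x → V M x
  V-mono {M} {N} {x} M≤N (mkV a b p∤b e) = mkV (+ (p ℕ.^ k) ℤ.* a) b p∤b (begin
    x * fromℤ b                              ≡⟨ e ⟩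
    power N * fromℤ a                        ≡⟨ cong (λ z → power z * fromℤ a) N≡ ⟩
    power (M ℤ.+ + k) * fromℤ a              ≡⟨ cong (_* fromℤ a) (power-+ M (+ k)) ⟩
    power M * P ^ k * fromℤ a                ≡⟨ ℚP.*-assoc (power M) (P ^ k) (fromℤ a) ⟩
    power M * (P ^ k * fromℤ a)              ≡⟨ cong (λ z → power M * (z * fromℤ a)) (sym (fromℕ-^ p k)) ⟩
    power M * (fromℕ (p ℕ.^ k) * fromℤ a)    ≡⟨ cong (power M *_) (sym (fromℤ-* (+ (p ℕ.^ k)) a)) ⟩
    power M * fromℤ (+ (p ℕ.^ k) ℤ.* a)      ∎)
    where
    k = ℤ.∣ N ℤ.- M ∣
    ring : ∀ m n → n ≡ m ℤ.+ (n ℤ.- m)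
    ring = ℤSolver.solve-∀
    N≡ : N ≡ M ℤ.+ + k
    N≡ = trans (ring M N) (cong (λ z → M ℤ.+ z) (sym (ℤP.0≤i⇒+∣i∣≡i (ℤP.i≤j⇒0≤j-i M≤N))))

  V-cancel : ∀ {N x} b → ¬ (+ p ℤD.∣ b) → V N (x * fromℤ b) → V N x
  V-cancel {N} {x} b p∤b (mkV a d p∤d e) = mkV a (b ℤ.* d) (p∤* b d p∤b p∤d)
    (trans (cong (x *_) (fromℤ-* b d)) (trans (sym (ℚP.*-assoc x (fromℤ b) (fromℤ d))) e))

  V-inverse : ∀ {x} b → ¬ (+ p ℤD.∣ b) → x * fromℤ b ≡ 1ℚ → V (+ 0) x
  V-inverse b p∤b e = mkV (+ 1) b p∤b e

  V-sumTo : ∀ {N} n {f} → (∀ i → i < n → V N (f i)) → V N (sumTo n f)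
  V-sumTo zero v = V-0
  V-sumTo (suc n) v = V-+ (V-sumTo n (λ i i<n → v i (ℕP.m<n⇒m<1+n i<n))) (v n (ℕP.n<1+n n))

  V-^ : ∀ {x} n → V (+ 0) x → V (+ 0) (x ^ n)
  V-^ zero v = V-fromℤ (+ 1)
  V-^ (suc n) v = V-mul v (V-^ n v)

  V-P^ : ∀ n → V (+ n) (P ^ n)
  V-P^ n = V-power (+ n)

  V-∣ : ∀ z → V (+ 1) (fromℤ z) → + p ℤD.∣ z
  V-∣ z (mkV a b p∤b e) with euclidsLemma ℤ.∣ z ∣ ℤ.∣ b ∣ p-prime p∣zb
    where
    zb≡pa : z ℤ.* b ≡ + p ℤ.* a
    zb≡pa = fromℤ-injective (trans (fromℤ-* z b) (trans e
      (trans (cong (_* fromℤ a) (ℚP.*-identityʳ P)) (sym (fromℤ-* (+ p) a)))))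
    p∣zb : p ℕD.∣ ℤ.∣ z ∣ ℕ.* ℤ.∣ b ∣
    p∣zb = ℕD.divides ℤ.∣ a ∣ (begin
      ℤ.∣ z ∣ ℕ.* ℤ.∣ b ∣     ≡⟨ sym (ℤP.abs-* z b) ⟩
      ℤ.∣ z ℤ.* b ∣           ≡⟨ cong ℤ.∣_∣ zb≡pa ⟩
      ℤ.∣ + p ℤ.* a ∣         ≡⟨ ℤP.abs-* (+ p) a ⟩
      p ℕ.* ℤ.∣ a ∣           ≡⟨ ℕP.*-comm p ℤ.∣ a ∣ ⟩
      ℤ.∣ a ∣ ℕ.* p           ∎)
  ... | inj₁ d = d
  ... | inj₂ d = ⊥-elim (p∤b d)

  ∣-V : ∀ z → + p ℤD.∣ z → V (+ 1) (fromℤ z)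
  ∣-V z (ℕD.divides c e) = V-≡ abs (signed z)
    where
    v : V (+ 1) (fromℤ (+ ℤ.∣ z ∣))
    v = V-≡ (trans (sym (fromℕ-* c p)) (cong fromℕ (sym e))) (V-mul (V-fromℕ c) V-P)
    -- Divisibility in ℤ is divisibility of absolute values, so the sign has to be put back
    -- separately.
    signed : ∀ w → V (+ 1) (fromℤ (ℤ.sign w ℤ.◃ ℤ.∣ z ∣))
    signed (+ _) = subst (λ t → V (+ 1) (fromℤ t)) (sym (ℤP.+◃n≡+n ℤ.∣ z ∣)) v
    signed -[1+ _ ] = subst (λ t → V (+ 1) (fromℤ t)) (sym (ℤP.-◃n≡-n ℤ.∣ z ∣))
      (V-≡ (sym (fromℤ-neg (+ ℤ.∣ z ∣))) (V-neg v))
    abs : fromℤ (ℤ.sign z ℤ.◃ ℤ.∣ z ∣) ≡ fromℤ z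
    abs = cong fromℤ (ℤP.signᵢ◃∣i∣≡i z)

  V⇒InPpowN : ∀ {N q} → V N q → InPpowN p N q
  V⇒InPpowN {+ k} {q} (mkV a b p∤b e) = a , b , p∤b , (begin
    q * fromℤ b                   ≡⟨ e ⟩
    P ^ k * fromℤ a               ≡⟨ ℚP.*-comm (P ^ k) (fromℤ a) ⟩
    fromℤ a * P ^ k               ≡⟨ cong (fromℤ a *_) (sym (fromℕ-^ p k)) ⟩
    fromℤ a * fromℕ (p ℕ.^ k)     ≡⟨ sym (fromℤ-* a (+ (p ℕ.^ k))) ⟩
    fromℤ (a ℤ.* + (p ℕ.^ k))     ∎)
  V⇒InPpowN { -[1+ k ]} {q} (mkV a b p∤b e) = a , b , p∤b , (begin
    q * fromℤ b * fromℕ (p ℕ.^ suc k)       ≡⟨ cong₂ _*_ e (fromℕ-^ p (suc k)) ⟩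
    1/P ^ suc k * fromℤ a * P ^ suc k       ≡⟨ ring (1/P ^ suc k) (fromℤ a) (P ^ suc k) ⟩
    1/P ^ suc k * P ^ suc k * fromℤ a       ≡⟨ cong (_* fromℤ a) (sym (^-distrib-* 1/P P (suc k))) ⟩
    (1/P * P) ^ suc k * fromℤ a             ≡⟨ cong (λ z → z ^ suc k * fromℤ a) 1/P*P ⟩
    1ℚ ^ suc k * fromℤ a                    ≡⟨ cong (_* fromℤ a) (1^ (suc k)) ⟩
    1ℚ * fromℤ a                            ≡⟨ ℚP.*-identityˡ (fromℤ a) ⟩
    fromℤ a                                 ∎)
    where
    ring : ∀ x a y → x * a * y ≡ x * y * a
    ring = solve-∀ ringℚ

-- Evaluation of polynomials.

evalQ-addP : ∀ f g x → evalQ (addP f g) x ≡ evalQ f x + evalQ g x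
evalQ-addP [] g x = sym (ℚP.+-identityˡ (evalQ g x))
evalQ-addP (a ∷ f) [] x = sym (ℚP.+-identityʳ (evalQ (a ∷ f) x))
evalQ-addP (a ∷ f) (b ∷ g) x =
  trans (cong (λ z → a + b + x * z) (evalQ-addP f g x)) (ring a b x (evalQ f x) (evalQ g x))
  where
  ring : ∀ a b x s t → a + b + x * (s + t) ≡ a + x * s + (b + x * t)
  ring = solve-∀ ringℚ

evalQ-scaleP : ∀ c f x → evalQ (scaleP c f) x ≡ c * evalQ f x
evalQ-scaleP c [] x = sym (ℚP.*-zeroʳ c)
evalQ-scaleP c (a ∷ f) x =
  trans (cong (λ z → c * a + x * z) (evalQ-scaleP c f x)) (ring c a x (evalQ f x))
  where
  ring : ∀ c a x s → c * a + x * (c * s) ≡ c * (a + x * s)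
  ring = solve-∀ ringℚ

evalQ-negP : ∀ f x → evalQ (negP f) x ≡ - evalQ f x
evalQ-negP f x = trans (evalQ-scaleP (- 1ℚ) f x) (ring (evalQ f x))
  where
  ring : ∀ s → (- 1ℚ) * s ≡ - s
  ring = solve-∀ ringℚ

evalQ-constP : ∀ c x → evalQ (constP c) x ≡ c
evalQ-constP c x = ring c x
  where
  ring : ∀ c x → c + x * 0ℚ ≡ c
  ring = solve-∀ ringℚ

evalQ-mulP : ∀ f g x → evalQ (mulP f g) x ≡ evalQ f x * evalQ g x
evalQ-mulP [] g x = sym (ℚP.*-zeroˡ (evalQ g x))
evalQ-mulP (a ∷ f) g x = begin
  evalQ (addP (scaleP a g) (0ℚ ∷ mulP f g)) x
    ≡⟨ evalQ-addP (scaleP a g) (0ℚ ∷ mulP f g) x ⟩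
  evalQ (scaleP a g) x + (0ℚ + x * evalQ (mulP f g) x)
    ≡⟨ cong₂ (λ s t → s + (0ℚ + x * t)) (evalQ-scaleP a g x) (evalQ-mulP f g x) ⟩
  a * evalQ g x + (0ℚ + x * (evalQ f x * evalQ g x))
    ≡⟨ ring a x (evalQ f x) (evalQ g x) ⟩
  (a + x * evalQ f x) * evalQ g x ∎
  where
  ring : ∀ a x s t → a * t + (0ℚ + x * (s * t)) ≡ (a + x * s) * t
  ring = solve-∀ ringℚ

evalQ-powP : ∀ f m x → evalQ (powP f m) x ≡ evalQ f x ^ m
evalQ-powP f zero x = evalQ-constP 1ℚ x
evalQ-powP f (suc m) x = trans (evalQ-mulP f (powP f m) x) (cong (evalQ f x *_) (evalQ-powP f m x))

evalQ-monoP : ∀ m x → evalQ (monoP m) x ≡ x ^ m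
evalQ-monoP zero x = evalQ-constP 1ℚ x
evalQ-monoP (suc m) x = trans (ℚP.+-identityˡ (x * evalQ (monoP m) x)) (cong (x *_) (evalQ-monoP m x))

evalQ-toQ : ∀ f z → evalQ (toQ f) (fromℤ z) ≡ fromℤ (evalZ f z)
evalQ-toQ [] z = refl
evalQ-toQ (c ∷ f) z = sym (trans (fromℤ-+ c (z ℤ.* evalZ f z))
  (cong (λ t → fromℤ c + t) (trans (fromℤ-* z (evalZ f z)) (cong (fromℤ z *_) (sym (evalQ-toQ f z))))))

-- Binomial polynomials and truncated Newton series.

-- The polynomial x (x - 1) ⋯ (x - j + 1) / j!. The recursion on j adds one linear factor and one
-- denominator at a time, which is the form needed in `polyMod-binomial`.
binomial : ℕ → ℚ → ℚ
binomial zero x = 1ℚ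
binomial (suc j) x = divQ (binomial j x * (x - fromℕ j)) (fromℕ (suc j))

binomial-suc : ∀ j x → binomial (suc j) x * fromℕ (suc j) ≡ binomial j x * (x - fromℕ j)
binomial-suc j x = divQ-* (binomial j x * (x - fromℕ j)) (fromℕ-suc≢0 j)

-- Proved together with `cleared`, the identity (x + 1 - j) C(x + 1, j) = (x + 1) C(x, j), which in
-- turn rests on Pascal's rule one degree lower.
binomial-pascal : ∀ j x → binomial (suc j) (1ℚ + x) ≡ binomial (suc j) x + binomial j x
binomial-pascal j x = *-cancelʳ (fromℕ (suc j)) (fromℕ-suc≢0 j) (begin
  binomial (suc j) (1ℚ + x) * fromℕ (suc j)                    ≡⟨ binomial-suc j (1ℚ + x) ⟩
  binomial j (1ℚ + x) * (1ℚ + x - fromℕ j)                     ≡⟨ cleared j ⟩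
  binomial j x * (1ℚ + x)                                      ≡⟨ ring₁ (binomial j x) x (fromℕ j) ⟩
  binomial j x * (x - fromℕ j) + binomial j x * (1ℚ + fromℕ j) ≡⟨ cong₂ (λ s t → s + binomial j x * t) (sym (binomial-suc j x)) (sym (fromℕ-suc j)) ⟩
  binomial (suc j) x * fromℕ (suc j) + binomial j x * fromℕ (suc j)
                                                               ≡⟨ sym (ℚP.*-distribʳ-+ (fromℕ (suc j)) (binomial (suc j) x) (binomial j x)) ⟩
  (binomial (suc j) x + binomial j x) * fromℕ (suc j)          ∎)
  where
  ring₁ : ∀ b x j → b * (1ℚ + x) ≡ b * (x - j) + b * (1ℚ + j)
  ring₁ = solve-∀ ringℚ
  cleared : ∀ j → binomial j (1ℚ + x) * (1ℚ + x - fromℕ j) ≡ binomial j x * (1ℚ + x)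
  cleared zero = ring x
    where
    ring : ∀ x → 1ℚ * (1ℚ + x - 0ℚ) ≡ 1ℚ * (1ℚ + x)
    ring = solve-∀ ringℚ
  cleared (suc i) = begin
    binomial (suc i) (1ℚ + x) * (1ℚ + x - fromℕ (suc i))
      ≡⟨ cong₂ (λ s t → s * (1ℚ + x - t)) (binomial-pascal i x) (fromℕ-suc i) ⟩
    (binomial (suc i) x + binomial i x) * (1ℚ + x - (1ℚ + fromℕ i))
      ≡⟨ ring₂ (binomial (suc i) x) (binomial i x) x (fromℕ i) ⟩
    binomial (suc i) x * (x - fromℕ i) + binomial i x * (x - fromℕ i)
      ≡⟨ cong (λ z → binomial (suc i) x * (x - fromℕ i) + z)
           (trans (sym (binomial-suc i x)) (cong (binomial (suc i) x *_) (fromℕ-suc i))) ⟩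
    binomial (suc i) x * (x - fromℕ i) + binomial (suc i) x * (1ℚ + fromℕ i)
      ≡⟨ sym (ring₁ (binomial (suc i) x) x (fromℕ i)) ⟩
    binomial (suc i) x * (1ℚ + x) ∎
    where
    ring₂ : ∀ b c x i → (b + c) * (1ℚ + x - (1ℚ + i)) ≡ b * (x - i) + c * (x - i)
    ring₂ = solve-∀ ringℚ

binomial-0 : ∀ j → binomial (suc j) 0ℚ ≡ 0ℚ
binomial-0 j = *-cancelʳ (fromℕ (suc j)) (fromℕ-suc≢0 j)
  (trans (binomial-suc j 0ℚ) (trans (numerator j) (sym (ℚP.*-zeroˡ (fromℕ (suc j))))))
  where
  numerator : ∀ j → binomial j 0ℚ * (0ℚ - fromℕ j) ≡ 0ℚ
  numerator zero = refl
  numerator (suc j) = trans (cong (_* (0ℚ - fromℕ (suc j))) (binomial-0 j)) (ℚP.*-zeroˡ (0ℚ - fromℕ (suc j)))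

-- The first J terms of the expansion of `translate 1ℚ w n`, in a form that is polynomial in n.
newtonSum : ℕ → (ℕ → ℚ) → ℕ → ℚ
newtonSum J w n = sumTo J (λ j → binomial j (fromℕ n) * w j)

newtonSum-zero : ∀ J w → newtonSum (suc J) w 0 ≡ w 0
newtonSum-zero J w = begin
  newtonSum (suc J) w 0
    ≡⟨ sumTo-head J (λ j → binomial j 0ℚ * w j) ⟩
  1ℚ * w 0 + sumTo J (λ j → binomial (suc j) 0ℚ * w (suc j))
    ≡⟨ cong₂ _+_ (ℚP.*-identityˡ (w 0)) (trans (sumTo-cong J (λ j _ → vanish j)) (trans (sumTo-* J 0ℚ (λ _ → 0ℚ)) (ℚP.*-zeroˡ (sumTo J (λ _ → 0ℚ))))) ⟩
  w 0 + 0ℚ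
    ≡⟨ ℚP.+-identityʳ (w 0) ⟩
  w 0 ∎
  where
  vanish : ∀ j → binomial (suc j) 0ℚ * w (suc j) ≡ 0ℚ * 0ℚ
  vanish j = trans (cong (_* w (suc j)) (binomial-0 j)) (ℚP.*-zeroˡ (w (suc j)))

-- By Pascal's rule the truncated series obeys the recursion that defines `translate 1ℚ`, with J
-- lowered by one on the shifted sequence.
newtonSum-suc : ∀ J w n → newtonSum (suc J) w (suc n) ≡ newtonSum J (shift w) n + newtonSum (suc J) w n
newtonSum-suc J w n = begin
  newtonSum (suc J) w (suc n)
    ≡⟨ sumTo-head J (λ j → binomial j (fromℕ (suc n)) * w j) ⟩
  1ℚ * w 0 + sumTo J (λ j → binomial (suc j) (fromℕ (suc n)) * w (suc j))
    ≡⟨ cong (λ z → 1ℚ * w 0 + z) (trans (sumTo-cong J (λ j _ → pascal j)) (sumTo-+ J _ _)) ⟩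
  1ℚ * w 0 + (newtonSum J (shift w) n + sumTo J (λ j → binomial (suc j) (fromℕ n) * w (suc j)))
    ≡⟨ ring (1ℚ * w 0) (newtonSum J (shift w) n) _ ⟩
  newtonSum J (shift w) n + (1ℚ * w 0 + sumTo J (λ j → binomial (suc j) (fromℕ n) * w (suc j)))
    ≡⟨ cong (λ z → newtonSum J (shift w) n + z) (sym (sumTo-head J (λ j → binomial j (fromℕ n) * w j))) ⟩
  newtonSum J (shift w) n + newtonSum (suc J) w n ∎
  where
  ring : ∀ a b c → a + (b + c) ≡ b + (a + c)
  ring = solve-∀ ringℚ
  ring′ : ∀ a b c → (a + b) * c ≡ b * c + a * c
  ring′ = solve-∀ ringℚ
  pascal : ∀ j → binomial (suc j) (fromℕ (suc n)) * w (suc j)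
    ≡ binomial j (fromℕ n) * w (suc j) + binomial (suc j) (fromℕ n) * w (suc j)
  pascal j = trans (cong (λ x → binomial (suc j) x * w (suc j)) (fromℕ-suc n))
    (trans (cong (_* w (suc j)) (binomial-pascal j (fromℕ n)))
           (ring′ (binomial (suc j) (fromℕ n)) (binomial j (fromℕ n)) (w (suc j))))

-- Functions congruent to p-integral polynomials.

module PolynomialCongruence (p : ℕ) (p-prime : Prime p) where

  open Valuation p p-prime

  V-translate : ∀ {N} a u n → V (+ 0) a → (∀ i → V N (u i)) → V N (translate a u n)
  V-translate a u zero va vu = vu 0
  V-translate a u (suc n) va vu =
    V-+ (V-translate a (shift u) n va (vu ∘ suc)) (V-mul va (V-translate a u n va vu))

  -- Both sides follow the same recursion, so the tail of the series never has to be written down.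
  -- At J = 0 all moments still present are among those assumed to lie in `V N`.
  translate-newtonSum : ∀ {N} J w n → (∀ j → J ≤ j → V N (w j)) →
    V N (translate 1ℚ w n - newtonSum J w n)
  translate-newtonSum zero w n vw =
    V-sub (V-translate 1ℚ w n (V-fromℤ (+ 1)) (λ j → vw j z≤n)) V-0
  translate-newtonSum (suc J) w zero vw =
    V-≡ (sym (trans (cong (λ z → w 0 - z) (newtonSum-zero J w)) (ℚP.+-inverseʳ (w 0)))) V-0
  translate-newtonSum (suc J) w (suc n) vw =
    V-≡ (trans (ring (translate 1ℚ (shift w) n) (newtonSum J (shift w) n) (translate 1ℚ w n) (newtonSum (suc J) w n))
               (cong (λ z → translate 1ℚ w (suc n) - z) (sym (newtonSum-suc J w n))))
        (V-+ (translate-newtonSum J (shift w) n (λ j J≤j → vw (suc j) (s≤s J≤j)))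
             (translate-newtonSum (suc J) w n vw))
    where
    ring : ∀ a b c d → (a - b) + (c - d) ≡ a + 1ℚ * c - (b + d)
    ring = solve-∀ ringℚ

  Integral : PolyQ → Set
  Integral = All (V (+ 0))

  Integral-scaleP : ∀ {c f} → V (+ 0) c → Integral f → Integral (scaleP c f)
  Integral-scaleP vc [] = []
  Integral-scaleP vc (va ∷ vf) = V-mul vc va ∷ Integral-scaleP vc vf

  Integral-addP : ∀ {f g} → Integral f → Integral g → Integral (addP f g)
  Integral-addP [] vg = vg
  Integral-addP (va ∷ vf) [] = va ∷ vf
  Integral-addP (va ∷ vf) (vb ∷ vg) = V-+ va vb ∷ Integral-addP vf vg

  Integral-mulP : ∀ {f g} → Integral f → Integral g → Integral (mulP f g)
  Integral-mulP [] vg = []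
  Integral-mulP (va ∷ vf) vg = Integral-addP (Integral-scaleP va vg) (V-0 ∷ Integral-mulP vf vg)

  V-evalQ : ∀ {f x} → Integral f → V (+ 0) x → V (+ 0) (evalQ f x)
  V-evalQ [] vx = V-0
  V-evalQ (va ∷ vf) vx = V-+ va (V-mul vx (V-evalQ vf vx))

  V-evalQ-0 : ∀ {N f x} → Integral f → V (+ 0) x → V N x → V N (evalQ f x - evalQ f 0ℚ)
  V-evalQ-0 [] vx vNx = V-0
  V-evalQ-0 {N} {a ∷ f} {x} (va ∷ vf) vx vNx =
    V-≡ (ring a x (evalQ f x) (evalQ f 0ℚ)) (V-mul (V-evalQ vf vx) vNx)
    where
    ring : ∀ a x s t → s * x ≡ a + x * s - (a + 0ℚ * t)
    ring = solve-∀ ringℚ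

  module _ (K : ℕ) (X : ℕ → ℚ) (V-X : ∀ t → V (+ 0) (X t)) where

    -- These functions of t form an algebra containing `X`. In the application X t = p n, and this
    -- scaling is what puts pᵐ into the coefficient of nᵐ.
    record PolyMod (φ : ℕ → ℚ) : Set where
      constructor polyMod
      field
        poly : PolyQ
        integral : Integral poly
        congruent : ∀ t → V (+ K) (φ t - evalQ poly (X t))

    open PolyMod

    V-polyMod : ∀ {φ} → PolyMod φ → ∀ t → V (+ 0) (φ t)
    V-polyMod {φ} (polyMod G vG c) t =
      V-≡ (ring (φ t) (evalQ G (X t))) (V-+ (V-mono (ℤ.+≤+ z≤n) (c t)) (V-evalQ vG (V-X t)))
      where
      ring : ∀ a b → a - b + b ≡ a
      ring = solve-∀ ringℚ

    polyMod-cong : ∀ {φ ψ} → (∀ t → V (+ K) (ψ t - φ t)) → PolyMod φ → PolyMod ψ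
    polyMod-cong {φ} {ψ} d (polyMod G vG c) = polyMod G vG
      λ t → V-≡ (ring (ψ t) (φ t) (evalQ G (X t))) (V-+ (d t) (c t))
      where
      ring : ∀ a b c → a - b + (b - c) ≡ a - c
      ring = solve-∀ ringℚ

    polyMod-≡ : ∀ {φ ψ} → (∀ t → φ t ≡ ψ t) → PolyMod φ → PolyMod ψ
    polyMod-≡ {φ} {ψ} e = polyMod-cong (λ t → V-≡ (sym (trans (cong (λ z → ψ t - z) (e t)) (ℚP.+-inverseʳ (ψ t)))) V-0)

    polyMod-const : ∀ {c} → V (+ 0) c → PolyMod (λ _ → c)
    polyMod-const {c} vc = polyMod (constP c) (vc ∷ [])
      λ t → V-≡ (sym (trans (cong (λ z → c - z) (evalQ-constP c (X t))) (ℚP.+-inverseʳ c))) V-0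

    polyMod-X : PolyMod X
    polyMod-X = polyMod (0ℚ ∷ 1ℚ ∷ []) (V-0 ∷ V-fromℤ (+ 1) ∷ []) λ t → V-≡ (ring (X t)) V-0
      where
      ring : ∀ x → 0ℚ ≡ x - (0ℚ + x * (1ℚ + x * 0ℚ))
      ring = solve-∀ ringℚ

    polyMod-+ : ∀ {φ ψ} → PolyMod φ → PolyMod ψ → PolyMod (λ t → φ t + ψ t)
    polyMod-+ {φ} {ψ} (polyMod G vG c) (polyMod H vH d) = polyMod (addP G H) (Integral-addP vG vH)
      λ t → V-≡ (trans (ring (φ t) (ψ t) (evalQ G (X t)) (evalQ H (X t)))
                       (cong (λ z → φ t + ψ t - z) (sym (evalQ-addP G H (X t)))))
                (V-+ (c t) (d t))
      where
      ring : ∀ a b g h → a - g + (b - h) ≡ a + b - (g + h)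
      ring = solve-∀ ringℚ

    polyMod-* : ∀ {φ ψ} → PolyMod φ → PolyMod ψ → PolyMod (λ t → φ t * ψ t)
    polyMod-* {φ} {ψ} f@(polyMod G vG c) (polyMod H vH d) = polyMod (mulP G H) (Integral-mulP vG vH)
      λ t → V-≡ (trans (ring (φ t) (ψ t) (evalQ G (X t)) (evalQ H (X t)))
                       (cong (λ z → φ t * ψ t - z) (sym (evalQ-mulP G H (X t)))))
                (V-+ (V-mul (V-polyMod f t) (d t)) (V-mul (V-evalQ vH (V-X t)) (c t)))
      where
      ring : ∀ a b g h → a * (b - h) + h * (a - g) ≡ a * b - g * h
      ring = solve-∀ ringℚ

    polyMod-sumTo : ∀ n {φ : ℕ → ℕ → ℚ} → (∀ j → j < n → PolyMod (φ j)) → PolyMod (λ t → sumTo n (λ j → φ j t))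
    polyMod-sumTo zero f = polyMod-const V-0
    polyMod-sumTo (suc n) f =
      polyMod-+ (polyMod-sumTo n (λ j j<n → f j (ℕP.m<n⇒m<1+n j<n))) (f n (ℕP.n<1+n n))

    module _ {y : ℕ → ℕ} (Py : PolyMod (λ t → P * fromℕ (y t))) where

      -- With y the value at t, pʲ⁺¹ C(y, j + 1) = pʲ C(y, j) (p y - p j) / (j + 1): each new linear
      -- factor absorbs one p and becomes a polynomial in p y, and j + 1 < p is a p-adic unit.
      polyMod-binomial : ∀ j → j < p → PolyMod (λ t → P ^ j * binomial j (fromℕ (y t)))
      polyMod-binomial zero _ = polyMod-const (V-fromℤ (+ 1))
      polyMod-binomial (suc j) j<p =
        polyMod-≡ step (polyMod-* (polyMod-binomial j (ℕP.<-trans (ℕP.n<1+n j) j<p))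
          (polyMod-* (polyMod-+ Py (polyMod-const (V-neg (V-mul (V-fromℕ p) (V-fromℕ j)))))
                     (polyMod-const (V-inverse (+ suc j) (p∤small (s≤s z≤n) j<p) (divQ-* 1ℚ (fromℕ-suc≢0 j))))))
        where
        c = divQ 1ℚ (fromℕ (suc j))
        step : ∀ t → P ^ j * binomial j (fromℕ (y t)) * ((P * fromℕ (y t) + - (P * fromℕ j)) * c)
          ≡ P * P ^ j * binomial (suc j) (fromℕ (y t))
        step t = begin
          P ^ j * b * ((P * x + - (P * fromℕ j)) * c)
            ≡⟨ ring₁ (P ^ j) b P x (fromℕ j) c ⟩
          P * P ^ j * (b * (x - fromℕ j)) * c
            ≡⟨ cong (λ z → P * P ^ j * z * c) (sym (binomial-suc j x)) ⟩
          P * P ^ j * (binomial (suc j) x * fromℕ (suc j)) * c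
            ≡⟨ ring₂ (P * P ^ j) (binomial (suc j) x) (fromℕ (suc j)) c ⟩
          P * P ^ j * binomial (suc j) x * (c * fromℕ (suc j))
            ≡⟨ cong (P * P ^ j * binomial (suc j) x *_) (divQ-* 1ℚ (fromℕ-suc≢0 j)) ⟩
          P * P ^ j * binomial (suc j) x * 1ℚ
            ≡⟨ ℚP.*-identityʳ (P * P ^ j * binomial (suc j) x) ⟩
          P * P ^ j * binomial (suc j) x ∎
          where
          x = fromℕ (y t)
          b = binomial j x
          ring₁ : ∀ q b p x j c → q * b * ((p * x + - (p * j)) * c) ≡ p * q * (b * (x - j)) * c
          ring₁ = solve-∀ ringℚ
          ring₂ : ∀ q b d c → q * (b * d) * c ≡ q * b * (c * d)
          ring₂ = solve-∀ ringℚ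

      -- The binomial expansion is split at J ≤ p: below J the coefficients pʲ C(y, j) are covered
      -- by `polyMod-binomial`, and from J on the moments vanish modulo pᴷ.
      polyMod-translate : ∀ J (z : ℕ → ℚ) → J ≤ p → (∀ j → j < J → V (+ 0) (z j)) →
        (∀ j → J ≤ j → V (+ K) (P ^ j * z j)) →
        PolyMod (λ t → translate 1ℚ (λ j → P ^ j * z j) (y t))
      polyMod-translate J z J≤p vz vK =
        polyMod-cong (λ t → translate-newtonSum J (λ j → P ^ j * z j) (y t) vK)
          (polyMod-sumTo J (λ j j<J →
            polyMod-≡ (λ t → ring (P ^ j) (binomial j (fromℕ (y t))) (z j))
              (polyMod-* (polyMod-binomial j (ℕP.<-≤-trans j<J J≤p)) (polyMod-const (vz j j<J)))))
        where
        ring : ∀ a b c → a * b * c ≡ b * (a * c)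
        ring = solve-∀ ringℚ

-- Truncated sequences, rearranged sums and the factorisation of xⁿ - yⁿ.

cut : ℕ → (ℕ → ℚ) → ℕ → ℚ
cut zero u j = 0ℚ
cut (suc J) u zero = u 0
cut (suc J) u (suc j) = cut J (shift u) j

cut-< : ∀ J u j → j < J → cut J u j ≡ u j
cut-< (suc J) u zero _ = refl
cut-< (suc J) u (suc j) (s≤s j<J) = cut-< J (shift u) j j<J

cut-≥ : ∀ J u j → J ≤ j → cut J u j ≡ 0ℚ
cut-≥ zero u j _ = refl
cut-≥ (suc J) u (suc j) (s≤s J≤j) = cut-≥ J (shift u) j J≤j

sumTo-append : ∀ m n f → sumTo (m ℕ.+ n) f ≡ sumTo m f + sumTo n (λ i → f (m ℕ.+ i))
sumTo-append m zero f = trans (cong (λ k → sumTo k f) (ℕP.+-identityʳ m)) (sym (ℚP.+-identityʳ (sumTo m f)))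
sumTo-append m (suc n) f = trans (cong (λ k → sumTo k f) (ℕP.+-suc m n))
  (trans (cong (_+ f (m ℕ.+ n)) (sumTo-append m n f)) (ℚP.+-assoc (sumTo m f) (sumTo n (λ i → f (m ℕ.+ i))) (f (m ℕ.+ n))))

sumTo-evenOdd : ∀ h f → sumTo (h ℕ.+ h) f ≡ sumTo h (λ i → f (i ℕ.+ i)) + sumTo h (λ i → f (suc (i ℕ.+ i)))
sumTo-evenOdd zero f = refl
sumTo-evenOdd (suc h) f = begin
  sumTo (h ℕ.+ suc h) f + f (h ℕ.+ suc h)
    ≡⟨ cong (λ k → sumTo k f + f k) (ℕP.+-suc h h) ⟩
  sumTo (h ℕ.+ h) f + f (h ℕ.+ h) + f (suc (h ℕ.+ h))
    ≡⟨ cong (λ z → z + f (h ℕ.+ h) + f (suc (h ℕ.+ h))) (sumTo-evenOdd h f) ⟩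
  E + O + f (h ℕ.+ h) + f (suc (h ℕ.+ h))
    ≡⟨ ring E O (f (h ℕ.+ h)) (f (suc (h ℕ.+ h))) ⟩
  E + f (h ℕ.+ h) + (O + f (suc (h ℕ.+ h))) ∎
  where
  E = sumTo h (λ i → f (i ℕ.+ i))
  O = sumTo h (λ i → f (suc (i ℕ.+ i)))
  ring : ∀ a b c d → a + b + c + d ≡ a + c + (b + d)
  ring = solve-∀ ringℚ

-- The sum of xⁱ yʲ over i + j = n - 1, in Horner form.
geometric : ℚ → ℚ → ℕ → ℚ
geometric x y zero = 0ℚ
geometric x y (suc n) = x * geometric x y n + y ^ n

^-difference : ∀ x y n → x ^ n - y ^ n ≡ (x - y) * geometric x y n
^-difference x y zero = ring x y
  where
  ring : ∀ x y → 1ℚ - 1ℚ ≡ (x - y) * 0ℚ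
  ring = solve-∀ ringℚ
^-difference x y (suc n) = begin
  x * x ^ n - y * y ^ n                          ≡⟨ ring₁ x y (x ^ n) (y ^ n) ⟩
  x * (x ^ n - y ^ n) + (x - y) * y ^ n          ≡⟨ cong (λ z → x * z + (x - y) * y ^ n) (^-difference x y n) ⟩
  x * ((x - y) * g) + (x - y) * y ^ n            ≡⟨ ring₂ x y g (y ^ n) ⟩
  (x - y) * (x * g + y ^ n)                      ∎
  where
  g = geometric x y n
  ring₁ : ∀ x y a b → x * a - y * b ≡ x * (a - b) + (x - y) * b
  ring₁ = solve-∀ ringℚ
  ring₂ : ∀ x y g b → x * ((x - y) * g) + (x - y) * b ≡ (x - y) * (x * g + b)
  ring₂ = solve-∀ ringℚ

-- Denominators of Bernoulli numbers and Fermat's congruence.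

module BernoulliCongruence (p : ℕ) (p-prime : Prime p) where

  open Valuation p p-prime
  open PolynomialCongruence p p-prime

  p₁ : ℕ
  p₁ = ℕ.pred p

  p≡1+p₁ : p ≡ suc p₁
  p≡1+p₁ = sym (ℕP.suc-pred p {{prime⇒nonZero p-prime}})

  p₁<p : p₁ < p
  p₁<p = subst (p₁ <_) (sym p≡1+p₁) (ℕP.n<1+n p₁)

  w : ℕ → ℚ
  w n = P ^ n * Bern n

  -- Φ n = p (1 - pⁿ⁻¹) Bₙ, written so that it also makes sense for n = 0.
  Φ : ℕ → ℚ
  Φ n = sumTo p₁ (λ a → translate (fromℕ (suc a)) w n)

  P*Bern : ∀ n → P * Bern n ≡ w n + Φ n
  P*Bern n = begin
    P * Bern n                                             ≡⟨ sym (Bern-multiplication p n) ⟩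
    sumTo p (λ a → translate (fromℕ a) w n)                ≡⟨ cong (λ m → sumTo m (λ a → translate (fromℕ a) w n)) p≡1+p₁ ⟩
    sumTo (suc p₁) (λ a → translate (fromℕ a) w n)         ≡⟨ sumTo-head p₁ (λ a → translate (fromℕ a) w n) ⟩
    translate 0ℚ w n + Φ n                                 ≡⟨ cong (_+ Φ n) (translate-0 w n) ⟩
    w n + Φ n                                              ∎

  -- The recurrence determines Bₙ from earlier values after division by C(n + 1, n) = n + 1, which
  -- is prime to p in this range.
  Bern-integral : ∀ n → suc n < p → V (+ 0) (Bern n)
  Bern-integral = <-rec _ step
    where
    step : ∀ n → (∀ {i} → i < n → suc i < p → V (+ 0) (Bern i)) → suc n < p → V (+ 0) (Bern n)
    step zero rec _ = V-fromℤ (+ 1)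
    step (suc n) rec 1+n<p = V-cancel (+ (suc (suc n) C suc n))
      (subst (λ c → ¬ (p ℕD.∣ c)) (sym symmetric) (p∤small (s≤s z≤n) 1+n<p))
      (V-≡ (trans (ring S top) (trans (cong (λ z → top - z) (Bern-recurrence n)) (ring′ (fromℕ (suc (suc n) C suc n)) (Bern (suc n)))))
           (V-neg (V-sumTo (suc n) (λ i i≤n → V-mul (V-fromℕ (suc (suc n) C i)) (rec i≤n (ℕP.<-trans (s≤s i≤n) 1+n<p))))))
      where
      S = sumTo (suc n) (λ k → fromℕ (suc (suc n) C k) * Bern k)
      top = fromℕ (suc (suc n) C suc n) * Bern (suc n)
      symmetric : suc (suc n) C suc n ≡ suc (suc n)
      symmetric = trans (nCk≡nC[n∸k] {suc n} {suc (suc n)} (ℕP.n≤1+n (suc n)))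
                        (trans (cong (λ k → suc (suc n) C k) (ℕP.m+n∸n≡m 1 (suc n))) (nC1≡n (suc (suc n))))
      ring : ∀ s t → - s ≡ t - (s + t)
      ring = solve-∀ ringℚ
      ring′ : ∀ c b → c * b - 0ℚ ≡ b * c
      ring′ = solve-∀ ringℚ

  -- Removing the top moment from E((x + a)ⁿ) leaves integral combinations of lower moments only;
  -- this is what makes the strong induction for p Bₙ possible.
  V-translate-top : ∀ {N} a u n → V (+ 0) a → (∀ i → i < n → V N (u i)) → V N (translate a u n - u n)
  V-translate-top a u zero va vu = V-≡ (sym (ℚP.+-inverseʳ (u 0))) V-0
  V-translate-top a u (suc n) va vu =
    V-≡ (ring (translate a (shift u) n) (u (suc n)) a (translate a u n) (u n))
        (V-+ (V-translate-top a (shift u) n va (λ i i<n → vu (suc i) (s≤s i<n)))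
             (V-mul va (V-+ (V-translate-top a u n va (λ i i<n → vu i (ℕP.m<n⇒m<1+n i<n)))
                            (vu n (ℕP.n<1+n n)))))
    where
    ring : ∀ t s a x y → t - s + a * (x - y + y) ≡ t + a * x - s
    ring = solve-∀ ringℚ

  p∤1-p^ : ∀ n → ¬ (+ p ℤD.∣ (+ 1 ℤ.- + (p ℕ.^ suc n)))
  p∤1-p^ n p∣ = p∤1 (V-∣ (+ 1) (V-≡ (trans (cong (_+ P ^ suc n) eq) (ring (P ^ suc n)))
    (V-+ (∣-V (+ 1 ℤ.- + (p ℕ.^ suc n)) p∣) (V-mono (ℤ.+≤+ (s≤s z≤n)) (V-P^ (suc n))))))
    where
    eq : fromℤ (+ 1 ℤ.- + (p ℕ.^ suc n)) ≡ 1ℚ - P ^ suc n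
    eq = trans (fromℤ-+ (+ 1) (ℤ.- + (p ℕ.^ suc n)))
      (cong (λ z → 1ℚ + z) (trans (fromℤ-neg (+ (p ℕ.^ suc n))) (cong -_ (fromℕ-^ p (suc n)))))
    ring : ∀ x → 1ℚ - x + x ≡ 1ℚ
    ring = solve-∀ ringℚ

  -- (1 - pⁿ) p Bₙ = Φ n - (p - 1) pⁿ Bₙ, and the right-hand side only involves Bᵢ with i < n.
  P*Bern-integral : ∀ n → V (+ 0) (P * Bern n)
  P*Bern-integral = <-rec _ step
    where
    w-integral : ∀ i → V (+ 0) (P * Bern i) → V (+ 0) (w i)
    w-integral zero _ = V-fromℤ (+ 1)
    w-integral (suc i) v = V-≡ (ring P (P ^ i) (Bern (suc i))) (V-mul (V-mono (ℤ.+≤+ z≤n) (V-P^ i)) v)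
      where
      ring : ∀ p q b → q * (p * b) ≡ p * q * b
      ring = solve-∀ ringℚ
    step : ∀ n → (∀ {i} → i < n → V (+ 0) (P * Bern i)) → V (+ 0) (P * Bern n)
    step zero _ = V-≡ (sym (ℚP.*-identityʳ P)) (V-fromℕ p)
    step (suc n) rec = V-cancel (+ 1 ℤ.- + (p ℕ.^ suc n)) (p∤1-p^ n) (V-≡ (sym equation) tops)
      where
      m = suc n
      tops : V (+ 0) (sumTo p₁ (λ a → translate (fromℕ (suc a)) w m - w m))
      tops = V-sumTo p₁ λ a _ → V-translate-top (fromℕ (suc a)) w m (V-fromℕ (suc a)) (λ i i<m → w-integral i (rec i<m))
      split : ∀ k (f : ℕ → ℚ) c → sumTo k (λ a → f a - c) ≡ sumTo k f - fromℕ k * c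
      split zero f c = ring c
        where
        ring : ∀ c → 0ℚ ≡ 0ℚ - 0ℚ * c
        ring = solve-∀ ringℚ
      split (suc k) f c = trans (cong (_+ (f k - c)) (split k f c))
        (trans (ring (sumTo k f) (fromℕ k) c (f k)) (cong (λ z → sumTo k f + f k - z * c) (sym (fromℕ-suc k))))
        where
        ring : ∀ s k c x → s - k * c + (x - c) ≡ s + x - (1ℚ + k) * c
        ring = solve-∀ ringℚ
      equation : P * Bern m * fromℤ (+ 1 ℤ.- + (p ℕ.^ m)) ≡ sumTo p₁ (λ a → translate (fromℕ (suc a)) w m - w m)
      equation = begin
        P * Bern m * fromℤ (+ 1 ℤ.- + (p ℕ.^ m))
          ≡⟨ cong (P * Bern m *_) (trans (fromℤ-+ (+ 1) (ℤ.- + (p ℕ.^ m)))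
               (cong (λ z → 1ℚ + z) (trans (fromℤ-neg (+ (p ℕ.^ m))) (cong -_ (fromℕ-^ p m))))) ⟩
        P * Bern m * (1ℚ - P ^ m)
          ≡⟨ ring₁ P (Bern m) (P ^ m) ⟩
        P * Bern m - P * w m
          ≡⟨ cong₂ (λ x y → x - y * w m) (P*Bern m) (trans (cong fromℕ p≡1+p₁) (fromℕ-suc p₁)) ⟩
        w m + Φ m - (1ℚ + fromℕ p₁) * w m
          ≡⟨ ring₂ (w m) (Φ m) (fromℕ p₁) ⟩
        Φ m - fromℕ p₁ * w m
          ≡⟨ sym (split p₁ (λ a → translate (fromℕ (suc a)) w m) (w m)) ⟩
        sumTo p₁ (λ a → translate (fromℕ (suc a)) w m - w m) ∎
        where
        ring₁ : ∀ p b q → p * b * (1ℚ - q) ≡ p * b - p * (q * b)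
        ring₁ = solve-∀ ringℚ
        ring₂ : ∀ w f k → w + f - (1ℚ + k) * w ≡ f - k * w
        ring₂ = solve-∀ ringℚ

  -- The factor p enters with the first linear factor of C(p, j + 1) and is never cancelled, the
  -- denominators being prime to p.
  V-binomial-p : ∀ j → suc j < p → V (+ 1) (binomial (suc j) P)
  V-binomial-p j 1+j<p = V-cancel (+ suc j) (p∤small (s≤s z≤n) 1+j<p)
    (V-≡ (sym (binomial-suc j P)) (numerator j 1+j<p))
    where
    numerator : ∀ j → suc j < p → V (+ 1) (binomial j P * (P - fromℕ j))
    numerator zero _ = V-≡ (ring P) V-P
      where
      ring : ∀ x → x ≡ 1ℚ * (x - 0ℚ)
      ring = solve-∀ ringℚ
    numerator (suc j) lt = V-≡ (ℚP.*-comm (P - fromℕ (suc j)) (binomial (suc j) P))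
      (V-mul (V-sub (V-fromℕ p) (V-fromℕ (suc j))) (V-binomial-p j (ℕP.<-trans (ℕP.n<1+n (suc j)) lt)))

  -- In the expansion of (x + 1)ᵖ the two end terms are xᵖ and 1, and the coefficients C(p, j) in
  -- between are divisible by p.
  frobenius-+1 : ∀ x → V (+ 0) x → V (+ 1) ((x + 1ℚ) ^ p - (x ^ p + 1ℚ))
  frobenius-+1 x vx = V-≡ (sym equation) (V-+ low middle)
    where
    -- The moments from p on are replaced by 0, since `translate-newtonSum` wants the dropped
    -- moments divisible by p; the term xᵖ lost in this way is restored in `total`.
    u : ℕ → ℚ
    u = cut p (x ^_)
    rest : ℕ → ℚ
    rest j = x ^ j - u j
    low : V (+ 1) (translate 1ℚ u p - newtonSum p u p)
    low = translate-newtonSum p u p (λ j p≤j → V-≡ (sym (cut-≥ p (x ^_) j p≤j)) V-0)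
    V-u : ∀ j → j < p → V (+ 0) (u j)
    V-u j j<p = V-≡ (sym (cut-< p (x ^_) j j<p)) (V-^ j vx)
    T = sumTo p₁ (λ j → binomial (suc j) P * u (suc j))
    middle : V (+ 1) T
    middle = V-sumTo p₁ λ j j<p₁ → let 1+j<p = subst (suc j <_) (sym p≡1+p₁) (s≤s j<p₁) in
      V-≡ (ℚP.*-comm (u (suc j)) (binomial (suc j) P)) (V-mul (V-u (suc j) 1+j<p) (V-binomial-p j 1+j<p))
    newton : newtonSum p u p ≡ 1ℚ + T
    newton = begin
      newtonSum p u p           ≡⟨ cong (λ m → sumTo m (λ j → binomial j P * u j)) p≡1+p₁ ⟩
      sumTo (suc p₁) (λ j → binomial j P * u j)
                                ≡⟨ sumTo-head p₁ (λ j → binomial j P * u j) ⟩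
      1ℚ * u 0 + T              ≡⟨ cong (λ z → 1ℚ * z + T) (cut-< p (x ^_) 0 (ℕP.≤-trans (s≤s z≤n) p₁<p)) ⟩
      1ℚ + T                    ∎
    total : (x + 1ℚ) ^ p ≡ translate 1ℚ u p + x ^ p
    total = begin
      (x + 1ℚ) ^ p                                      ≡⟨ sym (translate-^ 1ℚ x p) ⟩
      translate 1ℚ (x ^_) p                             ≡⟨ translate-cong refl (λ i → ring (x ^ i) (u i)) p ⟩
      translate 1ℚ (λ i → u i + 1ℚ * rest i) p          ≡⟨ translate-linear 1ℚ 1ℚ u rest p ⟩
      translate 1ℚ u p + 1ℚ * translate 1ℚ rest p       ≡⟨ cong (λ z → translate 1ℚ u p + 1ℚ * z) (translate1-lowest p rest λ i i<p →
                                                             trans (cong (λ z → x ^ i - z) (cut-< p (x ^_) i i<p)) (ℚP.+-inverseʳ (x ^ i))) ⟩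
      translate 1ℚ u p + 1ℚ * (x ^ p - u p)             ≡⟨ cong (λ z → translate 1ℚ u p + 1ℚ * (x ^ p - z)) (cut-≥ p (x ^_) p ℕP.≤-refl) ⟩
      translate 1ℚ u p + 1ℚ * (x ^ p - 0ℚ)              ≡⟨ ring′ (translate 1ℚ u p) (x ^ p) ⟩
      translate 1ℚ u p + x ^ p                          ∎
      where
      ring : ∀ a b → a ≡ b + 1ℚ * (a - b)
      ring = solve-∀ ringℚ
      ring′ : ∀ a b → a + 1ℚ * (b - 0ℚ) ≡ a + b
      ring′ = solve-∀ ringℚ
    equation : (x + 1ℚ) ^ p - (x ^ p + 1ℚ) ≡ translate 1ℚ u p - newtonSum p u p + T
    equation = trans (cong (λ z → z - (x ^ p + 1ℚ)) total)
      (trans (ring (translate 1ℚ u p) (x ^ p) T) (cong (λ z → translate 1ℚ u p - z + T) (sym newton)))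
      where
      ring : ∀ a b t → a + b - (b + 1ℚ) ≡ a - (1ℚ + t) + t
      ring = solve-∀ ringℚ

  fermat : ∀ a → V (+ 1) (fromℕ a ^ p - fromℕ a)
  fermat zero = V-≡ (sym (trans (cong (λ m → 0ℚ ^ m - 0ℚ) p≡1+p₁) (ring (0ℚ ^ p₁)))) V-0
    where
    ring : ∀ x → 0ℚ * x - 0ℚ ≡ 0ℚ
    ring = solve-∀ ringℚ
  fermat (suc a) = V-≡ equation (V-+ (frobenius-+1 x (V-fromℕ a)) (fermat a))
    where
    x = fromℕ a
    ring : ∀ y z x → y - (z + 1ℚ) + (z - x) ≡ y - (x + 1ℚ)
    ring = solve-∀ ringℚ
    equation : (x + 1ℚ) ^ p - (x ^ p + 1ℚ) + (x ^ p - x) ≡ fromℕ (suc a) ^ p - fromℕ (suc a)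
    equation = trans (ring ((x + 1ℚ) ^ p) (x ^ p) x)
      (cong (λ z → z ^ p - z) (trans (ℚP.+-comm x 1ℚ) (sym (fromℕ-suc a))))

  fermat-unit : ∀ a → ¬ (+ p ℤD.∣ + a) → V (+ 1) (fromℕ a ^ p₁ - 1ℚ)
  fermat-unit a p∤a = V-cancel (+ a) p∤a (V-≡ equation (fermat a))
    where
    x = fromℕ a
    ring : ∀ x y → x * y - x ≡ (y - 1ℚ) * x
    ring = solve-∀ ringℚ
    equation : x ^ p - x ≡ (x ^ p₁ - 1ℚ) * x
    equation = trans (cong (λ m → x ^ m - x) p≡1+p₁) (ring x (x ^ p₁))

  -- The cofactor of x - y in xᵖ - yᵖ is congruent to p yᵖ⁻¹ modulo p, because x ≡ y; so it supplies
  -- one further factor p.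
  V-^p : ∀ {m x y} → V (+ 0) x → V (+ 0) y → V (+ suc m) (x - y) → V (+ suc (suc m)) (x ^ p - y ^ p)
  V-^p {m} {x} {y} vx vy d = V-≡ (trans (ℚP.*-comm (geometric x y p) (x - y)) (sym (^-difference x y p)))
    (V-* (subst (λ k → V (+ 1) (geometric x y k)) (sym p≡1+p₁)
           (V-≡ (ring (geometric x y (suc p₁)) (fromℕ (suc p₁) * y ^ p₁))
             (V-+ (near p₁) (V-≡ (trans (ℚP.*-comm (y ^ p₁) P) (cong (λ k → fromℕ k * y ^ p₁) p≡1+p₁)) (V-mul (V-^ p₁ vy) V-P))))) d)
    where
    ring : ∀ a b → a - b + b ≡ a
    ring = solve-∀ ringℚ
    geometric-V : ∀ n → V (+ 0) (geometric x y n)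
    geometric-V zero = V-0
    geometric-V (suc n) = V-+ (V-mul vx (geometric-V n)) (V-^ n vy)
    near : ∀ n → V (+ 1) (geometric x y (suc n) - fromℕ (suc n) * y ^ n)
    near zero = V-≡ (ring₀ x) V-0
      where
      ring₀ : ∀ x → 0ℚ ≡ x * 0ℚ + 1ℚ - 1ℚ * 1ℚ
      ring₀ = solve-∀ ringℚ
    near (suc n) = V-≡ equation
      (V-+ (V-mul (geometric-V (suc n)) (V-mono {+ 1} {+ suc m} (ℤ.+≤+ (s≤s z≤n)) d)) (V-mul vy (near n)))
      where
      g = geometric x y (suc n)
      ring₁ : ∀ x y g c q → g * (x - y) + y * (g - c * q) ≡ x * g + y * q - (1ℚ + c) * (y * q)
      ring₁ = solve-∀ ringℚ
      equation : g * (x - y) + y * (g - fromℕ (suc n) * y ^ n) ≡ x * g + y ^ suc n - fromℕ (suc (suc n)) * y ^ suc n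
      equation = trans (ring₁ x y g (fromℕ (suc n)) (y ^ n))
        (cong (λ z → x * g + y ^ suc n - z * y ^ suc n) (sym (fromℕ-suc (suc n))))

  V-^p^ : ∀ {x y} k → V (+ 0) x → V (+ 0) y → V (+ 1) (x - y) → V (+ suc k) (x ^ (p ℕ.^ k) - y ^ (p ℕ.^ k))
  V-^p^ {x} {y} zero vx vy d = V-≡ (cong₂ _-_ (sym (ℚP.*-identityʳ x)) (sym (ℚP.*-identityʳ y))) d
  V-^p^ {x} {y} (suc k) vx vy d = V-≡ (cong₂ _-_ (power-eq x) (power-eq y))
    (V-^p (V-^ (p ℕ.^ k) vx) (V-^ (p ℕ.^ k) vy) (V-^p^ k vx vy d))
    where
    power-eq : ∀ x → (x ^ (p ℕ.^ k)) ^ p ≡ x ^ (p ℕ.^ suc k)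
    power-eq x = trans (^-assocʳ x (p ℕ.^ k) p) (cong (x ^_) (ℕP.*-comm (p ℕ.^ k) p))

-- Power sums and interpolation along a residue class modulo p - 1.

module BernoulliInterpolation (p : ℕ) (p-prime : Prime p) where

  open Valuation p p-prime
  open PolynomialCongruence p p-prime
  open BernoulliCongruence p p-prime

  V-^-cong : ∀ {N x y} n → V (+ 0) x → V (+ 0) y → V N (x - y) → V N (x ^ n - y ^ n)
  V-^-cong zero vx vy d = V-≡ (sym (ℚP.+-inverseʳ 1ℚ)) V-0
  V-^-cong {N} {x} {y} (suc n) vx vy d = V-≡ (ring x y (x ^ n) (y ^ n))
    (V-+ (V-mul vx (V-^-cong n vx vy d)) (V-mul (V-^ n vy) d))
    where
    ring : ∀ x y a b → x * (a - b) + b * (x - y) ≡ x * a - y * b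
    ring = solve-∀ ringℚ

  powerSum : ℕ → ℚ
  powerSum e = sumTo p₁ (λ a → fromℕ (suc a) ^ e)

  -- Multiplication by 2 permutes the nonzero residues: the even ones are 2a for a ≤ h, and the
  -- odd ones are 2a - p for a > h, whose pᴷ-th powers agree with those of 2a modulo pᴷ⁺¹.
  powerSum-doubling : ∀ h → p₁ ≡ h ℕ.+ h → ∀ K k →
    V (+ suc K) (powerSum (k ℕ.* p ℕ.^ K) - fromℕ 2 ^ (k ℕ.* p ℕ.^ K) * powerSum (k ℕ.* p ℕ.^ K))
  powerSum-doubling h p₁≡h+h K k = V-≡ (sym equation) (V-sumTo h λ i _ → odd i)
    where
    e = k ℕ.* p ℕ.^ K
    f : ℕ → ℚ
    f a = fromℕ (suc a) ^ e
    c = fromℕ 2 ^ e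
    double : ∀ a → (fromℕ 2 * fromℕ a) ^ e ≡ c * fromℕ a ^ e
    double a = ^-distrib-* (fromℕ 2) (fromℕ a) e
    even : ∀ i → f (suc (i ℕ.+ i)) ≡ c * f i
    even i = trans (cong (_^ e) (trans (cong fromℕ (arith i)) (fromℕ-* 2 (suc i)))) (double (suc i))
      where
      arith : ∀ i → suc (suc (i ℕ.+ i)) ≡ 2 ℕ.* suc i
      arith = ℕSolver.solve-∀
    odd : ∀ i → V (+ suc K) (f (i ℕ.+ i) - c * f (h ℕ.+ i))
    odd i = V-≡ (cong₂ _-_ (^-assocʳ x k (p ℕ.^ K)) (trans (^-assocʳ y k (p ℕ.^ K)) (double (suc (h ℕ.+ i)))))
      (V-^p^ K (V-^ k vx) (V-^ k vy) (V-^-cong k vx vy (V-≡ x-y≡ (V-neg V-P))))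
      where
      x = fromℕ (suc (i ℕ.+ i))
      y = fromℕ 2 * fromℕ (suc (h ℕ.+ i))
      vx = V-fromℕ (suc (i ℕ.+ i))
      vy = V-mul (V-fromℕ 2) (V-fromℕ (suc (h ℕ.+ i)))
      arith : ∀ h i → 2 ℕ.* suc (h ℕ.+ i) ≡ suc (i ℕ.+ i) ℕ.+ suc (h ℕ.+ h)
      arith = ℕSolver.solve-∀
      ring : ∀ x p → - p ≡ x - (x + p)
      ring = solve-∀ ringℚ
      x-y≡ : - P ≡ x - y
      x-y≡ = trans (ring x P) (cong (λ z → x - z)
        (trans (cong (λ m → x + fromℕ m) (trans p≡1+p₁ (cong suc p₁≡h+h)))
        (trans (sym (fromℕ-+ (suc (i ℕ.+ i)) (suc (h ℕ.+ h))))
        (trans (cong fromℕ (sym (arith h i))) (fromℕ-* 2 (suc (h ℕ.+ i)))))))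
    equation : powerSum e - c * powerSum e ≡ sumTo h (λ i → f (i ℕ.+ i) - c * f (h ℕ.+ i))
    equation = begin
      powerSum e - c * powerSum e
        ≡⟨ cong (λ m → sumTo m f - c * sumTo m f) p₁≡h+h ⟩
      sumTo (h ℕ.+ h) f - c * sumTo (h ℕ.+ h) f
        ≡⟨ cong₂ (λ s t → s - c * t)
             (trans (sumTo-evenOdd h f) (cong (λ z → E + z) (trans (sumTo-cong h (λ i _ → even i)) (sumTo-* h c f))))
             (sumTo-append h h f) ⟩
      E + c * L - c * (L + U)
        ≡⟨ ring c E L U ⟩
      E + (- c) * U
        ≡⟨ cong (λ z → E + z) (sym (sumTo-* h (- c) (λ i → f (h ℕ.+ i)))) ⟩
      E + sumTo h (λ i → (- c) * f (h ℕ.+ i))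
        ≡⟨ sym (sumTo-+ h (λ i → f (i ℕ.+ i)) (λ i → (- c) * f (h ℕ.+ i))) ⟩
      sumTo h (λ i → f (i ℕ.+ i) + (- c) * f (h ℕ.+ i))
        ≡⟨ sumTo-cong h (λ i _ → ring′ (f (i ℕ.+ i)) c (f (h ℕ.+ i))) ⟩
      sumTo h (λ i → f (i ℕ.+ i) - c * f (h ℕ.+ i)) ∎
      where
      E = sumTo h (λ i → f (i ℕ.+ i))
      L = sumTo h f
      U = sumTo h (λ i → f (h ℕ.+ i))
      ring : ∀ c e l u → e + c * l - c * (l + u) ≡ e + (- c) * u
      ring = solve-∀ ringℚ
      ring′ : ∀ a c b → a + (- c) * b ≡ a - c * b
      ring′ = solve-∀ ringℚ

  fermat-p^ : ∀ K a → V (+ 1) (fromℕ a ^ (p ℕ.^ K) - fromℕ a)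
  fermat-p^ zero a = V-≡ (sym (trans (cong (λ z → z - fromℕ a) (ℚP.*-identityʳ (fromℕ a))) (ℚP.+-inverseʳ (fromℕ a)))) V-0
  fermat-p^ (suc K) a = V-≡ equation (V-+ (fermat (a ℕ.^ (p ℕ.^ K))) (fermat-p^ K a))
    where
    x = fromℕ a
    b = fromℕ (a ℕ.^ (p ℕ.^ K))
    ring : ∀ u v x → u - v + (v - x) ≡ u - x
    ring = solve-∀ ringℚ
    equation : b ^ p - b + (x ^ (p ℕ.^ K) - x) ≡ x ^ (p ℕ.^ suc K) - x
    equation = trans (cong (λ z → b ^ p - b + (z - x)) (sym (fromℕ-^ a (p ℕ.^ K))))
      (trans (ring (b ^ p) b x) (cong (λ z → z - x)
        (trans (cong (_^ p) (fromℕ-^ a (p ℕ.^ K)))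
        (trans (^-assocʳ x (p ℕ.^ K) p) (cong (x ^_) (ℕP.*-comm (p ℕ.^ K) p))))))

  -- Here 0 < 2^κ - 1 < p, so the size of p settles the matter and nothing about the order of 2
  -- modulo p is required.
  1≢2^ : ∀ κ → 1 ≤ κ → 2 ℕ.^ κ ≤ p → ¬ V (+ 1) (1ℚ - fromℕ 2 ^ κ)
  1≢2^ (suc κ) _ 2^κ≤p v = p∤small 0<m m<p (V-∣ (+ m) (V-≡ equation (V-neg v)))
    where
    m = ℕ.pred (2 ℕ.^ suc κ)
    1≤2^κ : 1 ≤ 2 ℕ.^ κ
    1≤2^κ = ℕP.m^n>0 2 κ
    2≤2^ : 2 ≤ 2 ℕ.^ suc κ
    2≤2^ = ℕP.*-monoʳ-≤ 2 1≤2^κ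
    1+m≡ : suc m ≡ 2 ℕ.^ suc κ
    1+m≡ = ℕP.suc-pred (2 ℕ.^ suc κ) {{ℕ.>-nonZero (ℕP.≤-trans (s≤s z≤n) 2≤2^)}}
    0<m : 0 < m
    0<m = ℕP.≤-pred (subst (2 ≤_) (sym 1+m≡) 2≤2^)
    m<p : m < p
    m<p = subst (_≤ p) (sym 1+m≡) 2^κ≤p
    ring : ∀ m → - (1ℚ - (1ℚ + m)) ≡ m
    ring = solve-∀ ringℚ
    equation : - (1ℚ - fromℕ 2 ^ suc κ) ≡ fromℕ m
    equation = trans (cong (λ z → - (1ℚ - z)) (trans (sym (fromℕ-^ 2 (suc κ))) (trans (cong fromℕ (sym 1+m≡)) (fromℕ-suc m))))
                     (ring (fromℕ m))

  -- Doubling multiplies the sum by 2ᵉ with e = k pᴷ, so 1 - 2ᵉ times the sum is 0 modulo pᴷ⁺¹; it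
  -- remains to see that 1 - 2ᵉ is a unit, and 2ᵉ ≡ 2ᵏ by Fermat. The alternative k + κ = p - 1
  -- represents the class of -κ: there 2ᵏ 2^κ ≡ 1, so 2ᵏ ≡ 1 would again force 2^κ ≡ 1.
  powerSum-vanishes : ∀ h → p₁ ≡ h ℕ.+ h → ∀ κ → 1 ≤ κ → 2 ℕ.^ κ ≤ p → ∀ k → k ≡ κ ⊎ k ℕ.+ κ ≡ p₁ →
    ∀ K → V (+ suc K) (powerSum (k ℕ.* p ℕ.^ K))
  powerSum-vanishes h p₁≡h+h κ 1≤κ 2^κ≤p k base K = V-cancel b p∤b (V-≡ equation (powerSum-doubling h p₁≡h+h K k))
    where
    e = k ℕ.* p ℕ.^ K
    b = + 1 ℤ.- + (2 ℕ.^ e)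
    b≡ : fromℤ b ≡ 1ℚ - fromℕ 2 ^ e
    b≡ = trans (fromℤ-+ (+ 1) (ℤ.- + (2 ℕ.^ e)))
      (cong (λ z → 1ℚ + z) (trans (fromℤ-neg (+ (2 ℕ.^ e))) (cong -_ (fromℕ-^ 2 e))))
    equation : powerSum e - fromℕ 2 ^ e * powerSum e ≡ powerSum e * fromℤ b
    equation = trans (ring (powerSum e) (fromℕ 2 ^ e)) (cong (powerSum e *_) (sym b≡))
      where
      ring : ∀ s c → s - c * s ≡ s * (1ℚ - c)
      ring = solve-∀ ringℚ
    2^e≡2^k : V (+ 1) (fromℕ 2 ^ e - fromℕ 2 ^ k)
    2^e≡2^k = V-≡ (cong₂ _-_ (trans (cong (_^ (p ℕ.^ K)) (fromℕ-^ 2 k)) (^-assocʳ (fromℕ 2) k (p ℕ.^ K))) (fromℕ-^ 2 k))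
      (fermat-p^ K (2 ℕ.^ k))
    p∤b : ¬ (+ p ℤD.∣ b)
    p∤b p∣b = contradiction base
      where
      1≡2^k : V (+ 1) (1ℚ - fromℕ 2 ^ k)
      1≡2^k = V-≡ (trans (cong (λ z → z + (fromℕ 2 ^ e - fromℕ 2 ^ k)) b≡) (ring (fromℕ 2 ^ e) (fromℕ 2 ^ k))) (V-+ (∣-V b p∣b) 2^e≡2^k)
        where
        ring : ∀ x y → 1ℚ - x + (x - y) ≡ 1ℚ - y
        ring = solve-∀ ringℚ
      2<p : 2 < p
      2<p = subst (2 <_) (sym p≡1+p₁) (s≤s (2≤p₁ h p₁≡h+h))
        where
        2≤p₁ : ∀ h → p₁ ≡ h ℕ.+ h → 2 ≤ p₁
        2≤p₁ zero e = ⊥-elim (p∤1 (subst (λ m → m ℕD.∣ 1) (sym (trans p≡1+p₁ (cong suc e))) ℕD.∣-refl))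
        2≤p₁ (suc h) e = subst (2 ≤_) (sym (trans e (cong suc (ℕP.+-suc h h)))) (s≤s (s≤s z≤n))
      contradiction : k ≡ κ ⊎ k ℕ.+ κ ≡ p₁ → ⊥
      contradiction (inj₁ refl) = 1≢2^ κ 1≤κ 2^κ≤p 1≡2^k
      contradiction (inj₂ k+κ≡p₁) = 1≢2^ κ 1≤κ 2^κ≤p
        (V-≡ (trans (cong (λ z → (- (z - 1ℚ)) - fromℕ 2 ^ κ * (1ℚ - fromℕ 2 ^ k))
                (trans (cong (fromℕ 2 ^_) (sym k+κ≡p₁)) (^-homo-* (fromℕ 2) k κ))) (ring (fromℕ 2 ^ k) (fromℕ 2 ^ κ)))
          (V-sub (V-neg (fermat-unit 2 (p∤small (s≤s z≤n) 2<p))) (V-mul (V-^ κ (V-fromℕ 2)) 1≡2^k)))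
        where
        ring : ∀ a b → (- (a * b - 1ℚ)) - b * (1ℚ - a) ≡ 1ℚ - b
        ring = solve-∀ ringℚ

  p₁∤ : ¬ (+ p ℤD.∣ + p₁)
  p₁∤ = p∤small (ℕP.≤-pred (subst (1 <_) p≡1+p₁ (ℕ.nonTrivial⇒n>1 p {{prime⇒nonTrivial p-prime}}))) p₁<p

  p^≡1 : ∀ K → ∃ λ r → p ℕ.^ K ≡ suc (p₁ ℕ.* r)
  p^≡1 zero = 0 , cong suc (sym (ℕP.*-zeroʳ p₁))
  p^≡1 (suc K) with p^≡1 K
  ... | r , e = r ℕ.+ suc (p₁ ℕ.* r) , trans (cong₂ ℕ._*_ p≡1+p₁ e) (arith p₁ r)
    where
    arith : ∀ q r → suc q ℕ.* suc (q ℕ.* r) ≡ suc (q ℕ.* (r ℕ.+ suc (q ℕ.* r)))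
    arith = ℕSolver.solve-∀

  module Residue (a : ℕ) (a<p₁ : a < p₁) (K : ℕ) (K<p₁ : suc (suc K) ≤ p₁) where

    α β : ℚ
    α = fromℕ (suc a)
    β = divQ 1ℚ α

    p∤α : ¬ (+ p ℤD.∣ + suc a)
    p∤α = p∤small (s≤s z≤n) (ℕP.≤-trans (s≤s a<p₁) p₁<p)

    β*α : β * α ≡ 1ℚ
    β*α = divQ-* 1ℚ (fromℕ-suc≢0 a)

    V-β : V (+ 0) β
    V-β = V-inverse (+ suc a) p∤α β*α

    z : ℕ → ℚ
    z j = β ^ j * Bern j

    -- This is E((1 + p x / α)ⁿ), the factor that remains when αⁿ is taken out of E((α + p x)ⁿ).
    newton : ℕ → ℚ
    newton n = translate 1ℚ (λ j → P ^ j * z j) n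

    translate-α : ∀ n → translate α w n ≡ α ^ n * newton n
    translate-α n = trans (translate-cong (sym (ℚP.*-identityʳ α)) factor n) (translate-scale α 1ℚ (λ j → P ^ j * z j) n)
      where
      ring : ∀ a p b x → a * (p * (b * x)) ≡ b * a * (p * x)
      ring = solve-∀ ringℚ
      factor : ∀ i → w i ≡ α ^ i * (P ^ i * z i)
      factor i = sym (begin
        α ^ i * (P ^ i * (β ^ i * Bern i))   ≡⟨ ring (α ^ i) (P ^ i) (β ^ i) (Bern i) ⟩
        β ^ i * α ^ i * w i                  ≡⟨ cong (_* w i) (sym (^-distrib-* β α i)) ⟩
        (β * α) ^ i * w i                    ≡⟨ cong (_* w i) (trans (cong (_^ i) β*α) (1^ i)) ⟩
        1ℚ * w i                             ≡⟨ ℚP.*-identityˡ (w i) ⟩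
        w i                                  ∎)

    z-integral : ∀ j → j < p₁ → V (+ 0) (z j)
    z-integral j j<p₁ = V-mul (V-^ j V-β) (Bern-integral j (ℕP.≤-trans (s≤s j<p₁) p₁<p))

    -- For j ≥ p - 1 only p Bⱼ is known to be integral, so one of the j factors p is spent on the
    -- denominator. This is the origin of the bound K + 2 ≤ p - 1.
    z-tail : ∀ j → p₁ ≤ j → V (+ suc K) (P ^ j * z j)
    z-tail zero p₁≤0 with ℕP.≤-trans K<p₁ p₁≤0
    ... | ()
    z-tail (suc j) p₁≤j = V-≡ (ring (P ^ j) P (β ^ suc j) (Bern (suc j)))
      (V-mul (V-mul (V-^ (suc j) V-β) (P*Bern-integral (suc j)))
             (V-mono (ℤ.+≤+ (ℕP.≤-pred (ℕP.≤-trans K<p₁ p₁≤j))) (V-P^ j)))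
      where
      ring : ∀ q p b x → b * (p * x) * q ≡ p * q * (b * x)
      ring = solve-∀ ringℚ

    newton-polyMod : ∀ X V-X y → PolyMod (suc K) X V-X (λ t → P * fromℕ (y t)) → PolyMod (suc K) X V-X (λ t → newton (y t))
    newton-polyMod X V-X y Py = polyMod-translate (suc K) X V-X {y} Py p₁ z (ℕP.<⇒≤ p₁<p) z-integral z-tail

    -- `newton` agrees with one p-integral polynomial in p n; if p n ≡ 0 its value is that at 0, and
    -- `newton 0` is E(1) = 1.
    newton≡1 : ∀ n → V (+ suc K) (P * fromℕ n) → V (+ suc K) (newton n - 1ℚ)
    newton≡1 n Pn = V-≡ (ring (newton n) (evalQ (poly g) (X n)) (evalQ (poly g) 0ℚ))
      (V-+ (V-+ (congruent g n) (V-evalQ-0 (integral g) (V-X n) Pn))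
           (V-neg (V-≡ (cong (λ x → 1ℚ - evalQ (poly g) x) (ℚP.*-zeroʳ P)) (congruent g 0))))
      where
      open PolyMod
      X : ℕ → ℚ
      X t = P * fromℕ t
      V-X : ∀ t → V (+ 0) (X t)
      V-X t = V-mul (V-fromℕ p) (V-fromℕ t)
      g = newton-polyMod X V-X id (polyMod-X (suc K) X V-X)
      ring : ∀ x y o → x - y + (y - o) + - (1ℚ - o) ≡ x - 1ℚ
      ring = solve-∀ ringℚ

    -- The Fermat quotient of α.
    q : ℚ
    q = (α ^ p₁ - 1ℚ) * 1/P

    V-q : V (+ 0) q
    V-q = V-≡ (cong ((α ^ p₁ - 1ℚ) *_) (ℚP.*-identityʳ 1/P)) (V-* (fermat-unit (suc a) p∤α) (V-power -[1+ 0 ]))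

    α^p₁ : α ^ p₁ ≡ P * q + 1ℚ
    α^p₁ = sym (begin
      P * ((α ^ p₁ - 1ℚ) * 1/P) + 1ℚ        ≡⟨ ring₁ P (α ^ p₁) 1/P ⟩
      (α ^ p₁ - 1ℚ) * (1/P * P) + 1ℚ        ≡⟨ cong (λ x → (α ^ p₁ - 1ℚ) * x + 1ℚ) 1/P*P ⟩
      (α ^ p₁ - 1ℚ) * 1ℚ + 1ℚ               ≡⟨ ring₂ (α ^ p₁) ⟩
      α ^ p₁                                ∎)
      where
      ring₁ : ∀ p x i → p * ((x - 1ℚ) * i) + 1ℚ ≡ (x - 1ℚ) * (i * p) + 1ℚ
      ring₁ = solve-∀ ringℚ
      ring₂ : ∀ x → (x - 1ℚ) * 1ℚ + 1ℚ ≡ x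
      ring₂ = solve-∀ ringℚ

    -- The power (1 + p q)ᵗ is itself a binomial expansion, with moments pʲ qʲ; so
    -- `polyMod-translate` serves for this factor as well as for `newton`.
    α^-newton : ∀ k t → α ^ k * translate 1ℚ (λ j → P ^ j * q ^ j) t ≡ α ^ (k ℕ.+ p₁ ℕ.* t)
    α^-newton k t = sym (begin
      α ^ (k ℕ.+ p₁ ℕ.* t)                              ≡⟨ ^-homo-* α k (p₁ ℕ.* t) ⟩
      α ^ k * α ^ (p₁ ℕ.* t)                            ≡⟨ cong (α ^ k *_) (sym (^-assocʳ α p₁ t)) ⟩
      α ^ k * (α ^ p₁) ^ t                              ≡⟨ cong (λ x → α ^ k * x ^ t) α^p₁ ⟩
      α ^ k * (P * q + 1ℚ) ^ t                          ≡⟨ cong (α ^ k *_) (sym (translate-^ 1ℚ (P * q) t)) ⟩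
      α ^ k * translate 1ℚ ((P * q) ^_) t               ≡⟨ cong (α ^ k *_) (translate-cong refl (λ j → ^-distrib-* P q j) t) ⟩
      α ^ k * translate 1ℚ (λ j → P ^ j * q ^ j) t      ∎)

  module _ (K : ℕ) (K<p₁ : suc (suc K) ≤ p₁) (k : ℕ) where

    private
      n : ℕ → ℕ
      n t = k ℕ.+ p₁ ℕ.* t
      X : ℕ → ℚ
      X t = P * fromℕ (n t)
      V-X : ∀ t → V (+ 0) (X t)
      V-X t = V-mul (V-fromℕ p) (V-fromℕ (n t))

    -- In n = k + (p - 1) t the parameter t is recovered by dividing by p - 1, a p-adic unit.
    P*t-polyMod : PolyMod (suc K) X V-X (λ t → P * fromℕ t)
    P*t-polyMod = polyMod-≡ (suc K) X V-X equation
      (polyMod-* (suc K) X V-X (polyMod-const (suc K) X V-X {divQ 1ℚ (fromℕ p₁)} (V-inverse (+ p₁) p₁∤ (divQ-* 1ℚ (p∤⇒≢0 {+ p₁} p₁∤))))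
        (polyMod-+ (suc K) X V-X (polyMod-X (suc K) X V-X)
          (polyMod-const (suc K) X V-X (V-neg (V-mul (V-fromℕ p) (V-fromℕ k))))))
      where
      c = divQ 1ℚ (fromℕ p₁)
      equation : ∀ t → c * (X t + - (P * fromℕ k)) ≡ P * fromℕ t
      equation t = begin
        c * (P * fromℕ (n t) + - (P * fromℕ k))
          ≡⟨ cong (λ x → c * (P * x + - (P * fromℕ k))) (trans (fromℕ-+ k (p₁ ℕ.* t)) (cong (λ x → fromℕ k + x) (fromℕ-* p₁ t))) ⟩
        c * (P * (fromℕ k + fromℕ p₁ * fromℕ t) + - (P * fromℕ k))
          ≡⟨ ring c P (fromℕ k) (fromℕ p₁) (fromℕ t) ⟩
        c * fromℕ p₁ * (P * fromℕ t)
          ≡⟨ cong (_* (P * fromℕ t)) (divQ-* 1ℚ (p∤⇒≢0 {+ p₁} p₁∤)) ⟩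
        1ℚ * (P * fromℕ t)
          ≡⟨ ℚP.*-identityˡ (P * fromℕ t) ⟩
        P * fromℕ t ∎
        where
        ring : ∀ c p k d t → c * (p * (k + d * t) + - (p * k)) ≡ c * d * (p * t)
        ring = solve-∀ ringℚ

    translate-polyMod : ∀ a → a < p₁ → PolyMod (suc K) X V-X (λ t → translate (fromℕ (suc a)) w (n t))
    translate-polyMod a a<p₁ = polyMod-≡ (suc K) X V-X
      (λ t → trans (cong (_* newton (n t)) (α^-newton k t)) (sym (translate-α (n t))))
      (polyMod-* (suc K) X V-X
        (polyMod-* (suc K) X V-X (polyMod-const (suc K) X V-X (V-^ k (V-fromℕ (suc a))))
          (polyMod-translate (suc K) X V-X {id} P*t-polyMod p₁ (q ^_) (ℕP.<⇒≤ p₁<p) (λ j _ → V-^ j V-q)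
            (λ j p₁≤j → V-≡ (ℚP.*-comm (q ^ j) (P ^ j))
               (V-mul (V-^ j V-q) (V-mono (ℤ.+≤+ (ℕP.≤-trans (ℕP.≤-trans (ℕP.n≤1+n (suc K)) K<p₁) p₁≤j)) (V-P^ j))))))
        (newton-polyMod X V-X n (polyMod-X (suc K) X V-X)))
      where open Residue a a<p₁ K K<p₁

    Φ-polyMod : PolyMod (suc K) X V-X (λ t → Φ (n t))
    Φ-polyMod = polyMod-sumTo (suc K) X V-X p₁ translate-polyMod

    Φ≡powerSum : ∀ m → V (+ suc K) (P * fromℕ m) → V (+ suc K) (Φ m - powerSum m)
    Φ≡powerSum m Pm = V-≡ equation (V-sumTo p₁ step)
      where
      step : ∀ a → a < p₁ → V (+ suc K) (translate (fromℕ (suc a)) w m + (- 1ℚ) * fromℕ (suc a) ^ m)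
      step a a<p₁ = V-≡ (trans (ring (α ^ m) (newton m)) (cong (λ x → x + (- 1ℚ) * α ^ m) (sym (translate-α m))))
        (V-mul (V-^ m (V-fromℕ (suc a))) (newton≡1 m Pm))
        where
        open Residue a a<p₁ K K<p₁
        ring : ∀ a x → a * (x - 1ℚ) ≡ a * x + (- 1ℚ) * a
        ring = solve-∀ ringℚ
      equation : sumTo p₁ (λ a → translate (fromℕ (suc a)) w m + (- 1ℚ) * fromℕ (suc a) ^ m) ≡ Φ m - powerSum m
      equation = trans (sumTo-+ p₁ (λ a → translate (fromℕ (suc a)) w m) (λ a → (- 1ℚ) * fromℕ (suc a) ^ m))
        (cong (λ x → Φ m + x) (trans (sumTo-* p₁ (- 1ℚ) (λ a → fromℕ (suc a) ^ m)) (ring (powerSum m))))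
        where
        ring : ∀ x → (- 1ℚ) * x ≡ - x
        ring = solve-∀ ringℚ

    record Interpolation : Set where
      field
        G : PolyQ
        vG : Integral G
        cong-G : ∀ t → V (+ suc K) (Φ (k ℕ.+ p₁ ℕ.* t) - evalQ G (P * fromℕ (k ℕ.+ p₁ ℕ.* t)))
        G₀ : V (+ suc K) (evalQ G 0ℚ - powerSum (k ℕ.* p ℕ.^ K))

    -- The multiple kpᴷ of pᴷ lies in the progression k + (p - 1)ℕ, so there G(0) can be compared with Φ.
    interpolation : Interpolation
    interpolation = record { G = G ; vG = integral Φ-polyMod ; cong-G = congruent Φ-polyMod ; G₀ =
      V-≡ (ring (evalQ G 0ℚ) (evalQ G (X t₀)) (Φ (n t₀)) (powerSum m))
        (V-+ (V-+ (V-neg (V-evalQ-0 (integral Φ-polyMod) (V-X t₀) (subst (λ i → V (+ suc K) (P * fromℕ i)) (sym n≡m) Pm)))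
                  (V-neg (congruent Φ-polyMod t₀)))
             (subst (λ i → V (+ suc K) (Φ i - powerSum m)) (sym n≡m) (Φ≡powerSum m Pm))) }
      where
      open PolyMod
      G = poly Φ-polyMod
      m = k ℕ.* p ℕ.^ K
      r = proj₁ (p^≡1 K)
      t₀ = k ℕ.* r
      arith : ∀ k q r → k ℕ.+ q ℕ.* (k ℕ.* r) ≡ k ℕ.* suc (q ℕ.* r)
      arith = ℕSolver.solve-∀
      n≡m : n t₀ ≡ m
      n≡m = trans (arith k p₁ r) (cong (k ℕ.*_) (sym (proj₂ (p^≡1 K))))
      Pm : V (+ suc K) (P * fromℕ m)
      Pm = V-≡ (trans (ring′ P (fromℕ k) (P ^ K)) (cong (P *_) (sym (trans (fromℕ-* k (p ℕ.^ K)) (cong (fromℕ k *_) (fromℕ-^ p K))))))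
        (V-mul (V-fromℕ k) (V-P^ (suc K)))
        where
        ring′ : ∀ p k x → k * (p * x) ≡ p * (k * x)
        ring′ = solve-∀ ringℚ
      ring : ∀ o x f s → - (x - o) + - (f - x) + (f - s) ≡ o - s
      ring = solve-∀ ringℚ

-- Approximation of Bₙ on a class, and sums over a class.

sumOver : {I : Set} → (I → ℚ) → List I → ℚ
sumOver F is = sumQ (map F is)

sumOver-cong : ∀ {I : Set} {F G : I → ℚ} is → (∀ i → F i ≡ G i) → sumOver F is ≡ sumOver G is
sumOver-cong [] e = refl
sumOver-cong (i ∷ is) e = cong₂ _+_ (e i) (sumOver-cong is e)

sumOver-+ : ∀ {I : Set} (F G : I → ℚ) is → sumOver (λ i → F i + G i) is ≡ sumOver F is + sumOver G is
sumOver-+ F G [] = refl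
sumOver-+ F G (i ∷ is) =
  trans (cong (λ z → F i + G i + z) (sumOver-+ F G is)) (ring (F i) (G i) (sumOver F is) (sumOver G is))
  where
  ring : ∀ a b s t → a + b + (s + t) ≡ a + s + (b + t)
  ring = solve-∀ ringℚ

sumOver-* : ∀ {I : Set} c (F : I → ℚ) is → sumOver (λ i → c * F i) is ≡ c * sumOver F is
sumOver-* c F [] = sym (ℚP.*-zeroʳ c)
sumOver-* c F (i ∷ is) = trans (cong (λ z → c * F i + z) (sumOver-* c F is)) (sym (ℚP.*-distribˡ-+ c (F i) (sumOver F is)))

divideByX : PolyQ → PolyQ
divideByX [] = []
divideByX (_ ∷ G) = G

evalQ-divideByX : ∀ G x → evalQ G x ≡ evalQ G 0ℚ + x * evalQ (divideByX G) x
evalQ-divideByX [] x = ring x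
  where
  ring : ∀ x → 0ℚ ≡ 0ℚ + x * 0ℚ
  ring = solve-∀ ringℚ
evalQ-divideByX (c ∷ G) x = ring c x (evalQ G x) (evalQ G 0ℚ)
  where
  ring : ∀ c x s t → c + x * s ≡ c + 0ℚ * t + x * s
  ring = solve-∀ ringℚ

module ClassSums (p : ℕ) (p-prime : Prime p) where

  open Valuation p p-prime
  open PolynomialCongruence p p-prime
  open BernoulliCongruence p p-prime
  open BernoulliInterpolation p p-prime

  V-sumOver : ∀ {I : Set} {N} {F : I → ℚ} is → (∀ i → V N (F i)) → V N (sumOver F is)
  V-sumOver [] v = V-0
  V-sumOver (i ∷ is) v = V-+ (v i) (V-sumOver is v)

  Integral-divideByX : ∀ {G} → Integral G → Integral (divideByX G)
  Integral-divideByX [] = []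
  Integral-divideByX (_ ∷ vG) = vG

  V-÷P : ∀ {K x} → V (+ suc K) (P * x) → V (+ K) x
  V-÷P {K} {x} v = V-≡ equation (V-* (V-power -[1+ 0 ]) v)
    where
    ring : ∀ i p x → i * 1ℚ * (p * x) ≡ i * p * x
    ring = solve-∀ ringℚ
    equation : 1/P * 1ℚ * (P * x) ≡ x
    equation = trans (ring 1/P P x) (trans (cong (_* x) 1/P*P) (ℚP.*-identityˡ x))

  -- The two kinds of conditions on a class are the cases e = 0 and e = 1, κ = k.
  classSum : ∀ {I : Set} (is : List I) (γ ν : I → ℚ) N e κ →
    (∀ m → V (N ℤ.- + m) (sumOver (λ i → γ i * (ν i ^ suc m - e * κ ^ m * ν i)) is)) →
    ∀ {H} → Integral H →
    ∀ m → V (N ℤ.- + m) (sumOver (λ i → γ i * (ν i ^ suc m * evalQ H (P * ν i) - e * κ ^ m * evalQ H (P * κ) * ν i)) is)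
  classSum is γ ν N e κ hyp [] m = V-≡ (sym vanish) (V-0 {N ℤ.- + m})
    where
    ring : ∀ g a b c → g * (a * 0ℚ - b * 0ℚ * c) ≡ 0ℚ * g
    ring = solve-∀ ringℚ
    vanish : sumOver (λ i → γ i * (ν i ^ suc m * 0ℚ - e * κ ^ m * 0ℚ * ν i)) is ≡ 0ℚ
    vanish = trans (sumOver-cong is (λ i → ring (γ i) (ν i ^ suc m) (e * κ ^ m) (ν i)))
      (trans (sumOver-* 0ℚ γ is) (ℚP.*-zeroˡ (sumOver γ is)))
  -- A Horner step: the constant coefficient is paid for by the condition at m, while the rest
  -- carries a factor p ν, which supplies the power of p missing from the condition at `suc m`.
  classSum is γ ν N e κ hyp {c ∷ H} (vc ∷ vH) m = V-≡ (sym equation)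
    (V-+ (V-mul vc (hyp m))
         (subst (λ M → V M (P * sumOver G is)) (exponent N (+ m)) (V-* V-P (classSum is γ ν N e κ hyp vH (suc m)))))
    where
    exponent : ∀ N m → + 1 ℤ.+ (N ℤ.- (+ 1 ℤ.+ m)) ≡ N ℤ.- m
    exponent = ℤSolver.solve-∀
    F G : _ → ℚ
    F i = γ i * (ν i ^ suc m - e * κ ^ m * ν i)
    G i = γ i * (ν i ^ suc (suc m) * evalQ H (P * ν i) - e * κ ^ suc m * evalQ H (P * κ) * ν i)
    ring : ∀ g n y c p h e k x h′ →
      g * (n * y * (c + p * n * h) - e * x * (c + p * k * h′) * n)
        ≡ c * (g * (n * y - e * x * n)) + p * (g * (n * (n * y) * h - e * (k * x) * h′ * n))
    ring = solve-∀ ringℚ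
    equation : sumOver (λ i → γ i * (ν i ^ suc m * evalQ (c ∷ H) (P * ν i) - e * κ ^ m * evalQ (c ∷ H) (P * κ) * ν i)) is
      ≡ c * sumOver F is + P * sumOver G is
    equation = begin
      sumOver (λ i → γ i * (ν i ^ suc m * evalQ (c ∷ H) (P * ν i) - e * κ ^ m * evalQ (c ∷ H) (P * κ) * ν i)) is
        ≡⟨ sumOver-cong is (λ i → ring (γ i) (ν i) (ν i ^ m) c P (evalQ H (P * ν i)) e κ (κ ^ m) (evalQ H (P * κ))) ⟩
      sumOver (λ i → c * F i + P * G i) is
        ≡⟨ sumOver-+ (λ i → c * F i) (λ i → P * G i) is ⟩
      sumOver (λ i → c * F i) is + sumOver (λ i → P * G i) is
        ≡⟨ cong₂ _+_ (sumOver-* c F is) (sumOver-* P G is) ⟩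
      c * sumOver F is + P * sumOver G is ∎

  -- The difference is pⁿ Bₙ, in which one p is spent on the denominator of Bₙ; hence the
  -- requirement n ≥ K + 2.
  P*Bern≡Φ : ∀ K n → suc (suc K) ≤ n → V (+ suc K) (P * Bern n - Φ n)
  P*Bern≡Φ K (suc n) (s≤s K<n) = V-≡ equation
    (V-mul (P*Bern-integral (suc n)) (V-mono (ℤ.+≤+ K<n) (V-P^ n)))
    where
    ring₁ : ∀ p b x → p * b * x ≡ p * x * b
    ring₁ = solve-∀ ringℚ
    ring₂ : ∀ x y → x ≡ x + y - y
    ring₂ = solve-∀ ringℚ
    equation : P * Bern (suc n) * P ^ n ≡ P * Bern (suc n) - Φ (suc n)
    equation = trans (ring₁ P (Bern (suc n)) (P ^ n)) (trans (ring₂ (w (suc n)) (Φ (suc n)))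
      (cong (λ z → z - Φ (suc n)) (sym (P*Bern (suc n)))))

  module _ (h : ℕ) (p₁≡h+h : p₁ ≡ h ℕ.+ h) (K : ℕ) (K<p₁ : suc (suc K) ≤ p₁) where

    -- Once G(0) is split off, the rest of G(p n) is a multiple of p n. The later division by p then
    -- yields n H(p n) with H still p-integral.
    Bern-near : ∀ k G → Integral G →
      (∀ t → V (+ suc K) (Φ (k ℕ.+ p₁ ℕ.* t) - evalQ G (P * fromℕ (k ℕ.+ p₁ ℕ.* t)))) →
      ∀ t → let n = k ℕ.+ p₁ ℕ.* t in suc (suc K) ≤ n →
      V (+ suc K) (P * Bern n - evalQ G 0ℚ - P * fromℕ n * evalQ (divideByX G) (P * fromℕ n))
    Bern-near k G vG cong-G t K<n = V-≡ (trans (ring (P * Bern n) (Φ n) (evalQ G x))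
        (trans (cong (λ z → P * Bern n - z) (evalQ-divideByX G x)) (ring′ (P * Bern n) (evalQ G 0ℚ) (x * evalQ (divideByX G) x))))
      (V-+ (P*Bern≡Φ K n K<n) (cong-G t))
      where
      n = k ℕ.+ p₁ ℕ.* t
      x = P * fromℕ n
      ring : ∀ b f x → (b - f) + (f - x) ≡ b - x
      ring = solve-∀ ringℚ
      ring′ : ∀ b c y → b - (c + y) ≡ b - c - y
      ring′ = solve-∀ ringℚ

    powerSum-0 : powerSum 0 ≡ P - 1ℚ
    powerSum-0 = begin
      powerSum 0             ≡⟨ ones p₁ ⟩
      fromℕ p₁               ≡⟨ ring (fromℕ p₁) ⟩
      1ℚ + fromℕ p₁ - 1ℚ     ≡⟨ cong (λ z → z - 1ℚ) (sym (fromℕ-suc p₁)) ⟩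
      fromℕ (suc p₁) - 1ℚ    ≡⟨ cong (λ m → fromℕ m - 1ℚ) (sym p≡1+p₁) ⟩
      P - 1ℚ                 ∎
      where
      ones : ∀ m → sumTo m (λ a → fromℕ (suc a) ^ 0) ≡ fromℕ m
      ones zero = refl
      ones (suc m) = trans (cong (_+ 1ℚ) (ones m)) (trans (ℚP.+-comm (fromℕ m) 1ℚ) (sym (fromℕ-suc m)))
      ring : ∀ x → x ≡ 1ℚ + x - 1ℚ
      ring = solve-∀ ringℚ

    Bern-approx-zero : ∀ ρ → P * ρ ≡ P - 1ℚ →
      ∃ λ H → Integral H × (∀ t → let n = 0 ℕ.+ p₁ ℕ.* t in suc (suc K) ≤ n →
      V (+ K) (Bern n - (ρ + fromℕ n * evalQ H (P * fromℕ n))))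
    Bern-approx-zero ρ Pρ≡P-1 = divideByX G , Integral-divideByX vG , λ t K<n →
      V-÷P (V-≡ (equation (0 ℕ.+ p₁ ℕ.* t)) (V-+ (Bern-near 0 G vG cong-G t K<n)
        (V-≡ (cong (λ m → evalQ G 0ℚ - powerSum m) (ℕP.*-zeroˡ (p ℕ.^ K))) G₀)))
      where
      open Interpolation (interpolation K K<p₁ 0)
      equation : ∀ n →
        P * Bern n - evalQ G 0ℚ - P * fromℕ n * evalQ (divideByX G) (P * fromℕ n) + (evalQ G 0ℚ - powerSum 0)
          ≡ P * (Bern n - (ρ + fromℕ n * evalQ (divideByX G) (P * fromℕ n)))
      equation n = begin
        P * Bern n - evalQ G 0ℚ - P * fromℕ n * y + (evalQ G 0ℚ - powerSum 0)
          ≡⟨ cong (λ z → P * Bern n - evalQ G 0ℚ - P * fromℕ n * y + (evalQ G 0ℚ - z)) (trans powerSum-0 (sym Pρ≡P-1)) ⟩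
        P * Bern n - evalQ G 0ℚ - P * fromℕ n * y + (evalQ G 0ℚ - P * ρ)
          ≡⟨ ring P (Bern n) (evalQ G 0ℚ) (fromℕ n) y ρ ⟩
        P * (Bern n - (ρ + fromℕ n * y)) ∎
        where
        y = evalQ (divideByX G) (P * fromℕ n)
        ring : ∀ p b g n y r → p * b - g - p * n * y + (g - p * r) ≡ p * (b - (r + n * y))
        ring = solve-∀ ringℚ

    module _ (κ : ℕ) (1≤κ : 1 ≤ κ) (2^κ≤p : 2 ℕ.^ κ ≤ p) where

      Bern-approx-negative : ∀ k → k ℕ.+ κ ≡ p₁ → ∃ λ H → Integral H × (∀ t → let n = k ℕ.+ p₁ ℕ.* t in suc (suc K) ≤ n →
        V (+ K) (Bern n - fromℕ n * evalQ H (P * fromℕ n)))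
      Bern-approx-negative k k+κ≡p₁ = divideByX G , Integral-divideByX vG , λ t K<n →
        V-÷P (V-≡ (equation t) (V-+ (V-+ (Bern-near k G vG cong-G t K<n) G₀) (powerSum-vanishes h p₁≡h+h κ 1≤κ 2^κ≤p k (inj₂ k+κ≡p₁) K)))
        where
        open Interpolation (interpolation K K<p₁ k)
        S = powerSum (k ℕ.* p ℕ.^ K)
        ring : ∀ p b g n y s → p * b - g - p * n * y + (g - s) + s ≡ p * (b - n * y)
        ring = solve-∀ ringℚ
        equation : ∀ t → let n = k ℕ.+ p₁ ℕ.* t in
          P * Bern n - evalQ G 0ℚ - P * fromℕ n * evalQ (divideByX G) (P * fromℕ n) + (evalQ G 0ℚ - S) + S
            ≡ P * (Bern n - fromℕ n * evalQ (divideByX G) (P * fromℕ n))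
        equation t = ring P (Bern n) (evalQ G 0ℚ) (fromℕ n) (evalQ (divideByX G) (P * fromℕ n)) S
          where n = k ℕ.+ p₁ ℕ.* t

      -- The relation at n = κ, scaled by n / κ, is subtracted from the one at n. Since κ may be
      -- small compared with K, p^κ B_κ is not negligible there, so `Φ κ` itself is used in place of
      -- p B_κ; this produces the factor 1 - p^(κ - 1).
      Bern-approx-positive : ∃ λ H → Integral H × (∀ t → let n = κ ℕ.+ p₁ ℕ.* t in suc (suc K) ≤ n →
        V (+ K) (Bern n - (divQ (Bern κ) (fromℕ κ) * (1ℚ - P ^ (κ ℕ.∸ 1)) * fromℕ n
                           + (fromℕ n * evalQ H (P * fromℕ n) - evalQ H (P * fromℕ κ) * fromℕ n))))
      Bern-approx-positive = divideByX G , Integral-divideByX vG , λ t K<n →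
        let n = κ ℕ.+ p₁ ℕ.* t in
        V-÷P (V-≡ (equation t) (V-+ (V-+ (Bern-near κ G vG cong-G t K<n) V-G₀)
                                    (V-neg (V-mul (V-mul (V-fromℕ n) V-1/k) (V-+ at-κ V-G₀)))))
        where
        open Interpolation (interpolation K K<p₁ κ)
        S = powerSum (κ ℕ.* p ℕ.^ K)
        H = divideByX G
        k = fromℕ κ
        k≢0 : k ≢ 0ℚ
        k≢0 = fromℤ≢0 {+ κ} (λ e → ℕP.<⇒≢ 1≤κ (sym (ℤP.+-injective e)))
        1/k = divQ 1ℚ k
        κ<2^κ : ∀ κ → κ < 2 ℕ.^ κ
        κ<2^κ zero = s≤s z≤n
        κ<2^κ (suc κ) = ℕP.≤-trans (s≤s (κ<2^κ κ))
          (ℕP.≤-trans (ℕP.+-monoˡ-≤ (2 ℕ.^ κ) (ℕP.m^n>0 2 κ)) (ℕP.≤-reflexive (cong (2 ℕ.^ κ ℕ.+_) (sym (ℕP.+-identityʳ (2 ℕ.^ κ))))))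
        -- The bound 2^κ ≤ p also gives κ < p, so κ is invertible.
        V-1/k : V (+ 0) 1/k
        V-1/k = V-inverse (+ κ) (p∤small 1≤κ (ℕP.<-≤-trans (κ<2^κ κ) 2^κ≤p)) (divQ-* 1ℚ k≢0)
        V-G₀ : V (+ suc K) (evalQ G 0ℚ)
        V-G₀ = V-≡ (ring (evalQ G 0ℚ) S) (V-+ G₀ (powerSum-vanishes h p₁≡h+h κ 1≤κ 2^κ≤p κ (inj₁ refl) K))
          where
          ring : ∀ g s → g - s + s ≡ g
          ring = solve-∀ ringℚ
        P^κ : P ^ κ ≡ P * P ^ (κ ℕ.∸ 1)
        P^κ = cong (P ^_) (sym (ℕP.m+[n∸m]≡n 1≤κ))
        b/k : divQ (Bern κ) k ≡ 1/k * Bern κ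
        b/k = divQ-unique k≢0 (trans (ring 1/k (Bern κ) k) (trans (cong (_* Bern κ) (divQ-* 1ℚ k≢0)) (ℚP.*-identityˡ (Bern κ))))
          where
          ring : ∀ i b k → i * b * k ≡ i * k * b
          ring = solve-∀ ringℚ
        at-κ : V (+ suc K) (P * (1ℚ - P ^ (κ ℕ.∸ 1)) * Bern κ - evalQ G 0ℚ - P * k * evalQ H (P * k))
        at-κ = V-≡ (trans (cong₂ _-_ Φκ (evalQ-divideByX G (P * k))) (ring′ (P * (1ℚ - P ^ (κ ℕ.∸ 1)) * Bern κ) (evalQ G 0ℚ) (P * k * evalQ H (P * k))))
          (subst (λ n → V (+ suc K) (Φ n - evalQ G (P * fromℕ n))) (trans (cong (κ ℕ.+_) (ℕP.*-zeroʳ p₁)) (ℕP.+-identityʳ κ)) (cong-G 0))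
          where
          ring′ : ∀ a b c → a - (b + c) ≡ a - b - c
          ring′ = solve-∀ ringℚ
          ring₁ : ∀ w f → f ≡ w + f - w
          ring₁ = solve-∀ ringℚ
          ring₂ : ∀ p q b → p * b - p * q * b ≡ p * (1ℚ - q) * b
          ring₂ = solve-∀ ringℚ
          Φκ : Φ κ ≡ P * (1ℚ - P ^ (κ ℕ.∸ 1)) * Bern κ
          Φκ = trans (ring₁ (w κ) (Φ κ)) (trans (cong₂ _-_ (sym (P*Bern κ)) (cong (_* Bern κ) P^κ)) (ring₂ P (P ^ (κ ℕ.∸ 1)) (Bern κ)))
        equation : ∀ t → let n = κ ℕ.+ p₁ ℕ.* t in
          P * Bern n - evalQ G 0ℚ - P * fromℕ n * evalQ H (P * fromℕ n) + evalQ G 0ℚ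
            + - (fromℕ n * 1/k * (P * (1ℚ - P ^ (κ ℕ.∸ 1)) * Bern κ - evalQ G 0ℚ - P * k * evalQ H (P * k) + evalQ G 0ℚ))
          ≡ P * (Bern n - (divQ (Bern κ) k * (1ℚ - P ^ (κ ℕ.∸ 1)) * fromℕ n
                           + (fromℕ n * evalQ H (P * fromℕ n) - evalQ H (P * k) * fromℕ n)))
        equation t = begin
          P * b - g - P * n * y + g + - (n * 1/k * (P * (1ℚ - r) * bκ - g - P * k * yκ + g))
            ≡⟨ ring P b g n y 1/k r bκ k yκ ⟩
          P * (b - (1/k * bκ * (1ℚ - r) * n + (n * y - 1/k * k * yκ * n)))
            ≡⟨ cong₂ (λ u v → P * (b - (u * (1ℚ - r) * n + (n * y - v * yκ * n)))) (sym b/k) (divQ-* 1ℚ k≢0) ⟩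
          P * (b - (divQ bκ k * (1ℚ - r) * n + (n * y - 1ℚ * yκ * n)))
            ≡⟨ cong (λ u → P * (b - (divQ bκ k * (1ℚ - r) * n + (n * y - u * n)))) (ℚP.*-identityˡ yκ) ⟩
          P * (b - (divQ bκ k * (1ℚ - r) * n + (n * y - yκ * n))) ∎
          where
          n = fromℕ (κ ℕ.+ p₁ ℕ.* t)
          b = Bern (κ ℕ.+ p₁ ℕ.* t)
          bκ = Bern κ
          g = evalQ G 0ℚ
          y = evalQ H (P * n)
          yκ = evalQ H (P * k)
          r = P ^ (κ ℕ.∸ 1)
          ring : ∀ p b g n y i r c k z → p * b - g - p * n * y + g + - (n * i * (p * (1ℚ - r) * c - g - p * k * z + g))
            ≡ p * (b - (i * c * (1ℚ - r) * n + (n * y - i * k * z * n)))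
          ring = solve-∀ ringℚ

-- Statements about all sufficiently large primes.

Eventually : ((p : ℕ) → Prime p → Set) → Set
Eventually Q = ∃ λ B → ∀ p (p-prime : Prime p) → B ≤ p → Q p p-prime

always : ∀ {Q : (p : ℕ) → Prime p → Set} → (∀ p p-prime → Q p p-prime) → Eventually Q
always q = 0 , λ p p-prime _ → q p p-prime

eventually-≥ : ∀ B → Eventually (λ p _ → B ≤ p)
eventually-≥ B = B , λ _ _ B≤p → B≤p

eventually-map : ∀ {Q R : (p : ℕ) → Prime p → Set} → (∀ p p-prime → Q p p-prime → R p p-prime) →
  Eventually Q → Eventually R
eventually-map f (B , q) = B , λ p p-prime B≤p → f p p-prime (q p p-prime B≤p)

eventually-× : ∀ {Q R : (p : ℕ) → Prime p → Set} → Eventually Q → Eventually R →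
  Eventually (λ p p-prime → Q p p-prime × R p p-prime)
eventually-× (B , q) (D , r) = B ℕ.⊔ D , λ p p-prime m →
  q p p-prime (ℕP.≤-trans (ℕP.m≤m⊔n B D) m) , r p p-prime (ℕP.≤-trans (ℕP.m≤n⊔m B D) m)

eventually-Fin : ∀ n {Q : Fin n → (p : ℕ) → Prime p → Set} → (∀ i → Eventually (Q i)) →
  Eventually (λ p p-prime → ∀ i → Q i p p-prime)
eventually-Fin zero q = always (λ _ _ ())
eventually-Fin (suc n) {Q} q =
  eventually-map (λ { p p-prime (a , b) Fin.zero → a ; p p-prime (a , b) (Fin.suc i) → b i })
    (eventually-× (q Fin.zero) (eventually-Fin n (λ i → q (Fin.suc i))))

eventually-< : ∀ n {Q : ℕ → (p : ℕ) → Prime p → Set} → (∀ m → Eventually (Q m)) →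
  Eventually (λ p p-prime → ∀ m → m < n → Q m p p-prime)
eventually-< zero q = always (λ _ _ _ ())
eventually-< (suc n) {Q} q = eventually-map step (eventually-× (q n) (eventually-< n q))
  where
  step : ∀ p p-prime → Q n p p-prime × (∀ m → m < n → Q m p p-prime) → ∀ m → m < suc n → Q m p p-prime
  step p p-prime (a , b) m (s≤s m≤n) with ℕP.m≤n⇒m<n∨m≡n m≤n
  ... | inj₁ m<n = b m m<n
  ... | inj₂ refl = a

-- Cross-multiplied, so that the values of sums and products of fractions need no division.
record Value (x : ℚ) (h : Frac) (q : ℚ) : Set where
  constructor value
  field
    den≢0ℚ : evalQ (proj₂ h) x ≢ 0ℚ
    cross : evalQ (proj₁ h) x ≡ q * evalQ (proj₂ h) x

≢-≡ : ∀ {x y : ℚ} → x ≡ y → y ≢ 0ℚ → x ≢ 0ℚ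
≢-≡ e y≢0 x≡0 = y≢0 (trans (sym e) x≡0)

Value-polyF : ∀ x f → Value x (polyF f) (evalQ f x)
Value-polyF x f = value (≢-≡ (evalQ-constP 1ℚ x) (λ ()))
  (sym (trans (cong (evalQ f x *_) (evalQ-constP 1ℚ x)) (ℚP.*-identityʳ (evalQ f x))))

Value-addF : ∀ {x g h q r} → Value x g q → Value x h r → Value x (addF g h) (q + r)
Value-addF {x} {a , b} {c , d} {q} {r} (value b≢0 e) (value d≢0 e′) =
  value (≢-≡ (evalQ-mulP b d x) (*-nonzero b≢0 d≢0)) (begin
    evalQ (addP (mulP a d) (mulP c b)) x
      ≡⟨ evalQ-addP (mulP a d) (mulP c b) x ⟩
    evalQ (mulP a d) x + evalQ (mulP c b) x
      ≡⟨ cong₂ _+_ (evalQ-mulP a d x) (evalQ-mulP c b x) ⟩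
    evalQ a x * evalQ d x + evalQ c x * evalQ b x
      ≡⟨ cong₂ (λ s t → s * evalQ d x + t * evalQ b x) e e′ ⟩
    q * evalQ b x * evalQ d x + r * evalQ d x * evalQ b x
      ≡⟨ ring q r (evalQ b x) (evalQ d x) ⟩
    (q + r) * (evalQ b x * evalQ d x)
      ≡⟨ cong ((q + r) *_) (sym (evalQ-mulP b d x)) ⟩
    (q + r) * evalQ (mulP b d) x ∎)
  where
  ring : ∀ q r b d → q * b * d + r * d * b ≡ (q + r) * (b * d)
  ring = solve-∀ ringℚ

Value-mulF : ∀ {x g h q r} → Value x g q → Value x h r → Value x (mulF g h) (q * r)
Value-mulF {x} {a , b} {c , d} {q} {r} (value b≢0 e) (value d≢0 e′) =
  value (≢-≡ (evalQ-mulP b d x) (*-nonzero b≢0 d≢0)) (begin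
    evalQ (mulP a c) x
      ≡⟨ evalQ-mulP a c x ⟩
    evalQ a x * evalQ c x
      ≡⟨ cong₂ _*_ e e′ ⟩
    q * evalQ b x * (r * evalQ d x)
      ≡⟨ ring q r (evalQ b x) (evalQ d x) ⟩
    q * r * (evalQ b x * evalQ d x)
      ≡⟨ cong (q * r *_) (sym (evalQ-mulP b d x)) ⟩
    q * r * evalQ (mulP b d) x ∎)
  where
  ring : ∀ q r b d → q * b * (r * d) ≡ q * r * (b * d)
  ring = solve-∀ ringℚ

Value-subF : ∀ {x g h q r} → Value x g q → Value x h r → Value x (subF g h) (q - r)
Value-subF {x} {g} {c , d} {q} {r} v (value d≢0 e) = Value-addF {h = negP c , d} v (value d≢0
  (trans (evalQ-negP c x) (trans (cong -_ e) (ℚP.neg-distribˡ-* r (evalQ d x)))))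

Value-sumF : ∀ {I : Set} {x} {h : I → Frac} {q : I → ℚ} is → (∀ i → Value x (h i) (q i)) →
  Value x (sumF (map h is)) (sumOver q is)
Value-sumF {x = x} [] v = Value-polyF x []
Value-sumF (i ∷ is) v = Value-addF (v i) (Value-sumF is v)

Value-≡ : ∀ {x h q r} → q ≡ r → Value x h q → Value x h r
Value-≡ refl v = v

Value-evalRF : ∀ g {x} → evalQ (den g) x ≢ 0ℚ → Value x (toFrac g) (evalRF g x)
Value-evalRF g {x} den≢0 = value den≢0 (sym (divQ-* (evalQ (num g) x) den≢0))

-- From the t-adic valuation to the p-adic valuation at t = p.

ordP-nothing : ∀ f → ordP f ≡ nothing → ∀ x → evalQ f x ≡ 0ℚ
ordP-nothing [] _ x = refl
ordP-nothing (c ∷ f) e x with c ℚP.≟ 0ℚ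
ordP-nothing (c ∷ f) () x | no _
ordP-nothing (c ∷ f) e x | yes c≡0 with ordP f in eq
ordP-nothing (c ∷ f) () x | yes c≡0 | just k
ordP-nothing (c ∷ f) e x | yes c≡0 | nothing =
  trans (cong₂ (λ s t → s + x * t) c≡0 (ordP-nothing f eq x)) (trans (ℚP.+-identityˡ (x * 0ℚ)) (ℚP.*-zeroʳ x))

module _ (p : ℕ) (p-prime : Prime p) where

  open Valuation p p-prime

  record Unit (u : ℚ) : Set where
    constructor unit
    field
      top bot : ℤ
      p∤top : ¬ (+ p ℤD.∣ top)
      p∤bot : ¬ (+ p ℤD.∣ bot)
      equation : u * fromℤ bot ≡ fromℤ top

  Unit-+P : ∀ {u s} → Unit u → V (+ 0) s → Unit (u + P * s)
  Unit-+P {u} {s} (unit a b p∤a p∤b e) (mkV c d p∤d e′) =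
    unit (a ℤ.* d ℤ.+ + p ℤ.* c ℤ.* b) (b ℤ.* d) p∤top (p∤* b d p∤b p∤d) (begin
      (u + P * s) * fromℤ (b ℤ.* d)
        ≡⟨ cong ((u + P * s) *_) (fromℤ-* b d) ⟩
      (u + P * s) * (fromℤ b * fromℤ d)
        ≡⟨ ring u P s (fromℤ b) (fromℤ d) ⟩
      u * fromℤ b * fromℤ d + P * (s * fromℤ d) * fromℤ b
        ≡⟨ cong₂ (λ x y → x * fromℤ d + P * y * fromℤ b) e (trans e′ (ℚP.*-identityˡ (fromℤ c))) ⟩
      fromℤ a * fromℤ d + P * fromℤ c * fromℤ b
        ≡⟨ sym (trans (fromℤ-+ (a ℤ.* d) (+ p ℤ.* c ℤ.* b)) (cong₂ _+_ (fromℤ-* a d) pcb)) ⟩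
      fromℤ (a ℤ.* d ℤ.+ + p ℤ.* c ℤ.* b) ∎)
    where
    ring : ∀ u p s b d → (u + p * s) * (b * d) ≡ u * b * d + p * (s * d) * b
    ring = solve-∀ ringℚ
    pcb : fromℤ (+ p ℤ.* c ℤ.* b) ≡ P * fromℤ c * fromℤ b
    pcb = trans (fromℤ-* (+ p ℤ.* c) b) (cong (_* fromℤ b) (fromℤ-* (+ p) c))
    p∤top : ¬ (+ p ℤD.∣ (a ℤ.* d ℤ.+ + p ℤ.* c ℤ.* b))
    p∤top p∣ = p∤* a d p∤a p∤d (V-∣ (a ℤ.* d) (V-≡ (trans (cong₂ _-_ (fromℤ-+ (a ℤ.* d) (+ p ℤ.* c ℤ.* b)) (sym pcb))
        (ring′ (fromℤ (a ℤ.* d)) (fromℤ (+ p ℤ.* c ℤ.* b))))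
      (V-sub (∣-V (a ℤ.* d ℤ.+ + p ℤ.* c ℤ.* b) p∣)
        (V-≡ (ring″ P (fromℤ c) (fromℤ b)) (V-mul (V-mul (V-fromℤ c) (V-fromℤ b)) V-P)))))
      where
      ring′ : ∀ x y → x + y - y ≡ x
      ring′ = solve-∀ ringℚ
      ring″ : ∀ p c b → c * b * p ≡ p * c * b
      ring″ = solve-∀ ringℚ

*-↧ : ∀ q → q * fromℤ (ℚ.↧ q) ≡ fromℤ (ℚ.↥ q)
*-↧ q@(ℚ.mkℚ n d-1 _) = ℚP.toℚᵘ-injective
  (ℚᵘP.≃-trans (ℚP.toℚᵘ-homo-* q (fromℤ (+ suc d-1)))
  (ℚᵘP.≃-trans (ℚᵘP.*-congˡ {ℚ.toℚᵘ q} (fromℤ-toℚᵘ (+ suc d-1)))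
  (ℚᵘP.≃-trans (ℚᵘ.*≡* (ring n (+ suc d-1))) (ℚᵘP.≃-sym (fromℤ-toℚᵘ n)))))
  where
  ring : ∀ n d → n ℤ.* d ℤ.* + 1 ≡ n ℤ.* (d ℤ.* + 1)
  ring = ℤSolver.solve-∀

↧≢0 : ∀ q → ℚ.↧ q ≢ + 0
↧≢0 (ℚ.mkℚ _ _ _) ()

eventually-p∤ : ∀ z → z ≢ + 0 → Eventually (λ p _ → ¬ (+ p ℤD.∣ z))
eventually-p∤ z z≢0 = suc ℤ.∣ z ∣ , λ p p-prime z<p →
  Valuation.p∤small p p-prime (ℕP.n≢0⇒n>0 (λ e → z≢0 (ℤP.∣i∣≡0⇒i≡0 e))) z<p

eventually-integral : ∀ c → Eventually (λ p p-prime → Valuation.V p p-prime (+ 0) c)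
eventually-integral c = eventually-map
  (λ p p-prime p∤d → Valuation.V-cancel p p-prime (ℚ.↧ c) p∤d
    (Valuation.V-≡ p p-prime (sym (*-↧ c)) (Valuation.V-fromℤ p p-prime (ℚ.↥ c))))
  (eventually-p∤ (ℚ.↧ c) (↧≢0 c))

eventually-unit : ∀ c → c ≢ 0ℚ → Eventually (λ p p-prime → Unit p p-prime c)
eventually-unit c c≢0 = eventually-map
  (λ p p-prime (p∤n , p∤d) → unit (ℚ.↥ c) (ℚ.↧ c) p∤n p∤d (*-↧ c))
  (eventually-× (eventually-p∤ (ℚ.↥ c) (λ e → c≢0 (ℚP.↥p≡0⇒p≡0 c e))) (eventually-p∤ (ℚ.↧ c) (↧≢0 c)))

eventually-evalQ : ∀ f → Eventually (λ p p-prime → Valuation.V p p-prime (+ 0) (evalQ f (fromℕ p)))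
eventually-evalQ [] = always (λ p p-prime → Valuation.V-0 p p-prime)
eventually-evalQ (c ∷ f) = eventually-map
  (λ p p-prime (vc , vf) → let open Valuation p p-prime in V-+ vc (V-mul (V-fromℕ p) vf))
  (eventually-× (eventually-integral c) (eventually-evalQ f))

-- Write f = tᵏ (c + t h) with c ≠ 0. For all but finitely many p, c is a unit and h(p) is
-- p-integral, so c + p h(p) is a unit too.
eventually-ordP : ∀ f k → ordP f ≡ just k →
  Eventually (λ p p-prime → ∃ λ u → Unit p p-prime u × evalQ f (fromℕ p) ≡ u * fromℕ p ^ k)
eventually-ordP (c ∷ f) k e with c ℚP.≟ 0ℚ
eventually-ordP (c ∷ f) .0 refl | no c≢0 = eventually-map
  (λ p p-prime (uc , vf) → c + fromℕ p * evalQ f (fromℕ p) , Unit-+P p p-prime uc vf ,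
    sym (ℚP.*-identityʳ (c + fromℕ p * evalQ f (fromℕ p))))
  (eventually-× (eventually-unit c c≢0) (eventually-evalQ f))
eventually-ordP (c ∷ f) k e | yes c≡0 with ordP f in eq
eventually-ordP (c ∷ f) .(suc k) refl | yes c≡0 | just k = eventually-map
  (λ p p-prime (u , unit-u , e) → u , unit-u ,
    trans (cong₂ (λ s t → s + fromℕ p * t) c≡0 e) (ring (fromℕ p) u (fromℕ p ^ k)))
  (eventually-ordP f k eq)
  where
  ring : ∀ p u x → 0ℚ + p * (u * x) ≡ u * (p * x)
  ring = solve-∀ ringℚ

Unit⇒V : ∀ {p p-prime u} → Unit p p-prime u → Valuation.V p p-prime (+ 0) u
Unit⇒V {p} {p-prime} (unit a b p∤a p∤b e) =
  Valuation.mkV a b p∤b (trans e (sym (ℚP.*-identityˡ (fromℤ a))))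

V-quotient : ∀ p p-prime → let open Valuation p p-prime in ∀ {q u v} i j →
  Unit p p-prime u → Unit p p-prime v → u * P ^ i ≡ q * (v * P ^ j) → V (+ i ℤ.- + j) q
V-quotient p p-prime {q} {u} {v} i j unit-u (unit a b p∤a p∤b e) eq = V-cancel a p∤a
  (V-≡ (sym equation) (subst (λ N → V N (u * fromℤ b * power (+ i ℤ.- + j))) (exponent (+ i) (ℤ.- + j))
    (V-* (V-mul (Unit⇒V unit-u) (V-fromℤ b)) (V-power (+ i ℤ.- + j)))))
  where
  open Valuation p p-prime
  exponent : ∀ i j → + 0 ℤ.+ (i ℤ.+ j) ≡ i ℤ.+ j
  exponent i j = ℤP.+-identityˡ (i ℤ.+ j)
  W = power (ℤ.- + j)
  P^j*W : P ^ j * W ≡ 1ℚ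
  P^j*W = trans (sym (power-+ (+ j) (ℤ.- + j))) (cong power (ℤP.+-inverseʳ (+ j)))
  ring₂ : ∀ q v b x w → q * (v * b) * (x * w) ≡ q * (v * x) * (b * w)
  ring₂ = solve-∀ ringℚ
  ring₃ : ∀ u x b w → u * x * (b * w) ≡ u * b * (x * w)
  ring₃ = solve-∀ ringℚ
  equation : q * fromℤ a ≡ u * fromℤ b * power (+ i ℤ.- + j)
  equation = begin
    q * fromℤ a                          ≡⟨ sym (ℚP.*-identityʳ (q * fromℤ a)) ⟩
    q * fromℤ a * 1ℚ                     ≡⟨ cong₂ (λ s t → q * s * t) (sym e) (sym P^j*W) ⟩
    q * (v * fromℤ b) * (P ^ j * W)      ≡⟨ ring₂ q v (fromℤ b) (P ^ j) W ⟩
    q * (v * P ^ j) * (fromℤ b * W)      ≡⟨ cong (_* (fromℤ b * W)) (sym eq) ⟩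
    u * P ^ i * (fromℤ b * W)            ≡⟨ ring₃ u (P ^ i) (fromℤ b) W ⟩
    u * fromℤ b * (P ^ i * W)            ≡⟨ cong (u * fromℤ b *_) (sym (power-+ (+ i) (ℤ.- + j))) ⟩
    u * fromℤ b * power (+ i ℤ.- + j)    ∎

-- The passage from the hypotheses to congruences: numerator and denominator at t = p are units
-- times powers of p, with the t-adic orders as exponents. A vanishing numerator gives the value 0,
-- and a vanishing denominator contradicts `Value`.
eventually-vt≥ : ∀ h N → vt≥ h N →
  Eventually (λ p p-prime → ∀ q → Value (fromℕ p) h q → Valuation.V p p-prime N q)
eventually-vt≥ (a , b) N v with ordP a in eq-a | ordP b in eq-b
... | nothing | _ = always λ p p-prime q (value den≢0 e) → let open Valuation p p-prime in
  V-≡ (*-cancelʳ (evalQ b P) den≢0 (trans (ℚP.*-zeroˡ (evalQ b P)) (trans (sym (ordP-nothing a eq-a P)) e))) (V-0 {N})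
... | just i | nothing = always λ p p-prime q (value den≢0 e) → ⊥-elim (den≢0 (ordP-nothing b eq-b (fromℕ p)))
... | just i | just j = eventually-map
  (λ p p-prime ((u , unit-u , eu) , (w , unit-w , ew)) q (value den≢0 e) → let open Valuation p p-prime in
    V-mono v (V-quotient p p-prime i j unit-u unit-w (trans (sym eu) (trans e (cong (q *_) ew)))))
  (eventually-× (eventually-ordP a i eq-a) (eventually-ordP b j eq-b))

eventually-den≢0 : ∀ g → Eventually (λ p _ → evalQ (den g) (fromℕ p) ≢ 0ℚ)
eventually-den≢0 g with ordP (den g) in eq
... | nothing = ⊥-elim (den≢0 g eq)
... | just k = eventually-map
  (λ p p-prime (u , unit a b p∤a p∤b e , eu) → let open Valuation p p-prime in
    ≢-≡ eu (*-nonzero {u}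
      (λ u≡0 → p∤⇒≢0 {a} p∤a (trans (sym e) (trans (cong (_* fromℤ b) u≡0) (ℚP.*-zeroˡ (fromℤ b)))))
      (^≢0 k P≢0)))
  (eventually-ordP (den g) k eq)
  where
  ^≢0 : ∀ {x} k → x ≢ 0ℚ → x ^ k ≢ 0ℚ
  ^≢0 zero x≢0 = λ ()
  ^≢0 (suc k) x≢0 = *-nonzero x≢0 (^≢0 k x≢0)

eventually-Value : ∀ g → Eventually (λ p _ → Value (fromℕ p) (toFrac g) (evalRF g (fromℕ p)))
eventually-Value g = eventually-map (λ p _ den≢0 → Value-evalRF g den≢0) (eventually-den≢0 g)

-- The indices f(p) and their classes modulo p - 1.

i≤∣i∣ : ∀ i → i ℤ.≤ + ℤ.∣ i ∣
i≤∣i∣ (+ _) = ℤP.≤-refl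
i≤∣i∣ -[1+ _ ] = ℤ.-≤+

b≤c+x*e : ∀ b c {e} x → + 1 ℤ.≤ e → ℤ.∣ b ℤ.- c ∣ ≤ x → b ℤ.≤ c ℤ.+ + x ℤ.* e
b≤c+x*e b c {e} x 1≤e big = ℤP.≤-trans (ℤP.≤-reflexive (ring b c))
  (ℤP.+-monoʳ-≤ c (ℤP.≤-trans (i≤∣i∣ (b ℤ.- c)) (ℤP.≤-trans (ℤ.+≤+ big)
    (ℤP.≤-trans (ℤP.≤-reflexive (sym (ℤP.*-identityʳ (+ x)))) (ℤP.*-monoˡ-≤-nonNeg (+ x) 1≤e)))))
  where
  ring : ∀ b c → b ≡ c ℤ.+ (b ℤ.- c)
  ring = ℤSolver.solve-∀

evalZ-positive : ∀ f k → last f ≡ just (+ suc k) → ∃ λ B → ∀ x → B ≤ x → + 1 ℤ.≤ evalZ f (+ x)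
evalZ-positive (.(+ suc k) ∷ []) k refl = 0 , λ x _ →
  subst (+ 1 ℤ.≤_) (sym (trans (cong (λ z → + suc k ℤ.+ z) (ℤP.*-zeroʳ (+ x))) (ℤP.+-identityʳ (+ suc k)))) (ℤ.+≤+ (s≤s z≤n))
evalZ-positive (c ∷ d ∷ f) k e with evalZ-positive (d ∷ f) k e
... | B , positive = B ℕ.⊔ ℤ.∣ + 1 ℤ.- c ∣ , λ x big → b≤c+x*e (+ 1) c x
  (positive x (ℕP.≤-trans (ℕP.m≤m⊔n B _) big)) (ℕP.≤-trans (ℕP.m≤n⊔m B _) big)

evalZ-unbounded : ∀ f → NonConstPosLead f → ∀ b → ∃ λ B → ∀ x → B ≤ x → b ℤ.≤ evalZ f (+ x)
evalZ-unbounded [] (() , _)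
evalZ-unbounded (c ∷ []) (s≤s () , _)
evalZ-unbounded (c ∷ d ∷ f) (_ , k , e) b with evalZ-positive (d ∷ f) k e
... | B , positive = B ℕ.⊔ ℤ.∣ b ℤ.- c ∣ , λ x big → b≤c+x*e b c x
  (positive x (ℕP.≤-trans (ℕP.m≤m⊔n B _) big)) (ℕP.≤-trans (ℕP.m≤n⊔m B _) big)

-- Taken with q = p - 1, this places f(p) in the class of f(1); `d` is the quotient.
evalZ-at1 : ∀ f q → ∃ λ d → evalZ f (+ 1 ℤ.+ q) ≡ at1 f ℤ.+ q ℤ.* d
evalZ-at1 [] q = + 0 , sym (trans (ℤP.+-identityˡ (q ℤ.* + 0)) (ℤP.*-zeroʳ q))
evalZ-at1 (c ∷ f) q with evalZ-at1 f q
... | d , e = (+ 1 ℤ.+ q) ℤ.* d ℤ.+ at1 f , trans (cong (λ z → c ℤ.+ (+ 1 ℤ.+ q) ℤ.* z) e) (ring c q (at1 f) d)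
  where
  ring : ∀ c q a d → c ℤ.+ (+ 1 ℤ.+ q) ℤ.* (a ℤ.+ q ℤ.* d) ≡ c ℤ.+ + 1 ℤ.* a ℤ.+ q ℤ.* ((+ 1 ℤ.+ q) ℤ.* d ℤ.+ a)
  ring = ℤSolver.solve-∀

positive-multiple : ∀ q k d → k ℤ.< k ℤ.+ + q ℤ.* d → ∃ λ t → d ≡ + suc t
positive-multiple q k (+ suc t) _ = t , refl
positive-multiple q k (+ zero) lt = ⊥-elim (ℤP.<-irrefl (sym (trans (cong (λ z → k ℤ.+ z) (ℤP.*-zeroʳ (+ q))) (ℤP.+-identityʳ k))) lt)
positive-multiple q k -[1+ t ] lt = ⊥-elim (ℤP.<⇒≱ lt (ℤP.≤-trans
  (ℤP.+-monoʳ-≤ k (ℤP.≤-trans (ℤP.*-monoˡ-≤-nonNeg (+ q) { -[1+ t ]} {+ 0} ℤ.-≤+) (ℤP.≤-reflexive (ℤP.*-zeroʳ (+ q)))))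
  (ℤP.≤-reflexive (ℤP.+-identityʳ k))))

-- Class q k n: the index n lies in the residue class of k modulo q; for negative k the
-- progression starts at its least nonnegative member.
data Class (q : ℕ) : ℤ → ℕ → Set where
  nonneg : ∀ κ t → Class q (+ κ) (κ ℕ.+ q ℕ.* t)
  negative : ∀ κ k t → k ℕ.+ suc κ ≡ q → Class q -[1+ κ ] (k ℕ.+ q ℕ.* t)

eventually-class : ∀ f → NonConstPosLead f → ∀ L → Eventually (λ p _ →
  ∃ λ n → evalZ f (+ p) ≡ + n × L ≤ n × Class (ℕ.pred p) (at1 f) n)
eventually-class f nc L = eventually-map step
  (eventually-× (B ℕ.⊔ D , λ p _ m → large p (ℕP.≤-trans (ℕP.m≤m⊔n B D) m) , larger p (ℕP.≤-trans (ℕP.m≤n⊔m B D) m))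
                (eventually-≥ (suc ℤ.∣ at1 f ∣)))
  where
  B = proj₁ (evalZ-unbounded f nc (+ L))
  large = proj₂ (evalZ-unbounded f nc (+ L))
  -- Asking for f(p) > f(1) makes the quotient of f(p) - f(1) by p - 1 positive.
  D = proj₁ (evalZ-unbounded f nc (+ 1 ℤ.+ at1 f))
  larger = proj₂ (evalZ-unbounded f nc (+ 1 ℤ.+ at1 f))
  step : ∀ p → Prime p → ((+ L ℤ.≤ evalZ f (+ p)) × (+ 1 ℤ.+ at1 f ℤ.≤ evalZ f (+ p))) × suc ℤ.∣ at1 f ∣ ≤ p →
    ∃ λ n → evalZ f (+ p) ≡ + n × L ≤ n × Class (ℕ.pred p) (at1 f) n
  step (suc q) _ ((L≤ , k<) , s≤s ∣k∣≤q) with evalZ-at1 f (+ q)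
  ... | d , e with positive-multiple q (at1 f) d (subst (at1 f ℤ.<_) e (ℤP.suc[i]≤j⇒i<j k<))
  ...   | t , refl with at1 f
  ...     | + κ = κ ℕ.+ q ℕ.* suc t , e′ , ℤP.drop‿+≤+ (subst (+ L ℤ.≤_) e′ L≤) , nonneg κ (suc t)
    where
    e′ : evalZ f (+ suc q) ≡ + (κ ℕ.+ q ℕ.* suc t)
    e′ = trans e (trans (cong (λ z → + κ ℤ.+ z) (sym (ℤP.pos-* q (suc t)))) (sym (ℤP.pos-+ κ (q ℕ.* suc t))))
  -- One of the `suc t` steps of length q leads from the negative f(1) to k = q - (κ + 1), which is
  -- nonnegative because p > |f(1)|.
  ...     | -[1+ κ ] = k ℕ.+ q ℕ.* t , e′ , ℤP.drop‿+≤+ (subst (+ L ℤ.≤_) e′ L≤) , negative κ k t k+κ≡q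
    where
    k = q ℕ.∸ suc κ
    k+κ≡q : k ℕ.+ suc κ ≡ q
    k+κ≡q = ℕP.m∸n+n≡m ∣k∣≤q
    ring : ∀ k c q t → ℤ.- c ℤ.+ (k ℤ.+ c) ℤ.+ q ℤ.* t ≡ k ℤ.+ q ℤ.* t
    ring = ℤSolver.solve-∀
    ring′ : ∀ c q t → ℤ.- c ℤ.+ q ℤ.* (+ 1 ℤ.+ t) ≡ ℤ.- c ℤ.+ q ℤ.+ q ℤ.* t
    ring′ = ℤSolver.solve-∀
    e′ : evalZ f (+ suc q) ≡ + (k ℕ.+ q ℕ.* t)
    e′ = begin
      evalZ f (+ suc q)                                            ≡⟨ e ⟩
      -[1+ κ ] ℤ.+ + q ℤ.* + suc t                                 ≡⟨ ring′ (+ suc κ) (+ q) (+ t) ⟩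
      -[1+ κ ] ℤ.+ + q ℤ.+ + q ℤ.* + t                             ≡⟨ cong (λ z → -[1+ κ ] ℤ.+ z ℤ.+ + q ℤ.* + t)
                                                                       (trans (cong +_ (sym k+κ≡q)) (ℤP.pos-+ k (suc κ))) ⟩
      -[1+ κ ] ℤ.+ (+ k ℤ.+ + suc κ) ℤ.+ + q ℤ.* + t               ≡⟨ ring (+ k) (+ suc κ) (+ q) (+ t) ⟩
      + k ℤ.+ + q ℤ.* + t                                          ≡⟨ cong (λ z → + k ℤ.+ z) (sym (ℤP.pos-* q t)) ⟩
      + k ℤ.+ + (q ℕ.* t)                                          ≡⟨ sym (ℤP.pos-+ k (q ℕ.* t)) ⟩
      + (k ℕ.+ q ℕ.* t)                                            ∎

parity : ∀ n → ∃ λ h → n ≡ h ℕ.+ h ⊎ n ≡ suc (h ℕ.+ h)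
parity zero = 0 , inj₁ refl
parity (suc n) with parity n
... | h , inj₁ e = h , inj₂ (cong suc e)
... | h , inj₂ e = suc h , inj₁ (trans (cong suc e) (cong suc (sym (ℕP.+-suc h h))))

2∣h+h : ∀ h → 2 ℕD.∣ h ℕ.+ h
2∣h+h h = ℕD.divides h (ring h)
  where
  ring : ∀ h → h ℕ.+ h ≡ h ℕ.* 2
  ring = ℕSolver.solve-∀

odd-prime : ∀ p → Prime p → 3 ≤ p → ∃ λ h → ℕ.pred p ≡ h ℕ.+ h
odd-prime (suc q) p-prime 3≤p with parity q
... | h , inj₁ e = h , e
... | h , inj₂ e with prime⇒irreducible p-prime {2} (subst (2 ℕD.∣_) (cong suc (trans (ℕP.+-suc h h) (sym e))) (2∣h+h (suc h)))
...   | inj₁ ()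
...   | inj₂ 2≡p = ⊥-elim (ℕP.<⇒≢ 3≤p 2≡p)

Bern-odd′ : ∀ n → ¬ (2 ℕD.∣ n) → 3 ≤ n → Bern n ≡ 0ℚ
Bern-odd′ n 2∤n 3≤n with parity n
... | h , inj₁ refl = ⊥-elim (2∤n (2∣h+h h))
Bern-odd′ .(suc (h ℕ.+ h)) 2∤n (s≤s 2≤h+h) | h , inj₂ refl = go h 2≤h+h
  where
  go : ∀ h → 2 ≤ h ℕ.+ h → Bern (suc (h ℕ.+ h)) ≡ 0ℚ
  go (suc h) _ = trans (cong Bern (ring h)) (Bern-odd h)
    where
    ring : ∀ h → suc (suc h ℕ.+ suc h) ≡ 3 ℕ.+ 2 ℕ.* h
    ring = ℕSolver.solve-∀

-- As q is even, moving along the progression preserves parity, also from a negative k to its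
-- nonnegative representative.
Class-odd : ∀ {q k n} → (∃ λ h → q ≡ h ℕ.+ h) → Class q k n → ¬ Even k → ¬ (2 ℕD.∣ n)
Class-odd {q} (h , e) (nonneg κ t) odd 2∣n =
  odd (ℕD.∣m+n∣m⇒∣n (subst (2 ℕD.∣_) (ℕP.+-comm κ (q ℕ.* t)) 2∣n) (ℕD.∣m⇒∣m*n t (subst (2 ℕD.∣_) (sym e) (2∣h+h h))))
Class-odd {q} (h , e) (negative κ k t k+κ≡q) odd 2∣n =
  odd (ℕD.∣m+n∣m⇒∣n (subst (2 ℕD.∣_) (sym k+κ≡q) 2∣q)
    (ℕD.∣m+n∣m⇒∣n (subst (2 ℕD.∣_) (ℕP.+-comm k (q ℕ.* t)) 2∣n) (ℕD.∣m⇒∣m*n t 2∣q)))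
  where
  2∣q = subst (2 ℕD.∣_) (sym e) (2∣h+h h)

-- Restricted sums, the bound M and the partition into classes.

indicator : {A : Set} → Dec A → ℚ → ℚ
indicator (yes _) x = x
indicator (no _) x = 0ℚ

sumOver-filter : ∀ {I : Set} {Q : I → Set} (Q? : Decidable Q) (F : I → ℚ) is →
  sumOver F (filter Q? is) ≡ sumOver (λ i → indicator (Q? i) (F i)) is
sumOver-filter Q? F [] = refl
sumOver-filter Q? F (i ∷ is) with Q? i
... | yes _ = cong (λ z → F i + z) (sumOver-filter Q? F is)
... | no _ = trans (sumOver-filter Q? F is) (sym (ℚP.+-identityˡ (sumOver (λ i → indicator (Q? i) (F i)) is)))

-- M ≼ v: M is a lower bound of v in ℤ ∪ {∞}, with ∞ = nothing.
_≼_ : Maybe ℤ → Maybe ℤ → Set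
_ ≼ nothing = ⊤
nothing ≼ just _ = ⊥
just M ≼ just v = M ℤ.≤ v

minM-≼ˡ : ∀ x y → minM x y ≼ x
minM-≼ˡ nothing y = tt
minM-≼ˡ (just x) nothing = ℤP.≤-refl
minM-≼ˡ (just x) (just y) = ℤP.i⊓j≤i x y

minM-≼ʳ : ∀ x y {v} → y ≼ v → minM x y ≼ v
minM-≼ʳ x y {nothing} _ = tt
minM-≼ʳ x nothing {just v} ()
minM-≼ʳ nothing (just y) {just v} y≤v = y≤v
minM-≼ʳ (just x) (just y) {just v} y≤v = ℤP.≤-trans (ℤP.i⊓j≤j x y) y≤v

foldr-minM-≼ : ∀ {I : Set} (F : I → Maybe ℤ) z {i} is → i ∈ is → foldr minM z (map F is) ≼ F i
foldr-minM-≼ F z (j ∷ is) (here refl) = minM-≼ˡ (F j) (foldr minM z (map F is))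
foldr-minM-≼ F z (j ∷ is) (there i∈is) = minM-≼ʳ (F j) (foldr minM z (map F is)) (foldr-minM-≼ F z is i∈is)

≼⇒vt≥ : ∀ h {M} → just M ≼ vtF h → vt≥ h M
≼⇒vt≥ h M≤v with vtF h
... | nothing = tt
... | just v = M≤v

-- When all gᵢ vanish there are no conditions with m ≥ 1, and N serves as the bound.
lower-bound : ∀ N n g0 (g : Fin n → RatFun) → ∃ λ M →
  (∀ m → + suc m ℤ.≤ N ℤ.- M → ≤N-M (suc m) N (minVal g0 g)) × (∀ i → vt≥ (toFrac (g i)) M)
lower-bound N n g0 g with minVal g0 g | (λ i → foldr-minM-≼ (λ i → vt (g i)) (vt g0) (allFin n) (∈-allFin i))
... | just M | below = M , (λ m le → le) , λ i → ≼⇒vt≥ (toFrac (g i)) (below i)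
... | nothing | below = N , (λ m le → none m (subst (+ suc m ℤ.≤_) (ℤP.+-inverseʳ N) le)) , λ i → infinite i (below i)
  where
  none : ∀ m → + suc m ℤ.≤ + 0 → ⊥
  none m (ℤ.+≤+ ())
  infinite : ∀ i → nothing ≼ vtF (toFrac (g i)) → vt≥ (toFrac (g i)) N
  infinite i e with vtF (toFrac (g i))
  ... | nothing = tt

module _ (p : ℕ) (p-prime : Prime p) where

  open Valuation p p-prime
  open ClassSums p p-prime using (V-sumOver)

  -- The list `js` may name a class several times. Each step peels off the class of `j` and replaces
  -- its entries by 0, so that a repeated class adds nothing when it is met again.
  V-partition : ∀ {I : Set} {N} (key : I → ℤ) is js (X : I → ℚ) →
    (∀ i → X i ≡ 0ℚ ⊎ Any (λ j → key i ≡ key j) js) →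
    (∀ j → V N (sumOver (λ i → indicator (key i ℤP.≟ key j) (X i)) is)) → V N (sumOver X is)
  V-partition {N = N} key is [] X covered classes = V-sumOver is (λ i → V-≡ (sym (vanish i (covered i))) V-0)
    where
    vanish : ∀ i → X i ≡ 0ℚ ⊎ Any (λ j → key i ≡ key j) [] → X i ≡ 0ℚ
    vanish i (inj₁ e) = e
    vanish i (inj₂ ())
  V-partition {N = N} key is (j ∷ js) X covered classes =
    V-≡ (sym (trans (sumOver-cong is split) (sumOver-+ Xⱼ X′ is)))
      (V-+ (classes j) (V-partition key is js X′ covered′ classes′))
    where
    Xⱼ X′ : _ → ℚ
    Xⱼ i = indicator (key i ℤP.≟ key j) (X i)
    X′ i with key i ℤP.≟ key j
    ... | yes _ = 0ℚ
    ... | no _ = X i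
    split : ∀ i → X i ≡ Xⱼ i + X′ i
    split i with key i ℤP.≟ key j
    ... | yes _ = sym (ℚP.+-identityʳ (X i))
    ... | no _ = sym (ℚP.+-identityˡ (X i))
    covered′ : ∀ i → X′ i ≡ 0ℚ ⊎ Any (λ j → key i ≡ key j) js
    covered′ i with key i ℤP.≟ key j | covered i
    ... | yes _ | _ = inj₁ refl
    ... | no _ | inj₁ e = inj₁ e
    ... | no ≢ | inj₂ (here e) = ⊥-elim (≢ e)
    ... | no _ | inj₂ (there later) = inj₂ later
    classes′ : ∀ j′ → V N (sumOver (λ i → indicator (key i ℤP.≟ key j′) (X′ i)) is)
    classes′ j′ with key j′ ℤP.≟ key j
    ... | yes same = V-sumOver is (λ i → V-≡ (sym (vanish i)) V-0)
      where
      vanish : ∀ i → indicator (key i ℤP.≟ key j′) (X′ i) ≡ 0ℚ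
      vanish i with key i ℤP.≟ key j′ | key i ℤP.≟ key j
      ... | no _ | _ = refl
      ... | yes _ | yes _ = refl
      ... | yes e | no ≢ = ⊥-elim (≢ (trans e same))
    ... | no different = V-≡ (sumOver-cong is agree) (classes j′)
      where
      agree : ∀ i → indicator (key i ℤP.≟ key j′) (X i) ≡ indicator (key i ℤP.≟ key j′) (X′ i)
      agree i with key i ℤP.≟ key j′ | key i ℤP.≟ key j
      ... | no _ | _ = refl
      ... | yes _ | no _ = refl
      ... | yes e | yes e′ = ⊥-elim (different (trans (sym e) e′))

-- The contribution of one class at a fixed prime.

fromℤ-^ : ∀ z m → fromℤ (z ℤ.^ m) ≡ fromℤ z ^ m
fromℤ-^ z zero = refl
fromℤ-^ z (suc m) = trans (fromℤ-* z (z ℤ.^ m)) (cong (fromℤ z *_) (fromℤ-^ z m))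

indicator-* : ∀ {A : Set} (d : Dec A) x y → indicator d (x * y) ≡ indicator d x * y
indicator-* (yes _) x y = refl
indicator-* (no _) x y = sym (ℚP.*-zeroˡ y)

divQ-0 : ∀ y → divQ 0ℚ y ≡ 0ℚ
divQ-0 y with y ℚP.≟ 0ℚ
... | yes _ = refl
... | no y≢0 = ℚP.*-zeroˡ (1/ y)
  where instance _ = ℚ.≢-nonZero y≢0

-- Spelled as in `cond1Term`, so that the two agree by definition when condition 1 is evaluated.
kummerPoly : ℕ → PolyQ
kummerPoly k = scaleP (divQ (Bern k) (fromℕ k)) (addP (constP 1ℚ) (negP (monoP (k ℕ.∸ 1))))

evalQ-kummerPoly : ∀ k x → evalQ (kummerPoly k) x ≡ divQ (Bern k) (fromℕ k) * (1ℚ - x ^ (k ℕ.∸ 1))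
evalQ-kummerPoly k x = trans (evalQ-scaleP (divQ (Bern k) (fromℕ k)) (addP (constP 1ℚ) (negP (monoP (k ℕ.∸ 1)))) x)
  (cong (divQ (Bern k) (fromℕ k) *_)
    (trans (evalQ-addP (constP 1ℚ) (negP (monoP (k ℕ.∸ 1))) x)
      (cong₂ _+_ (evalQ-constP 1ℚ x) (trans (evalQ-negP (monoP (k ℕ.∸ 1)) x) (cong -_ (evalQ-monoP (k ℕ.∸ 1) x))))))

-- The contribution of one index to condition 1, at t = x with 1 - 1/t = ρ.
mainTerm : ℚ → ℚ → ℤ → ℚ → ℚ → ℚ
mainTerm ρ x k γ ν =
  indicator (k ℤP.≟ + 0) (ρ * γ) + indicator (+ 2 ℤP.≤? k) (evalQ (kummerPoly ℤ.∣ k ∣) x * (γ * ν))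

remainder : ℚ → ℚ → ℤ → ℚ → ℚ → ℚ → ℚ
remainder ρ x k b γ ν = γ * b - mainTerm ρ x k γ ν

-- K is the precision required of Bₙ when its coefficient lies in `V M`. The bound 3 + K ≤ p gives K
-- + 2 ≤ p - 1 and makes p odd; likewise 3 + K ≤ n below serves both for K + 2 ≤ n and for n ≥ 3 in
-- odd classes.
module AtPrime (p : ℕ) (p-prime : Prime p) (N M : ℤ) (K : ℕ) (N≤M+K : N ℤ.≤ M ℤ.+ + K) (K+3≤p : 3 ℕ.+ K ≤ p) where

  open Valuation p p-prime
  open PolynomialCongruence p p-prime
  open BernoulliCongruence p p-prime
  open ClassSums p p-prime

  ρ : ℚ
  ρ = 1ℚ - 1/P

  K<p₁ : suc (suc K) ≤ p₁
  K<p₁ = ℕP.≤-pred (subst (3 ℕ.+ K ≤_) p≡1+p₁ K+3≤p)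

  p₁-even : ∃ λ h → p₁ ≡ h ℕ.+ h
  p₁-even = odd-prime p p-prime (ℕP.≤-trans (ℕP.m≤m+n 3 K) K+3≤p)

  V-error : ∀ {x y} → V M x → V (+ K) y → V N (x * y)
  V-error vx vy = V-mono N≤M+K (V-* vx vy)

  -- The powers `fromℕ n ^ 1` and `κ ^ 0` stay unsimplified because the subtracted expression is the
  -- summand of `classSum` at m = 0.
  Approximation : ℤ → ℚ → ℚ → Set
  Approximation k e κ = ∃ λ H → Integral H × (∀ n → 3 ℕ.+ K ≤ n → Class p₁ k n → ∀ γ → V M γ →
    V N (remainder ρ P k (Bern n) γ (fromℕ n)
         - γ * (fromℕ n ^ 1 * evalQ H (P * fromℕ n) - e * κ ^ 0 * evalQ H (P * κ) * fromℕ n)))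

  -- Here n is odd and at least 3, so Bₙ = 0. The main term is 0 as well: B_k = 0 for odd k ≥ 3, and
  -- k = 1 lies below the range k ≥ 2 of condition 1.
  remainder-odd : ∀ k n γ → ¬ Even k → 3 ℕ.+ K ≤ n → Class p₁ k n → remainder ρ P k (Bern n) γ (fromℕ n) ≡ 0ℚ
  remainder-odd k n γ odd K<n class = trans
    (cong₂ (λ b m → γ * b - m) (Bern-odd′ n (Class-odd p₁-even class odd) (ℕP.≤-trans (ℕP.m≤m+n 3 K) K<n))
      (cong₂ _+_ (not-zero (k ℤP.≟ + 0)) (not-positive k odd (+ 2 ℤP.≤? k))))
    (ring γ)
    where
    ring : ∀ γ → γ * 0ℚ - (0ℚ + 0ℚ) ≡ 0ℚ
    ring = solve-∀ ringℚ
    not-zero : ∀ (d : Dec (k ≡ + 0)) → indicator d (ρ * γ) ≡ 0ℚ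
    not-zero (yes refl) = ⊥-elim (odd (2 ℕD.∣0))
    not-zero (no _) = refl
    Bern-k : ∀ k → ¬ Even k → + 2 ℤ.≤ k → Bern ℤ.∣ k ∣ ≡ 0ℚ
    Bern-k (+ 2) odd _ = ⊥-elim (odd ℕD.∣-refl)
    Bern-k (+ 0) odd (ℤ.+≤+ ())
    Bern-k (+ 1) odd (ℤ.+≤+ (s≤s ()))
    Bern-k (+ suc (suc (suc k))) odd _ = Bern-odd′ (3 ℕ.+ k) odd (s≤s (s≤s (s≤s z≤n)))
    not-positive : ∀ k → ¬ Even k → (d : Dec (+ 2 ℤ.≤ k)) →
      indicator d (evalQ (kummerPoly ℤ.∣ k ∣) P * (γ * fromℕ n)) ≡ 0ℚ
    not-positive k odd (no _) = refl
    not-positive k odd (yes 2≤k) = trans (cong (_* (γ * fromℕ n)) (begin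
      evalQ (kummerPoly ℤ.∣ k ∣) P
        ≡⟨ evalQ-kummerPoly ℤ.∣ k ∣ P ⟩
      divQ (Bern ℤ.∣ k ∣) (fromℕ ℤ.∣ k ∣) * r
        ≡⟨ cong (λ b → divQ b (fromℕ ℤ.∣ k ∣) * r) (Bern-k k odd 2≤k) ⟩
      divQ 0ℚ (fromℕ ℤ.∣ k ∣) * r
        ≡⟨ cong (_* r) (divQ-0 (fromℕ ℤ.∣ k ∣)) ⟩
      0ℚ * r
        ≡⟨ ℚP.*-zeroˡ r ⟩
      0ℚ ∎)) (ℚP.*-zeroˡ (γ * fromℕ n))
      where
      r = 1ℚ - P ^ (ℤ.∣ k ∣ ℕ.∸ 1)

  approximation-negative : ∀ κ k → k ℕ.+ suc κ ≡ p₁ → 2 ℕ.^ suc κ ≤ p → Approximation -[1+ κ ] 0ℚ 0ℚ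
  approximation-negative κ k k+κ≡p₁ 2^≤p = H , vH , bound
    where
    solution = Bern-approx-negative (proj₁ p₁-even) (proj₂ p₁-even) K K<p₁ (suc κ) (s≤s z≤n) 2^≤p k k+κ≡p₁
    H = proj₁ solution
    vH = proj₁ (proj₂ solution)
    approx = proj₂ (proj₂ solution)
    ring : ∀ γ b n y z → γ * (b - n * y) ≡ γ * b - (0ℚ + 0ℚ) - γ * (n * 1ℚ * y - 0ℚ * 1ℚ * z * n)
    ring = solve-∀ ringℚ
    bound : ∀ n → 3 ℕ.+ K ≤ n → Class p₁ -[1+ κ ] n → ∀ γ → V M γ →
      V N (remainder ρ P -[1+ κ ] (Bern n) γ (fromℕ n)
           - γ * (fromℕ n ^ 1 * evalQ H (P * fromℕ n) - 0ℚ * 0ℚ ^ 0 * evalQ H (P * 0ℚ) * fromℕ n))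
    bound _ K<n (negative .κ k′ t k′+κ≡p₁) γ vγ =
      V-≡ (ring γ (Bern n) (fromℕ n) (evalQ H (P * fromℕ n)) (evalQ H (P * 0ℚ))) (V-error vγ error)
      where
      n = k′ ℕ.+ p₁ ℕ.* t
      error : V (+ K) (Bern n - fromℕ n * evalQ H (P * fromℕ n))
      error = subst (λ j → suc (suc K) ≤ j ℕ.+ p₁ ℕ.* t →
          V (+ K) (Bern (j ℕ.+ p₁ ℕ.* t) - fromℕ (j ℕ.+ p₁ ℕ.* t) * evalQ H (P * fromℕ (j ℕ.+ p₁ ℕ.* t))))
        (ℕP.+-cancelʳ-≡ (suc κ) k k′ (trans k+κ≡p₁ (sym k′+κ≡p₁))) (approx t) (ℕP.≤-trans (ℕP.n≤1+n _) K<n)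

  P*ρ : P * ρ ≡ P - 1ℚ
  P*ρ = trans (ring P 1/P) (cong (λ z → P - z) 1/P*P)
    where
    ring : ∀ p i → p * (1ℚ - i) ≡ p - i * p
    ring = solve-∀ ringℚ

  approximation-zero : Approximation (+ 0) 0ℚ 0ℚ
  approximation-zero = H , vH , bound
    where
    solution = Bern-approx-zero (proj₁ p₁-even) (proj₂ p₁-even) K K<p₁ ρ P*ρ
    H = proj₁ solution
    vH = proj₁ (proj₂ solution)
    approx = proj₂ (proj₂ solution)
    ring : ∀ γ b r n y z → γ * (b - (r + n * y)) ≡ γ * b - (r * γ + 0ℚ) - γ * (n * 1ℚ * y - 0ℚ * 1ℚ * z * n)
    ring = solve-∀ ringℚ
    bound : ∀ n → 3 ℕ.+ K ≤ n → Class p₁ (+ 0) n → ∀ γ → V M γ →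
      V N (remainder ρ P (+ 0) (Bern n) γ (fromℕ n)
           - γ * (fromℕ n ^ 1 * evalQ H (P * fromℕ n) - 0ℚ * 0ℚ ^ 0 * evalQ H (P * 0ℚ) * fromℕ n))
    bound _ K<n (nonneg .0 t) γ vγ =
      V-≡ (ring γ (Bern n) ρ (fromℕ n) (evalQ H (P * fromℕ n)) (evalQ H (P * 0ℚ)))
        (V-error vγ (approx t (ℕP.≤-trans (ℕP.n≤1+n _) K<n)))
      where
      n = 0 ℕ.+ p₁ ℕ.* t

  approximation-positive : ∀ κ → 2 ≤ κ → 2 ℕ.^ κ ≤ p → Approximation (+ κ) 1ℚ (fromℕ κ)
  approximation-positive κ 2≤κ 2^≤p = H , vH , bound
    where
    solution = Bern-approx-positive (proj₁ p₁-even) (proj₂ p₁-even) K K<p₁ κ (ℕP.≤-trans (ℕP.n≤1+n 1) 2≤κ) 2^≤p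
    H = proj₁ solution
    vH = proj₁ (proj₂ solution)
    approx = proj₂ (proj₂ solution)
    c : ℚ
    c = divQ (Bern κ) (fromℕ κ) * (1ℚ - P ^ (κ ℕ.∸ 1))
    ring : ∀ γ b c n y z → γ * (b - (c * n + (n * y - z * n)))
      ≡ γ * b - (0ℚ + c * (γ * n)) - γ * (n * 1ℚ * y - 1ℚ * 1ℚ * z * n)
    ring = solve-∀ ringℚ
    main : ∀ γ ν → 0ℚ + c * (γ * ν) ≡ mainTerm ρ P (+ κ) γ ν
    main γ ν = cong₂ _+_ (not-zero (+ κ ℤP.≟ + 0)) (at-least-2 (+ 2 ℤP.≤? + κ))
      where
      not-zero : ∀ (d : Dec (+ κ ≡ + 0)) → 0ℚ ≡ indicator d (ρ * γ)
      not-zero (yes e) = ⊥-elim (ℕP.<⇒≢ (ℕP.≤-trans (ℕP.n≤1+n 1) 2≤κ) (sym (ℤP.+-injective e)))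
      not-zero (no _) = refl
      at-least-2 : ∀ (d : Dec (+ 2 ℤ.≤ + κ)) → c * (γ * ν) ≡ indicator d (evalQ (kummerPoly κ) P * (γ * ν))
      at-least-2 (yes _) = cong (_* (γ * ν)) (sym (evalQ-kummerPoly κ P))
      at-least-2 (no ≱) = ⊥-elim (≱ (ℤ.+≤+ 2≤κ))
    bound : ∀ n → 3 ℕ.+ K ≤ n → Class p₁ (+ κ) n → ∀ γ → V M γ →
      V N (remainder ρ P (+ κ) (Bern n) γ (fromℕ n)
           - γ * (fromℕ n ^ 1 * evalQ H (P * fromℕ n) - 1ℚ * fromℕ κ ^ 0 * evalQ H (P * fromℕ κ) * fromℕ n))
    bound _ K<n (nonneg .κ t) γ vγ =
      V-≡ (trans (ring γ (Bern n) c (fromℕ n) (evalQ H (P * fromℕ n)) (evalQ H (P * fromℕ κ)))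
                 (cong (λ z → γ * Bern n - z - γ * (fromℕ n ^ 1 * evalQ H (P * fromℕ n) - 1ℚ * fromℕ κ ^ 0 * evalQ H (P * fromℕ κ) * fromℕ n))
                       (main γ (fromℕ n))))
        (V-error vγ (approx t (ℕP.≤-trans (ℕP.n≤1+n _) K<n)))
      where
      n = κ ℕ.+ p₁ ℕ.* t

  module _ {I : Set} (is : List I) (key : I → ℤ) (γ : I → ℚ) (n : I → ℕ)
    (V-γ : ∀ i → V M (γ i)) (K<n : ∀ i → 3 ℕ.+ K ≤ n i)
    (class : ∀ i → Class p₁ (key i) (n i)) (2^≤p : ∀ i → 2 ℕ.^ ℤ.∣ key i ∣ ≤ p) where

    ν : I → ℚ
    ν i = fromℕ (n i)

    X : I → ℚ
    X i = remainder ρ P (key i) (Bern (n i)) (γ i) (ν i)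

    classTerm : ℤ → ℚ → ℚ → ℕ → I → ℚ
    classTerm k e κ m i = indicator (key i ℤP.≟ k) (γ i) * (ν i ^ suc m - e * κ ^ m * ν i)

    Conditions : ℤ → ℚ → ℚ → Set
    Conditions k e κ = ∀ m → V (N ℤ.- + m) (sumOver (classTerm k e κ m) is)

    class-approximated : ∀ k e κ → Approximation k e κ → Conditions k e κ →
      V N (sumOver (λ i → indicator (key i ℤP.≟ k) (X i)) is)
    class-approximated k e κ (H , vH , approx) conditions = V-≡ (sym split)
      (V-+ (subst (λ L → V L (sumOver F is)) (ℤP.+-identityʳ N)
             (classSum is (λ i → indicator (key i ℤP.≟ k) (γ i)) ν N e κ conditions vH 0))
           (V-sumOver is error))
      where
      F : I → ℚ
      F i = indicator (key i ℤP.≟ k) (γ i) * (ν i ^ 1 * evalQ H (P * ν i) - e * κ ^ 0 * evalQ H (P * κ) * ν i)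
      E : I → ℚ
      E i = indicator (key i ℤP.≟ k) (X i) - F i
      ring : ∀ a b → a ≡ b + (a - b)
      ring = solve-∀ ringℚ
      split : sumOver (λ i → indicator (key i ℤP.≟ k) (X i)) is ≡ sumOver F is + sumOver E is
      split = trans (sumOver-cong is (λ i → ring (indicator (key i ℤP.≟ k) (X i)) (F i))) (sumOver-+ F E is)
      Y : I → ℚ
      Y i = ν i ^ 1 * evalQ H (P * ν i) - e * κ ^ 0 * evalQ H (P * κ) * ν i
      ring′ : ∀ x → 0ℚ ≡ 0ℚ - 0ℚ * x
      ring′ = solve-∀ ringℚ
      error′ : ∀ i (d : Dec (key i ≡ k)) → V N (indicator d (X i) - indicator d (γ i) * Y i)
      error′ i (yes refl) = approx (n i) (K<n i) (class i) (γ i) (V-γ i)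
      error′ i (no _) = V-≡ (ring′ (Y i)) V-0
      error : ∀ i → V N (E i)
      error i = error′ i (key i ℤP.≟ k)

    class-vanishes : (∀ i → Even (key i) → key i ℤ.≤ + 0 → Conditions (key i) 0ℚ 0ℚ) →
      (∀ i → Even (key i) → + 0 ℤ.< key i → Conditions (key i) 1ℚ (fromℤ (key i))) →
      ∀ i → V N (sumOver (λ j → indicator (key j ℤP.≟ key i) (X j)) is)
    class-vanishes cond₂ cond₃ i = by-parity (2 ℕD.∣? ℤ.∣ key i ∣)
      where
      vanish : ¬ Even (key i) → ∀ j (d : Dec (key j ≡ key i)) → V N (indicator d (X j))
      vanish odd j (yes same) = V-≡ (sym (remainder-odd (key j) (n j) (γ j) (λ even → odd (subst Even same even)) (K<n j) (class j))) V-0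
      vanish odd j (no _) = V-0
      -- The key is generalised to a variable `k` so that its sign can be matched on.
      by-sign : Even (key i) → ∀ k → k ≡ key i → Class p₁ k (n i) → 2 ℕ.^ ℤ.∣ k ∣ ≤ p →
        V N (sumOver (λ j → indicator (key j ℤP.≟ key i) (X j)) is)
      by-sign even k e class-i 2^k≤p = subst (λ k → V N (sumOver (λ j → indicator (key j ℤP.≟ k) (X j)) is)) e
        (go k class-i 2^k≤p (subst Even (sym e) even)
          (λ ev le → subst (λ k → Conditions k 0ℚ 0ℚ) (sym e) (cond₂ i (subst Even e ev) (subst (ℤ._≤ + 0) e le)))
          (λ ev lt → subst (λ k → Conditions k 1ℚ (fromℤ k)) (sym e) (cond₃ i (subst Even e ev) (subst (+ 0 ℤ.<_) e lt))))
        where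
        go : ∀ k {m} → Class p₁ k m → 2 ℕ.^ ℤ.∣ k ∣ ≤ p → Even k →
          (Even k → k ℤ.≤ + 0 → Conditions k 0ℚ 0ℚ) → (Even k → + 0 ℤ.< k → Conditions k 1ℚ (fromℤ k)) →
          V N (sumOver (λ j → indicator (key j ℤP.≟ k) (X j)) is)
        go (+ 0) _ _ ev c₂ c₃ = class-approximated (+ 0) 0ℚ 0ℚ approximation-zero (c₂ ev (ℤ.+≤+ z≤n))
        go (+ 1) _ _ (ℕD.divides (suc q) ())
        go (+ suc (suc κ)) _ 2^ ev c₂ c₃ = class-approximated (+ suc (suc κ)) 1ℚ (fromℕ (suc (suc κ)))
          (approximation-positive (suc (suc κ)) (s≤s (s≤s z≤n)) 2^) (c₃ ev (ℤ.+<+ (s≤s z≤n)))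
        go -[1+ κ ] (negative .κ k t e) 2^ ev c₂ c₃ = class-approximated -[1+ κ ] 0ℚ 0ℚ
          (approximation-negative κ k e 2^) (c₂ ev ℤ.-≤+)
      by-parity : Dec (Even (key i)) → V N (sumOver (λ j → indicator (key j ℤP.≟ key i) (X j)) is)
      by-parity (no odd) = V-sumOver is (λ j → vanish odd j (key j ℤP.≟ key i))
      by-parity (yes even) = by-sign even (key i) refl (class i) (2^≤p i)

-- Assembly for all large primes.

module _ (N : ℤ) (n : ℕ) (f : Fin n → PolyZ) (g0 : RatFun) (g : Fin n → RatFun)
  (nonConst : ∀ i → NonConstPosLead (f i)) (cond₁ : Cond1 N f g0 g) (cond₂ : Cond2 N f g0 g) (cond₃ : Cond3 N f g0 g)
  (M : ℤ) (applicable : ∀ m → + suc m ℤ.≤ N ℤ.- M → ≤N-M (suc m) N (minVal g0 g)) (vt≥M : ∀ i → vt≥ (toFrac (g i)) M) where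

  private
    key : Fin n → ℤ
    key i = at1 (f i)

    is : List (Fin n)
    is = allFin n

    -- The absolute value also covers N < M: it still gives N ≤ M + K, and m < K whenever m + 1 ≤ N
    -- - M.
    K : ℕ
    K = ℤ.∣ N ℤ.- M ∣

    N≤M+K : N ℤ.≤ M ℤ.+ + K
    N≤M+K = ℤP.≤-trans (ℤP.≤-reflexive (ring N M)) (ℤP.+-monoʳ-≤ M (i≤∣i∣ (N ℤ.- M)))
      where
      ring : ∀ N M → N ≡ M ℤ.+ (N ℤ.- M)
      ring = ℤSolver.solve-∀

    frac₁ : Frac
    frac₁ = subF (subF (toFrac g0) (mulF oneMinusInvT (sumWhere f (ℤP._≟ + 0) (λ i → toFrac (g i)))))
                 (sumWhere f (+ 2 ℤP.≤?_) (λ i → cond1Term (f i) (g i)))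

    -- The index is shifted: `m` here belongs to the exponent m + 1 of conditions 2 and 3, in
    -- agreement with `classSum`.
    poly₂ : ℕ → Fin n → PolyQ
    poly₂ m j = powP (toQ (f j)) (suc m)

    poly₃ : ℤ → ℕ → Fin n → PolyQ
    poly₃ k m j = addP (powP (toQ (f j)) (suc m)) (negP (scaleP (fromℤ (k ℤ.^ m)) (toQ (f j))))

    classFrac : ℤ → (Fin n → PolyQ) → Frac
    classFrac k poly = sumWhere f (ℤP._≟ k) (λ j → mulF (toFrac (g j)) (polyF (poly j)))

    Bound : ℤ → (Fin n → PolyQ) → ℕ → (p : ℕ) → Prime p → Set
    Bound k poly m p p-prime = ∀ q → Value (fromℕ p) (classFrac k poly) q → Valuation.V p p-prime (N ℤ.+ + 1 ℤ.- + suc m) q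

    -- The threshold for p has to be fixed before the side conditions are supplied, so these are
    -- decided first; where one of them fails the claim is void.
    bound₂ : ∀ i m → Eventually (λ p p-prime →
      Even (key i) → key i ℤ.≤ + 0 → + suc m ℤ.≤ N ℤ.- M → Bound (key i) (poly₂ m) m p p-prime)
    bound₂ i m with 2 ℕD.∣? ℤ.∣ key i ∣ | key i ℤP.≤? + 0 | + suc m ℤP.≤? N ℤ.- M
    ... | yes ev | yes k≤0 | yes m≤ = eventually-map (λ p p-prime b _ _ _ → b)
      (eventually-vt≥ (classFrac (key i) (poly₂ m)) (N ℤ.+ + 1 ℤ.- + suc m)
        (cond₂ (key i) ev k≤0 (i , refl) (suc m) (s≤s z≤n) (applicable m m≤)))
    ... | no odd | _ | _ = always (λ p p-prime ev _ _ → ⊥-elim (odd ev))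
    ... | yes _ | no ≰ | _ = always (λ p p-prime _ k≤0 _ → ⊥-elim (≰ k≤0))
    ... | yes _ | yes _ | no ≰ = always (λ p p-prime _ _ m≤ → ⊥-elim (≰ m≤))

    bound₃ : ∀ i m → Eventually (λ p p-prime →
      Even (key i) → + 0 ℤ.< key i → 1 ≤ m → + suc m ℤ.≤ N ℤ.- M → Bound (key i) (poly₃ (key i) m) m p p-prime)
    bound₃ i zero = always (λ { p p-prime _ _ () })
    bound₃ i m@(suc m-1) with 2 ℕD.∣? ℤ.∣ key i ∣ | + 0 ℤP.<? key i | + suc m ℤP.≤? N ℤ.- M
    ... | yes ev | yes 0<k | yes m≤ = eventually-map (λ p p-prime b _ _ _ _ → b)
      (eventually-vt≥ (classFrac (key i) (poly₃ (key i) m)) (N ℤ.+ + 1 ℤ.- + suc m)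
        (cond₃ (key i) ev 0<k (i , refl) (suc m) (s≤s (s≤s z≤n)) (applicable m m≤)))
    ... | no odd | _ | _ = always (λ p p-prime ev _ _ _ → ⊥-elim (odd ev))
    ... | yes _ | no ≮ | _ = always (λ p p-prime _ 0<k _ _ → ⊥-elim (≮ 0<k))
    ... | yes _ | yes _ | no ≰ = always (λ p p-prime _ _ _ m≤ → ⊥-elim (≰ m≤))

    record Large (p : ℕ) (p-prime : Prime p) : Set where
      constructor large
      field
        value-g0 : Value (fromℕ p) (toFrac g0) (evalRF g0 (fromℕ p))
        value-g : ∀ i → Value (fromℕ p) (toFrac (g i)) (evalRF (g i) (fromℕ p))
        bound-g : ∀ i q → Value (fromℕ p) (toFrac (g i)) q → Valuation.V p p-prime M q
        bound-1 : ∀ q → Value (fromℕ p) frac₁ q → Valuation.V p p-prime N q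
        bound-2 : ∀ i m → m < K →
          Even (key i) → key i ℤ.≤ + 0 → + suc m ℤ.≤ N ℤ.- M → Bound (key i) (poly₂ m) m p p-prime
        bound-3 : ∀ i m → m < K →
          Even (key i) → + 0 ℤ.< key i → 1 ≤ m → + suc m ℤ.≤ N ℤ.- M → Bound (key i) (poly₃ (key i) m) m p p-prime
        classes : ∀ i → ∃ λ m → evalZ (f i) (+ p) ≡ + m × 3 ℕ.+ K ≤ m × Class (ℕ.pred p) (key i) m
        2^≤p : ∀ i → 2 ℕ.^ ℤ.∣ key i ∣ ≤ p
        K+3≤p : 3 ℕ.+ K ≤ p

    eventually-large : Eventually Large
    eventually-large = eventually-map
      (λ { p p-prime (a , b , c , d , e , h , i , j , k) → large a b c d e h i j k })
      (eventually-× (eventually-Value g0)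
      (eventually-× (eventually-Fin n (λ i → eventually-Value (g i)))
      (eventually-× (eventually-Fin n (λ i → eventually-vt≥ (toFrac (g i)) M (vt≥M i)))
      (eventually-× (eventually-vt≥ frac₁ N cond₁)
      (eventually-× (eventually-Fin n (λ i → eventually-< K (bound₂ i)))
      (eventually-× (eventually-Fin n (λ i → eventually-< K (bound₃ i)))
      (eventually-× (eventually-Fin n (λ i → eventually-class (f i) (nonConst i) (3 ℕ.+ K)))
      (eventually-× (eventually-Fin n (λ i → eventually-≥ (2 ℕ.^ ℤ.∣ key i ∣)))
        (eventually-≥ (3 ℕ.+ K))))))))))

    module _ (p : ℕ) (p-prime : Prime p) (L : Large p p-prime) where

      open Large L
      open Valuation p p-prime
      open BernoulliCongruence p p-prime using (p₁)
      open ClassSums p p-prime using (V-sumOver)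
      open AtPrime p p-prime N M K N≤M+K K+3≤p using (ρ)
      module A = AtPrime p p-prime N M K N≤M+K K+3≤p

      γ : Fin n → ℚ
      γ i = evalRF (g i) P

      index : Fin n → ℕ
      index i = proj₁ (classes i)

      evalZ≡index : ∀ i → evalZ (f i) (+ p) ≡ + index i
      evalZ≡index i = proj₁ (proj₂ (classes i))

      ν : Fin n → ℚ
      ν i = fromℕ (index i)

      evalQ≡ν : ∀ i → evalQ (toQ (f i)) P ≡ ν i
      evalQ≡ν i = trans (evalQ-toQ (f i) (+ p)) (cong fromℤ (evalZ≡index i))

      V-γ : ∀ i → V M (γ i)
      V-γ i = bound-g i (γ i) (value-g i)

      3+K≤index : ∀ i → 3 ℕ.+ K ≤ index i
      3+K≤index i = proj₁ (proj₂ (proj₂ (classes i)))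

      class : ∀ i → Class p₁ (key i) (index i)
      class i = proj₂ (proj₂ (proj₂ (classes i)))

      X : Fin n → ℚ
      X = A.X is key γ index V-γ 3+K≤index class 2^≤p

      Conditions : ℤ → ℚ → ℚ → Set
      Conditions = A.Conditions is key γ index V-γ 3+K≤index class 2^≤p

      classTerm : ℤ → ℚ → ℚ → ℕ → Fin n → ℚ
      classTerm = A.classTerm is key γ index V-γ 3+K≤index class 2^≤p

      V-indicator : ∀ {A : Set} {N x} (d : Dec A) → V N x → V N (indicator d x)
      V-indicator (yes _) v = v
      V-indicator (no _) v = V-0

      -- Beyond m + 1 ≤ N - M one has N - m ≤ M, so the bound on γ alone suffices, the other factor
      -- being integral.
      V-classTerm : ∀ k e κ m → V (+ 0) e → V (+ 0) κ → ¬ (+ suc m ℤ.≤ N ℤ.- M) → ∀ j → V (N ℤ.- + m) (classTerm k e κ m j)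
      V-classTerm k e κ m ve vκ m≰ j = V-mono N-m≤M
        (subst (λ L → V L (classTerm k e κ m j)) (ℤP.+-identityʳ M)
          (V-* (V-indicator (key j ℤP.≟ k) (V-γ j))
               (V-sub (V-^ (suc m) (V-fromℕ (index j))) (V-mul (V-mul ve (V-^ m vκ)) (V-fromℕ (index j))))))
        where
        ring : ∀ N M → N ≡ N ℤ.- M ℤ.+ M
        ring = ℤSolver.solve-∀
        ring′ : ∀ m M → m ℤ.+ M ℤ.- m ≡ M
        ring′ = ℤSolver.solve-∀
        N-m≤M : N ℤ.- + m ℤ.≤ M
        N-m≤M = ℤP.≤-trans (ℤP.+-monoˡ-≤ (ℤ.- + m) (ℤP.≤-trans (ℤP.≤-reflexive (ring N M))
            (ℤP.+-monoˡ-≤ M (ℤP.≮⇒≥ (λ (lt : + m ℤ.< N ℤ.- M) → m≰ (ℤP.i<j⇒suc[i]≤j lt))))))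
          (ℤP.≤-reflexive (ring′ (+ m) M))

      m<K : ∀ {m} → + suc m ℤ.≤ N ℤ.- M → m < K
      m<K m≤ = ℤP.drop‿+≤+ (ℤP.≤-trans m≤ (i≤∣i∣ (N ℤ.- M)))

      Value-class : ∀ k e κ m poly → (∀ j → evalQ (poly j) P ≡ ν j ^ suc m - e * κ ^ m * ν j) →
        Value P (classFrac k poly) (sumOver (classTerm k e κ m) is)
      Value-class k e κ m poly eq = Value-≡ sum≡
        (Value-sumF (filter (λ i → key i ℤP.≟ k) is) (λ j → Value-mulF (value-g j) (Value-polyF P (poly j))))
        where
        F : Fin n → ℚ
        F j = γ j * evalQ (poly j) P
        sum≡ : sumOver F (filter (λ i → key i ℤP.≟ k) is) ≡ sumOver (classTerm k e κ m) is
        sum≡ = trans (sumOver-filter (λ i → key i ℤP.≟ k) F is)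
          (sumOver-cong is (λ j → trans (indicator-* (key j ℤP.≟ k) (γ j) (evalQ (poly j) P))
                                        (cong (indicator (key j ℤP.≟ k) (γ j) *_) (eq j))))

      weaken : ∀ m {x} → V (N ℤ.+ + 1 ℤ.- + suc m) x → V (N ℤ.- + m) x
      weaken m {x} = subst (λ L → V L x) (ring N (+ m))
        where
        ring : ∀ N m → N ℤ.+ + 1 ℤ.- (+ 1 ℤ.+ m) ≡ N ℤ.- m
        ring = ℤSolver.solve-∀

      conditions₂ : ∀ i → Even (key i) → key i ℤ.≤ + 0 → Conditions (key i) 0ℚ 0ℚ
      conditions₂ i ev k≤0 m = by-size (+ suc m ℤP.≤? N ℤ.- M)
        where
        ring : ∀ x y z → x ≡ x - 0ℚ * y * z
        ring = solve-∀ ringℚ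
        eval : ∀ j → evalQ (poly₂ m j) P ≡ ν j ^ suc m - 0ℚ * 0ℚ ^ m * ν j
        eval j = trans (evalQ-powP (toQ (f j)) (suc m) P)
          (trans (cong (_^ suc m) (evalQ≡ν j)) (ring (ν j ^ suc m) (0ℚ ^ m) (ν j)))
        by-size : Dec (+ suc m ℤ.≤ N ℤ.- M) → V (N ℤ.- + m) (sumOver (classTerm (key i) 0ℚ 0ℚ m) is)
        by-size (yes m≤) = weaken m (bound-2 i m (m<K m≤) ev k≤0 m≤ (sumOver (classTerm (key i) 0ℚ 0ℚ m) is)
          (Value-class (key i) 0ℚ 0ℚ m (poly₂ m) eval))
        by-size (no m≰) = V-sumOver is (V-classTerm (key i) 0ℚ 0ℚ m V-0 V-0 m≰)

      conditions₃ : ∀ i → Even (key i) → + 0 ℤ.< key i → Conditions (key i) 1ℚ (fromℤ (key i))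
      -- With exponent 1 the second factor is ν - ν = 0, which is why condition 3 starts at exponent
      -- 2.
      conditions₃ i ev 0<k zero = V-sumOver is
        (λ j → V-≡ (ring (indicator (key j ℤP.≟ key i) (γ j)) (ν j)) V-0)
        where
        ring : ∀ a b → 0ℚ ≡ a * (b * 1ℚ - 1ℚ * 1ℚ * b)
        ring = solve-∀ ringℚ
      conditions₃ i ev 0<k m@(suc m-1) = by-size (+ suc m ℤP.≤? N ℤ.- M)
        where
        k = key i
        eval : ∀ j → evalQ (poly₃ k m j) P ≡ ν j ^ suc m - 1ℚ * fromℤ k ^ m * ν j
        eval j = begin
          evalQ (addP (powP F (suc m)) (negP (scaleP c F))) P
            ≡⟨ evalQ-addP (powP F (suc m)) (negP (scaleP c F)) P ⟩
          evalQ (powP F (suc m)) P + evalQ (negP (scaleP c F)) P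
            ≡⟨ cong₂ _+_ (trans (evalQ-powP F (suc m) P) (cong (_^ suc m) (evalQ≡ν j)))
                         (trans (evalQ-negP (scaleP c F) P) (cong -_ (trans (evalQ-scaleP c F P)
                           (cong₂ _*_ (trans (fromℤ-^ k m) (sym (ℚP.*-identityˡ (fromℤ k ^ m)))) (evalQ≡ν j))))) ⟩
          ν j ^ suc m - 1ℚ * fromℤ k ^ m * ν j ∎
          where
          F = toQ (f j)
          c = fromℤ (k ℤ.^ m)
        by-size : Dec (+ suc m ℤ.≤ N ℤ.- M) → V (N ℤ.- + m) (sumOver (classTerm k 1ℚ (fromℤ k) m) is)
        by-size (yes m≤) = weaken m (bound-3 i m (m<K m≤) ev 0<k (s≤s z≤n) m≤ (sumOver (classTerm k 1ℚ (fromℤ k) m) is)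
          (Value-class k 1ℚ (fromℤ k) m (poly₃ k m) eval))
        by-size (no m≰) = V-sumOver is (V-classTerm k 1ℚ (fromℤ k) m (V-fromℤ (+ 1)) (V-fromℤ k) m≰)

      V-X : V N (sumOver X is)
      V-X = V-partition p p-prime key is is X (λ i → inj₂ (Any.map (cong key) (∈-allFin i)))
        (A.class-vanishes is key γ index V-γ 3+K≤index class 2^≤p conditions₂ conditions₃)

      is₀ is₂ : List (Fin n)
      is₀ = filter (λ i → key i ℤP.≟ + 0) is
      is₂ = filter (λ i → + 2 ℤP.≤? key i) is

      kummerTerm : Fin n → ℚ
      kummerTerm i = evalQ (kummerPoly ℤ.∣ key i ∣) P * (γ i * ν i)

      q₁ : ℚ
      q₁ = evalRF g0 P - ρ * sumOver γ is₀ - sumOver kummerTerm is₂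

      value-ρ : Value P oneMinusInvT ρ
      value-ρ = value (≢-≡ (ring P) P≢0) (trans (ring′ P) (trans (sym A.P*ρ) (ring″ P ρ)))
        where
        ring : ∀ p → 0ℚ + p * (1ℚ + p * 0ℚ) ≡ p
        ring = solve-∀ ringℚ
        ring′ : ∀ p → - 1ℚ + p * (1ℚ + p * 0ℚ) ≡ p - 1ℚ
        ring′ = solve-∀ ringℚ
        ring″ : ∀ p r → p * r ≡ r * (0ℚ + p * (1ℚ + p * 0ℚ))
        ring″ = solve-∀ ringℚ

      V-q₁ : V N q₁
      V-q₁ = bound-1 q₁ (Value-subF (Value-subF value-g0 (Value-mulF value-ρ (Value-sumF is₀ value-g)))
        (Value-sumF is₂ (λ i → Value-mulF (Value-polyF P (kummerPoly ℤ.∣ key i ∣))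
          (Value-mulF (value-g i) (Value-≡ (evalQ≡ν i) (Value-polyF P (toQ (f i))))))))

      -- The main terms removed from the summands of `X` are those that condition 1 compares with
      -- g₀(p), so subtracting `q₁` cancels them and leaves the difference in the congruence.
      total : sumOver X is - q₁ ≡ bernSum f g p - evalRF g0 P
      total = begin
        sumOver X is - q₁
          ≡⟨ cong (_- q₁) (trans (sumOver-cong is (λ i → ring (γ i * Bern (index i)) (T i)))
                                 (trans (sumOver-+ (λ i → γ i * Bern (index i)) (λ i → (- 1ℚ) * T i) is)
                                        (cong (λ z → S + z) (sumOver-* (- 1ℚ) T is)))) ⟩
        S + (- 1ℚ) * sumOver T is - q₁
          ≡⟨ cong (λ z → S + (- 1ℚ) * z - q₁) (trans (sumOver-+ (λ i → indicator (key i ℤP.≟ + 0) (ρ * γ i)) (λ i → indicator (+ 2 ℤP.≤? key i) (kummerTerm i)) is)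
               (cong₂ _+_ (trans (sym (sumOver-filter (λ i → key i ℤP.≟ + 0) (λ i → ρ * γ i) is)) (sumOver-* ρ γ is₀))
                          (sym (sumOver-filter (λ i → + 2 ℤP.≤? key i) kummerTerm is)))) ⟩
        S + (- 1ℚ) * (ρ * sumOver γ is₀ + sumOver kummerTerm is₂) - q₁
          ≡⟨ ring′ S (ρ * sumOver γ is₀) (sumOver kummerTerm is₂) (evalRF g0 P) ⟩
        S - evalRF g0 P
          ≡⟨ cong (_- evalRF g0 P) (sumOver-cong is (λ i → cong (λ z → γ i * Bern ℤ.∣ z ∣) (sym (evalZ≡index i)))) ⟩
        bernSum f g p - evalRF g0 P ∎
        where
        T : Fin n → ℚ
        T i = mainTerm ρ P (key i) (γ i) (ν i)
        S = sumOver (λ i → γ i * Bern (index i)) is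
        ring : ∀ a b → a - b ≡ a + (- 1ℚ) * b
        ring = solve-∀ ringℚ
        ring′ : ∀ s a b c → s + (- 1ℚ) * (a + b) - (c - a - b) ≡ s - c
        ring′ = solve-∀ ringℚ

      congruence : CongModPow p N (bernSum f g p) (evalRF g0 (fromℕ p))
      congruence = V⇒InPpowN (V-≡ total (V-sub V-X V-q₁))

  large-primes : Eventually (λ p _ → CongModPow p N (bernSum f g p) (evalRF g0 (fromℕ p)))
  large-primes = eventually-map congruence eventually-large

theorem1p1 : (N : ℤ) (n : ℕ) (f : Fin n → PolyZ) (g0 : RatFun) (g : Fin n → RatFun)
    → (∀ i → NonConstPosLead (f i))
    → Cond1 N f g0 g
    → Cond2 N f g0 g
    → Cond3 N f g0 g
    → ∃ λ (P : ℕ) → ∀ (p : ℕ) → Prime p → P ≤ p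
    → CongModPow p N (bernSum f g p) (evalRF g0 (fromℕ p))
theorem1p1 N n f g0 g nonConst cond₁ cond₂ cond₃ = large-primes N n f g0 g nonConst cond₁ cond₂ cond₃ M applicable vt≥M
  where
  bound = lower-bound N n g0 g
  M = proj₁ bound
  applicable = proj₁ (proj₂ bound)
  vt≥M = proj₂ (proj₂ bound)
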